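{- Let $k\ge 2$, let $\pi\in S_k$, let $A\subseteq\{1,\dots,k-1\}$, and let $j=k-|A|$ be the number of blocks of the vincular pattern $(\pi,A)$. For each $n$ let $\sigma_n$ be a uniformly random element of $S_n$ and let $X^{(\pi,A)}(\sigma_n)$ be the number of occurrences of $(\pi,A)$ in $\sigma_n$. Then there exist $C>0$ and $n_0$ such that for all $n\ge n_0$, $$\operatorname{Var}\bigl(X^{(\pi,A)}(\sigma_n)\bigr)\ge C\,n^{2j-1}.$$
   Context: $S_n$ is the set of permutations of $\{1,\dots,n\}$, written in one-line notation $\sigma=\sigma_1\sigma_2\dots\sigma_n$. A vincular pattern of size $k$ is a pair $(\pi,A)$ with $\pi\in S_k$ and $A\subseteq\{1,\dots,k-1\}$; its number of blocks is $j=k-|A|$. An occurrence of $(\pi,A)$ in $\sigma\in S_n$ is a subsequence $\sigma_{i_1}\sigma_{i_2}\dots\sigma_{i_k}$ with $i_1<i_2<\dots<i_k$ (identified with its set of positions $\{i_1,\dots,i_k\}$) such that (i) for all $r,s\in\{1,\dots,k\}$, $\pi_r<\pi_s \iff \sigma_{i_r}<\sigma_{i_s}$; and (ii) $i_{a+1}=i_a+1$ for all $a\in A$. -}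

module Defs where

open import Data.Fin.Base as Fin using (Fin; zero; suc; toℕ; inject₁)
open import Data.Fin.Permutation as Perm
  using (Permutation′; _⟨$⟩ʳ_; insert; remove; insert-remove)
open import Data.Fin.Properties as Finₚ using (all?)
open import Data.Fin.Subset using (Subset; _∈_; ∣_∣)
open import Data.Fin.Subset.Properties using (_∈?_)
open import Data.Integer.Base using (+_)
open import Data.List.Base as List
  using (List; []; _∷_; [_]; allFin; cartesianProductWith; filter; foldr; length)
open import Data.List.Membership.Propositional using () renaming (_∈_ to _∈ˡ_)
open import Data.List.Membership.Propositional.Properties
  using (∈-allFin; ∈-cartesianProductWith⁺)
open import Data.List.Properties using (length-++; length-map; length-tabulate)
open import Data.List.Relation.Unary.Any using (Any; here)
open import Data.List.Relation.Unary.All using ([])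
open import Data.List.Relation.Unary.AllPairs using ([]; _∷_)
import Data.List.Relation.Unary.Any.Properties as Anyₚ
import Data.List.Relation.Unary.Unique.Propositional as Unique
import Data.List.Relation.Unary.Unique.Setoid as UniqueS
import Data.List.Relation.Unary.Unique.Propositional.Properties as Uniqueₚ
import Data.List.Relation.Unary.Unique.Setoid.Properties as UniqueSₚ
open import Data.Nat.Base as ℕ using (ℕ; zero; suc; pred; _∸_; _!)
open import Data.Nat.Properties as ℕₚ using (_!≢0)
open import Data.Product.Base using (_×_; _,_; uncurry)
open import Data.Rational.Base using (ℚ; 0ℚ; _/_; _+_; _-_; _*_)
open import Data.Vec.Base as Vec using (Vec; []; _∷_; lookup)
open import Data.Vec.Properties using (∷-injective)
open import Data.Vec.Relation.Unary.Linked using (Linked; linked?)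
open import Function.Bundles using (_⇔_; mk⇔; module Equivalence)
open import Level using (0ℓ)
open import Relation.Binary.Bundles using (Setoid)
open import Relation.Binary.PropositionalEquality
  using (_≡_; refl; sym; trans; cong; cong₂; setoid)
open import Relation.Nullary.Decidable using (Dec; map′; _×-dec_; _→-dec_)

-- A vincular pattern of size k is a pair (π , A) with π : Permutation′ k and
-- A : Subset (pred k). Indices are 0-based: the element a of A stands for
-- a + 1 ∈ {1,…,k-1}, i.e. for the adjacent pair of indices left a, right a.

left right : ∀ {k} → Fin (pred k) → Fin k
left  {suc k} a = inject₁ a
right {suc k} a = suc a

blocks : ∀ k → Subset (pred k) → ℕ
blocks k A = k ∸ ∣ A ∣

-- Since occurrences are listed in increasing order, the vector i of positions
-- and the set {i₁,…,i_k} determine each other.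

record IsOccurrence {k n} (π : Permutation′ k) (A : Subset (pred k))
                    (σ : Permutation′ n) (i : Vec (Fin n) k) : Set where
  constructor isOccurrence
  field
    increasing : Linked Fin._<_ i
    sameOrder  : ∀ r s → (π ⟨$⟩ʳ r Fin.< π ⟨$⟩ʳ s) ⇔
                         (σ ⟨$⟩ʳ lookup i r Fin.< σ ⟨$⟩ʳ lookup i s)
    adjacent   : ∀ a → a ∈ A →
                 toℕ (lookup i (right a)) ≡ suc (toℕ (lookup i (left a)))

private
  infix 2 _⇔-dec_

  _⇔-dec_ : ∀ {P Q : Set} → Dec P → Dec Q → Dec (P ⇔ Q)
  p? ⇔-dec q? = map′ (uncurry mk⇔) (λ e → Equivalence.to e , Equivalence.from e)
                     ((p? →-dec q?) ×-dec (q? →-dec p?))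

isOccurrence? : ∀ {k n} (π : Permutation′ k) (A : Subset (pred k))
                (σ : Permutation′ n) (i : Vec (Fin n) k) →
                Dec (IsOccurrence π A σ i)
isOccurrence? π A σ i =
  map′ (λ (p , q , r) → isOccurrence p q r)
       (λ (isOccurrence p q r) → p , q , r)
       (linked? Finₚ._<?_ i
        ×-dec all? (λ r → all? λ s →
                (π ⟨$⟩ʳ r Finₚ.<? π ⟨$⟩ʳ s) ⇔-dec
                (σ ⟨$⟩ʳ lookup i r Finₚ.<? σ ⟨$⟩ʳ lookup i s))
        ×-dec all? (λ a → (a ∈? A) →-dec
                (toℕ (lookup i (right a)) ℕₚ.≟ suc (toℕ (lookup i (left a))))))

vectors : ∀ n k → List (Vec (Fin n) k)
vectors n zero    = [ [] ]
vectors n (suc k) = cartesianProductWith _∷_ (allFin n) (vectors n k)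

occurrences : ∀ {k} (π : Permutation′ k) (A : Subset (pred k)) {n} →
              Permutation′ n → ℕ
occurrences {k} π A {n} σ = length (filter (isOccurrence? π A σ) (vectors n k))

-- S_n, listed by choosing the image of the first element and then a
-- permutation of the rest. Permutations are functions, so the list is
-- exhaustive and repetition-free up to pointwise equality Perm._≈_.

permutations : ∀ n → List (Permutation′ n)
permutations zero    = [ Perm.id ]
permutations (suc n) =
  cartesianProductWith (insert zero) (allFin (suc n)) (permutations n)

-- Expectation and variance for the uniform distribution on S_n. Every random
-- variable on S_n considered here is rational-valued, so ℚ suffices.

sumℚ : List ℚ → ℚ
sumℚ = foldr _+_ 0ℚ

𝔼 : ∀ {n} → (Permutation′ n → ℚ) → ℚ
𝔼 {n} X = (+ 1 / n !) {{n !≢0}} * sumℚ (List.map X (permutations n))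

Var : ∀ {n} → (Permutation′ n → ℚ) → ℚ
Var X = 𝔼 λ σ → (X σ - 𝔼 X) * (X σ - 𝔼 X)

fromℕ : ℕ → ℚ
fromℕ m = + m / 1

vectors-complete : ∀ {n k} (v : Vec (Fin n) k) → v ∈ˡ vectors n k
vectors-complete []      = here refl
vectors-complete (x ∷ v) = ∈-cartesianProductWith⁺ _∷_ (∈-allFin x) (vectors-complete v)

vectors-unique : ∀ n k → Unique.Unique (vectors n k)
vectors-unique n zero    = [] ∷ []
vectors-unique n (suc k) =
  Uniqueₚ.cartesianProductWith⁺ _∷_ ∷-injective (Uniqueₚ.allFin⁺ n) (vectors-unique n k)

permutationSetoid : ℕ → Setoid 0ℓ 0ℓ
permutationSetoid n = record
  { Carrier = Permutation′ n
  ; _≈_ = Perm._≈_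
  ; isEquivalence = record
    { refl  = λ _ → refl
    ; sym   = λ p i → sym (p i)
    ; trans = λ p q i → trans (p i) (q i)
    }
  }

private
  insert-cong : ∀ {n} {i j : Fin (suc n)} {σ τ : Permutation′ n} →
                i ≡ j → σ Perm.≈ τ → insert zero i σ Perm.≈ insert zero j τ
  insert-cong refl σ≈τ zero    = refl
  insert-cong {i = i} refl σ≈τ (suc l) = cong (Fin.punchIn i) (σ≈τ l)

  insert-injective : ∀ {n} {i j : Fin (suc n)} {σ τ : Permutation′ n} →
                     insert zero i σ Perm.≈ insert zero j τ → i ≡ j × σ Perm.≈ τ
  insert-injective {i = i} {j} {σ} {τ} e with e zero
  ... | refl = refl , λ l → Finₚ.punchIn-injective i _ _ (e (suc l))

permutations-complete : ∀ {n} (σ : Permutation′ n) → Any (σ Perm.≈_) (permutations n)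
permutations-complete {zero}  σ = here λ ()
permutations-complete {suc n} σ =
  Anyₚ.cartesianProductWith⁺ (insert zero)
    (λ {i} {τ} p q → λ l → trans (sym (insert-remove zero σ l)) (insert-cong p q l))
    (∈-allFin (σ ⟨$⟩ʳ zero)) (permutations-complete (remove zero σ))

permutations-unique : ∀ n → UniqueS.Unique (permutationSetoid n) (permutations n)
permutations-unique zero    = [] ∷ []
permutations-unique (suc n) =
  UniqueSₚ.cartesianProductWith⁺ (setoid _) (permutationSetoid n) (permutationSetoid (suc n))
    (insert zero) insert-injective (Uniqueₚ.allFin⁺ (suc n)) (permutations-unique n)

private
  length-cartesianProductWith : ∀ {A B C : Set} (f : A → B → C) xs ys →
    length (cartesianProductWith f xs ys) ≡ length xs ℕ.* length ys
  length-cartesianProductWith f []       ys = refl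
  length-cartesianProductWith f (x ∷ xs) ys =
    trans (length-++ (List.map (f x) ys))
          (cong₂ ℕ._+_ (length-map (f x) ys) (length-cartesianProductWith f xs ys))

length-permutations : ∀ n → length (permutations n) ≡ n !
length-permutations zero    = refl
length-permutations (suc n) =
  trans (length-cartesianProductWith (insert zero) (allFin (suc n)) (permutations n))
        (cong₂ ℕ._*_ (length-tabulate {n = suc n} (λ i → i)) (length-permutations n))

{-# OPTIONS --safe #-}
module Submission where

-- For a statistic Y with mean 0, Var X ≥ 2 t E[XY] - t² E[Y²] for every t, so
-- it suffices to find Y with E[Y²] small and E[XY] large.
--
-- One block. Cut the positions into windows of length 3k and let Y compare, in
-- every window, the event that σ increases there with the event that it does so
-- up to a fixed rearrangement of the middle k positions. The windows are
-- orthogonal, and rearranging an increasing window changes X by at least 1, in a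
-- direction that depends only on π; hence E[Y²] ≤ n and |E[XY]| ≥ c n.
--
-- j ≥ 2 blocks. Let Y be n times the centred number of points of σ in the box
-- [1,h]×[1,h] with h a small multiple of n, so that E[Y²] ≤ n³. Fix the positions
-- i of a potential occurrence. A position off i is uncorrelated with the pattern
-- at i, and the covariances over all positions add up to 0. At a position of i
-- other than that of the minimum of π, a value ≤ h forces two values ≤ h, so the
-- covariance is about - h / k! there. Thus the sign of the contribution of i is
-- given by whether the minimum or the other entries lie among the first h
-- positions. If the minimum is in the first block, only the few i close to the
-- boundary h contribute negatively; if not, only those i with two blocks among
-- the first h positions contribute positively. Since the i with exactly the first
-- block there are of order h n^(j-1), it follows that |E[XY]| ≥ c n^(j+1).

open import Defs

-- Why two test statistics: the fixed gain in a window relies on every occurrence that meets the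
-- middle of the window staying inside it, which holds for a single block only. The box, conversely,
-- notices an occurrence only if the boundary h separates its positions; for a single block fewer
-- than k position sets are separated, and the covariance would have order n where n^2 is required.
-- Why the minimum, and why h is small: computing the linear projection of X would need a separate
-- discussion of each π. Two prescribed small values have probability at most (h/n)^2, negligible
-- against h/n once 2 k! h ≤ n, so no finer information on π enters. The covariance at the minimum
-- itself is never estimated: since all covariances add up to 0, it can be eliminated. With t
-- constant for j = 1 and of order n^(j-2) for j ≥ 2, both terms of the quadratic bound have order
-- n^(2j-1). The estimates are made with integer sums over S_n; factors such as n and k! are kept on
-- one side instead of being divided out.

module VarianceBound where

  open import Data.Empty using (⊥-elim)
  open import Data.Fin.Base as Fin using (Fin; zero; suc; toℕ; inject₁; punchIn; punchOut)
  open import Data.Fin.Induction using (<-weakInduction)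
  open import Data.Fin.Permutation as Perm using (Permutation′; _⟨$⟩ʳ_; _⟨$⟩ˡ_; _∘ₚ_; insert)
  open import Data.Fin.Properties as Finₚ using (all?; any?)
  open import Data.Fin.Subset using (Subset; _∈_; _∉_; ∣_∣; ∁; inside; outside)
  open import Data.Fin.Subset.Properties using (_∈?_; ∣∁p∣≡n∸∣p∣; ∣p∣≤n; drop-there)
  open import Data.Integer.Base hiding (suc; pred; _/_; _%_; _^_; ∣_∣)
  open import Data.Integer.Properties hiding (_≟_)
  open import Data.Integer.Tactic.RingSolver using (solve-∀)
  open import Data.List.Base as List using (List; []; _∷_; _++_; allFin; cartesianProductWith; filter; length)
  open import Data.List.Membership.Propositional.Properties using (∈-allFin)
  open import Data.List.Properties using (length-tabulate; map-tabulate)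
  open import Data.List.Relation.Unary.All using (All; []; _∷_)
  open import Data.List.Relation.Unary.AllPairs using ([]; _∷_)
  open import Data.List.Relation.Unary.Any using (Any; here; there)
  import Data.List.Relation.Unary.Unique.Propositional.Properties as Uniqueₚ
  import Data.List.Relation.Unary.Unique.Setoid as UniqueS
  open import Data.Nat.Base as ℕ using (ℕ; zero; suc; _!)
  open import Data.Nat.DivMod using (m≡m%n+[m/n]*n; m%n≤n; m/n*n≤m; m/n≤m; m≥n⇒m/n>0; m*n/n≡m; /-monoˡ-≤)
  import Data.Nat.Properties as ℕₚ
  open import Data.Nat.Tactic.RingSolver using () renaming (solve-∀ to ℕ-solve-∀)
  open import Data.Product.Base using (Σ-syntax; ∃; _×_; _,_; proj₁; proj₂; uncurry)
  open import Data.Rational.Base as ℚ using (ℚ; 0ℚ; 1ℚ; _/_; toℚᵘ)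
  import Data.Rational.Properties as ℚₚ
  open import Data.Rational.Solver using (module +-*-Solver)
  open import Data.Rational.Unnormalised.Base as ℚᵘ using (mkℚᵘ; *≡*)
  import Data.Rational.Unnormalised.Properties as ℚᵘₚ
  open import Data.Sum.Base using (_⊎_; inj₁; inj₂)
  open import Data.Unit.Base using (⊤; tt)
  open import Data.Vec.Base as Vec using (Vec; []; _∷_; lookup; here; there)
  open import Data.Vec.Properties using (≡-dec; lookup∘tabulate)
  open import Data.Vec.Relation.Unary.Linked using (Linked; linked?; []; [-]; _∷_)
  open import Data.Vec.Relation.Unary.Linked.Properties using (lookup⁺)
  open import Function.Base using (_∘_; case_of_)
  open import Function.Bundles using (_⇔_; mk⇔; module Equivalence)
  open import Function.Definitions using (Injective)
  open import Level using (0ℓ)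
  open import Relation.Binary.Bundles using (Setoid)
  open import Relation.Binary.Definitions using (tri<; tri≈; tri>)
  open import Relation.Binary.PropositionalEquality
  open import Relation.Nullary using (¬_; Dec; yes; no)
  open import Relation.Nullary.Decidable using (map′; ¬?; decidable-stable; _×-dec_; _→-dec_)
  open import Relation.Nullary.Negation using (contradiction)

  private variable
    A B : Set
    P Q R : Set
    k m n : ℕ

  -- Finite sums and indicators

  +-congˡ : ∀ a {b c : ℤ} → b ≡ c → a + b ≡ a + c
  +-congˡ a = cong (λ z → a + z)

  ∑ : List A → (A → ℤ) → ℤ
  ∑ []       f = 0ℤ
  ∑ (x ∷ xs) f = f x + ∑ xs f

  infix 5 ∑
  syntax ∑ xs (λ x → e) = ∑[ x ∈ xs ] e

  ⟦_⟧ : Dec P → ℤ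
  ⟦ yes _ ⟧ = 1ℤ
  ⟦ no  _ ⟧ = 0ℤ

  ∑-cong : ∀ (xs : List A) {f g : A → ℤ} → (∀ x → f x ≡ g x) → ∑ xs f ≡ ∑ xs g
  ∑-cong []       f≗g = refl
  ∑-cong (x ∷ xs) f≗g = cong₂ _+_ (f≗g x) (∑-cong xs f≗g)

  ∑-mono : ∀ (xs : List A) {f g : A → ℤ} → (∀ x → f x ≤ g x) → ∑ xs f ≤ ∑ xs g
  ∑-mono []       f≤g = ≤-refl
  ∑-mono (x ∷ xs) f≤g = +-mono-≤ (f≤g x) (∑-mono xs f≤g)

  ∑-0 : ∀ (xs : List A) → ∑[ x ∈ xs ] 0ℤ ≡ 0ℤ
  ∑-0 []       = refl
  ∑-0 (x ∷ xs) = trans (+-identityˡ _) (∑-0 xs)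

  ∑-≡0 : ∀ (xs : List A) {f : A → ℤ} → (∀ x → f x ≡ 0ℤ) → ∑ xs f ≡ 0ℤ
  ∑-≡0 xs f≡0 = trans (∑-cong xs f≡0) (∑-0 xs)

  ∑-0≤ : ∀ (xs : List A) {f : A → ℤ} → (∀ x → 0ℤ ≤ f x) → 0ℤ ≤ ∑ xs f
  ∑-0≤ xs 0≤f = ≤-trans (≤-reflexive (sym (∑-0 xs))) (∑-mono xs 0≤f)

  ∑-+ : ∀ (xs : List A) (f g : A → ℤ) → ∑[ x ∈ xs ] (f x + g x) ≡ ∑ xs f + ∑ xs g
  ∑-+ []       f g = refl
  ∑-+ (x ∷ xs) f g = trans (+-congˡ (f x + g x) (∑-+ xs f g)) (shuffle (f x) (g x) _ _)
    where
    shuffle : ∀ a b c d → (a + b) + (c + d) ≡ (a + c) + (b + d)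
    shuffle = solve-∀

  ∑-*ˡ : ∀ (xs : List A) c (f : A → ℤ) → ∑[ x ∈ xs ] (c * f x) ≡ c * ∑ xs f
  ∑-*ˡ []       c f = sym (*-zeroʳ c)
  ∑-*ˡ (x ∷ xs) c f = trans (+-congˡ (c * f x) (∑-*ˡ xs c f)) (sym (*-distribˡ-+ c (f x) _))

  ∑-*ʳ : ∀ (xs : List A) c (f : A → ℤ) → ∑[ x ∈ xs ] (f x * c) ≡ ∑ xs f * c
  ∑-*ʳ xs c f = trans (∑-cong xs (λ x → *-comm (f x) c)) (trans (∑-*ˡ xs c f) (*-comm c _))

  ∑-- : ∀ (xs : List A) (f g : A → ℤ) → ∑[ x ∈ xs ] (f x - g x) ≡ ∑ xs f - ∑ xs g
  ∑-- []       f g = refl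
  ∑-- (x ∷ xs) f g = trans (+-congˡ (f x - g x) (∑-- xs f g)) (shuffle (f x) (g x) _ _)
    where
    shuffle : ∀ a b c d → (a - b) + (c - d) ≡ (a + c) - (b + d)
    shuffle = solve-∀

  ∑-swap : ∀ (xs : List A) (ys : List B) (f : A → B → ℤ) →
           ∑[ x ∈ xs ] ∑[ y ∈ ys ] f x y ≡ ∑[ y ∈ ys ] ∑[ x ∈ xs ] f x y
  ∑-swap []       ys f = sym (∑-0 ys)
  ∑-swap (x ∷ xs) ys f = trans (+-congˡ (∑ ys (f x)) (∑-swap xs ys f)) (sym (∑-+ ys (f x) _))

  ∑-++ : ∀ (xs ys : List A) (f : A → ℤ) → ∑ (xs ++ ys) f ≡ ∑ xs f + ∑ ys f
  ∑-++ []       ys f = sym (+-identityˡ _)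
  ∑-++ (x ∷ xs) ys f = trans (+-congˡ (f x) (∑-++ xs ys f)) (sym (+-assoc (f x) _ _))

  ∑-map : ∀ (g : A → B) xs (f : B → ℤ) → ∑ (List.map g xs) f ≡ ∑[ x ∈ xs ] f (g x)
  ∑-map g []       f = refl
  ∑-map g (x ∷ xs) f = +-congˡ (f (g x)) (∑-map g xs f)

  ∑-cartesianProductWith : ∀ {C : Set} (g : A → B → C) xs ys (f : C → ℤ) →
    ∑ (cartesianProductWith g xs ys) f ≡ ∑[ x ∈ xs ] ∑[ y ∈ ys ] f (g x y)
  ∑-cartesianProductWith g []       ys f = refl
  ∑-cartesianProductWith g (x ∷ xs) ys f =
    trans (∑-++ (List.map (g x) ys) _ f)
          (cong₂ _+_ (∑-map (g x) ys f) (∑-cartesianProductWith g xs ys f))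

  ∑-const : ∀ (xs : List A) c → ∑[ x ∈ xs ] c ≡ + length xs * c
  ∑-const []       c = sym (*-zeroˡ c)
  ∑-const (x ∷ xs) c = trans (+-congˡ c (∑-const xs c)) (sym (suc-* (+ length xs) c))

  length-filter : ∀ {P : A → Set} (P? : ∀ x → Dec (P x)) xs →
                  + length (filter P? xs) ≡ ∑[ x ∈ xs ] ⟦ P? x ⟧
  length-filter P? []       = refl
  length-filter P? (x ∷ xs) with P? x
  ... | yes _ = +-congˡ 1ℤ (length-filter P? xs)
  ... | no  _ = trans (length-filter P? xs) (sym (+-identityˡ _))

  ⟦⟧-yes : (P? : Dec P) → P → ⟦ P? ⟧ ≡ 1ℤ
  ⟦⟧-yes (yes _) p = refl
  ⟦⟧-yes (no ¬p) p = contradiction p ¬p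

  ⟦⟧-no : (P? : Dec P) → ¬ P → ⟦ P? ⟧ ≡ 0ℤ
  ⟦⟧-no (yes p) ¬p = contradiction p ¬p
  ⟦⟧-no (no _)  ¬p = refl

  ⟦⟧-mono : (P? : Dec P) (Q? : Dec Q) → (P → Q) → ⟦ P? ⟧ ≤ ⟦ Q? ⟧
  ⟦⟧-mono (yes p) Q?      f = ≤-reflexive (sym (⟦⟧-yes Q? (f p)))
  ⟦⟧-mono (no _)  (yes _) f = +≤+ ℕ.z≤n
  ⟦⟧-mono (no _)  (no _)  f = ≤-refl

  ⟦⟧-cong : (P? : Dec P) (Q? : Dec Q) → (P → Q) → (Q → P) → ⟦ P? ⟧ ≡ ⟦ Q? ⟧
  ⟦⟧-cong P? Q? f g = ≤-antisym (⟦⟧-mono P? Q? f) (⟦⟧-mono Q? P? g)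

  0≤⟦⟧ : (P? : Dec P) → 0ℤ ≤ ⟦ P? ⟧
  0≤⟦⟧ (yes _) = +≤+ ℕ.z≤n
  0≤⟦⟧ (no _)  = ≤-refl

  ⟦⟧≤1 : (P? : Dec P) → ⟦ P? ⟧ ≤ 1ℤ
  ⟦⟧≤1 (yes _) = ≤-refl
  ⟦⟧≤1 (no _)  = +≤+ ℕ.z≤n

  ⟦⟧-× : (P? : Dec P) (Q? : Dec Q) (R? : Dec R) → (R → P × Q) → (P → Q → R) →
         ⟦ R? ⟧ ≡ ⟦ P? ⟧ * ⟦ Q? ⟧
  ⟦⟧-× (yes p) (yes q) R? to from = ⟦⟧-yes R? (from p q)
  ⟦⟧-× (yes p) (no ¬q) R? to from = ⟦⟧-no R? (¬q ∘ proj₂ ∘ to)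
  ⟦⟧-× (no ¬p) Q?      R? to from = trans (⟦⟧-no R? (¬p ∘ proj₁ ∘ to)) (sym (*-zeroˡ ⟦ Q? ⟧))

  -- Reindexing

  -- Completeness and absence of repetition are merged into one sum of indicators, the form in which
  -- `∑-pick` and `∑-reindex` consume them. A setoid is needed because permutations are listed up to
  -- pointwise equality.
  record Enumeration (S : Setoid 0ℓ 0ℓ) : Set where
    open Setoid S
    field
      _≟_    : ∀ x y → Dec (x ≈ y)
      list   : List Carrier
      once   : ∀ x → ∑[ y ∈ list ] ⟦ y ≟ x ⟧ ≡ 1ℤ

  module _ (S : Setoid 0ℓ 0ℓ) (_≟_ : ∀ x y → Dec (Setoid._≈_ S x y)) where

    open Setoid S using (Carrier; _≈_)

    private
      absent : ∀ {x ys} → ¬ Any (x ≈_) ys → ∑[ y ∈ ys ] ⟦ y ≟ x ⟧ ≡ 0ℤ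
      absent {ys = []}     x∉ = refl
      absent {ys = y ∷ ys} x∉ =
        cong₂ _+_ (⟦⟧-no (y ≟ _) λ y≈x → x∉ (here (Setoid.sym S y≈x))) (absent (x∉ ∘ there))

      first-absent : ∀ {x y ys} → y ≈ x → All (λ z → ¬ y ≈ z) ys → ¬ Any (x ≈_) ys
      first-absent y≈x (y≉z ∷ _)  (here x≈z) = y≉z (Setoid.trans S y≈x x≈z)
      first-absent y≈x (_ ∷ y∉ys) (there p)  = first-absent y≈x y∉ys p

      later-absent : ∀ {x y ys} → Any (x ≈_) ys → All (λ z → ¬ y ≈ z) ys → ¬ y ≈ x
      later-absent (here x≈z) (y≉z ∷ _) y≈x = y≉z (Setoid.trans S y≈x x≈z)
      later-absent (there p)  (_ ∷ y∉)  y≈x = later-absent p y∉ y≈x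

      occursOnce : ∀ {x ys} → UniqueS.Unique S ys → Any (x ≈_) ys → ∑[ y ∈ ys ] ⟦ y ≟ x ⟧ ≡ 1ℤ
      occursOnce {x} (y∉ys ∷ u) (here x≈y) =
        cong₂ _+_ (⟦⟧-yes (_ ≟ x) (Setoid.sym S x≈y)) (absent (first-absent (Setoid.sym S x≈y) y∉ys))
      occursOnce {x} (y∉ys ∷ u) (there p) =
        cong₂ _+_ (⟦⟧-no (_ ≟ x) (later-absent p y∉ys)) (occursOnce u p)

    enumeration : ∀ xs → UniqueS.Unique S xs → (∀ x → Any (x ≈_) xs) → Enumeration S
    enumeration xs unique complete = record
      { _≟_ = _≟_ ; list = xs ; once = λ x → occursOnce unique (complete x) }

  module _ {S : Setoid 0ℓ 0ℓ} (E : Enumeration S) where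
    open Setoid S using (Carrier; _≈_)
    open Enumeration E

    ∑-pick : ∀ x (f : Carrier → ℤ) → (∀ {y z} → y ≈ z → f y ≡ f z) →
             ∑[ y ∈ list ] ⟦ y ≟ x ⟧ * f y ≡ f x
    ∑-pick x f f-resp = begin
      ∑[ y ∈ list ] ⟦ y ≟ x ⟧ * f y  ≡⟨ ∑-cong list pointwise ⟩
      ∑[ y ∈ list ] ⟦ y ≟ x ⟧ * f x  ≡⟨ ∑-*ʳ list (f x) _ ⟩
      (∑[ y ∈ list ] ⟦ y ≟ x ⟧) * f x ≡⟨ cong (_* f x) (once x) ⟩
      1ℤ * f x                         ≡⟨ *-identityˡ (f x) ⟩
      f x                              ∎
      where
      open ≡-Reasoning
      pointwise : ∀ y → ⟦ y ≟ x ⟧ * f y ≡ ⟦ y ≟ x ⟧ * f x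
      pointwise y with y ≟ x
      ... | yes y≈x = cong (1ℤ *_) (f-resp y≈x)
      ... | no _    = refl

    -- Each `f (φ x)` is written as a sum of `f y` against the indicator of `y ≈ φ x`. After
    -- exchanging the sums, this indicator is that of `x ≈ ψ y` and adds up to 1 over `x`. No
    -- rearrangement of lists is involved.
    ∑-reindex : ∀ (φ ψ : Carrier → Carrier) → (∀ {x y} → y ≈ φ x → x ≈ ψ y) →
                (∀ {x y} → x ≈ ψ y → y ≈ φ x) →
                ∀ (f : Carrier → ℤ) → (∀ {x y} → x ≈ y → f x ≡ f y) →
                ∑[ x ∈ list ] f (φ x) ≡ ∑ list f
    ∑-reindex φ ψ to from f f-resp = begin
      ∑[ x ∈ list ] f (φ x)                           ≡⟨ ∑-cong list (λ x → sym (∑-pick (φ x) f f-resp)) ⟩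
      ∑[ x ∈ list ] ∑[ y ∈ list ] ⟦ y ≟ φ x ⟧ * f y  ≡⟨ ∑-swap list list _ ⟩
      ∑[ y ∈ list ] ∑[ x ∈ list ] ⟦ y ≟ φ x ⟧ * f y  ≡⟨ ∑-cong list (λ y → ∑-*ʳ list (f y) _) ⟩
      ∑[ y ∈ list ] (∑[ x ∈ list ] ⟦ y ≟ φ x ⟧) * f y
        ≡⟨ ∑-cong list (λ y → cong (_* f y)
             (trans (∑-cong list (λ x → ⟦⟧-cong (y ≟ φ x) (x ≟ ψ y) to from)) (once (ψ y)))) ⟩
      ∑[ y ∈ list ] 1ℤ * f y                          ≡⟨ ∑-cong list (λ y → *-identityˡ (f y)) ⟩
      ∑ list f                                        ∎
      where open ≡-Reasoning

  finEnumeration : ∀ n → Enumeration (setoid (Fin n))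
  finEnumeration n = enumeration (setoid (Fin n)) Finₚ._≟_ (allFin n) (Uniqueₚ.allFin⁺ n) ∈-allFin

  vecEnumeration : ∀ n k → Enumeration (setoid (Vec (Fin n) k))
  vecEnumeration n k = enumeration (setoid _) (≡-dec Finₚ._≟_) (vectors n k) (vectors-unique n k) vectors-complete

  permEnumeration : ∀ n → Enumeration (permutationSetoid n)
  permEnumeration n = enumeration (permutationSetoid n) (λ σ τ → all? λ p → σ ⟨$⟩ʳ p Finₚ.≟ τ ⟨$⟩ʳ p)
    (permutations n) (permutations-unique n) permutations-complete

  ∑Fin-permute : ∀ (σ : Permutation′ n) (f : Fin n → ℤ) →
                 ∑[ p ∈ allFin n ] f (σ ⟨$⟩ʳ p) ≡ ∑ (allFin n) f
  ∑Fin-permute {n} σ f = ∑-reindex (finEnumeration n) (σ ⟨$⟩ʳ_) (σ ⟨$⟩ˡ_)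
    (λ { refl → sym (Perm.inverseˡ σ) }) (λ { refl → sym (Perm.inverseʳ σ) }) f (cong f)

  Extensional : (Permutation′ n → ℤ) → Set
  Extensional f = ∀ σ τ → σ Perm.≈ τ → f σ ≡ f τ

  -- The uniform distribution is invariant under permuting positions: `ρ ∘ₚ σ` sends `p` to
  -- `σ (ρ p)`. All independence and exchangeability used below comes from this.
  ∑Perm-translate : ∀ (ρ : Permutation′ n) {f : Permutation′ n → ℤ} → Extensional f →
                    ∑[ σ ∈ permutations n ] f (ρ ∘ₚ σ) ≡ ∑ (permutations n) f
  ∑Perm-translate {n} ρ {f} f-ext = ∑-reindex (permEnumeration n) (ρ ∘ₚ_) (Perm.flip ρ ∘ₚ_)
    (λ {σ} {τ} τ≈ρσ p → sym (trans (τ≈ρσ (ρ ⟨$⟩ˡ p)) (cong (σ ⟨$⟩ʳ_) (Perm.inverseʳ ρ))))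
    (λ {σ} {τ} σ≈ρ⁻τ p → sym (trans (σ≈ρ⁻τ (ρ ⟨$⟩ʳ p)) (cong (τ ⟨$⟩ʳ_) (Perm.inverseˡ ρ))))
    f (λ {σ} {τ} → f-ext σ τ)

  -- Order patterns

  SameOrder : (Fin k → Fin m) → (Fin k → Fin n) → Set
  SameOrder f g = ∀ r s → (f r Fin.< f s) ⇔ (g r Fin.< g s)

  sameOrder? : (f : Fin k → Fin m) (g : Fin k → Fin n) → Dec (SameOrder f g)
  sameOrder? f g = all? λ r → all? λ s →
    map′ (uncurry mk⇔) (λ e → Equivalence.to e , Equivalence.from e)
      ((f r Finₚ.<? f s →-dec g r Finₚ.<? g s) ×-dec (g r Finₚ.<? g s →-dec f r Finₚ.<? f s))

  sameOrder-sym : {f : Fin k → Fin m} {g : Fin k → Fin n} → SameOrder f g → SameOrder g f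
  sameOrder-sym f~g r s = mk⇔ (Equivalence.from (f~g r s)) (Equivalence.to (f~g r s))

  sameOrder-trans : ∀ {o} {f : Fin k → Fin m} {g : Fin k → Fin n} {h : Fin k → Fin o} →
                    SameOrder f g → SameOrder g h → SameOrder f h
  sameOrder-trans f~g g~h r s =
    mk⇔ (Equivalence.to (g~h r s) ∘ Equivalence.to (f~g r s))
        (Equivalence.from (f~g r s) ∘ Equivalence.from (g~h r s))

  sameOrder-reflexive : {f g : Fin k → Fin n} → (∀ r → f r ≡ g r) → SameOrder f g
  sameOrder-reflexive f≗g r s =
    mk⇔ (subst₂ Fin._<_ (f≗g r) (f≗g s)) (subst₂ Fin._<_ (sym (f≗g r)) (sym (f≗g s)))

  sameOrder-∘ : ∀ {l} {f : Fin k → Fin m} {g : Fin k → Fin n} → SameOrder f g →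
                (h : Fin l → Fin k) → SameOrder (f ∘ h) (g ∘ h)
  sameOrder-∘ f~g h r s = f~g (h r) (h s)

  ⟨$⟩ʳ-injective : (σ : Permutation′ n) → Injective _≡_ _≡_ (σ ⟨$⟩ʳ_)
  ⟨$⟩ʳ-injective σ eq = trans (sym (Perm.inverseˡ σ)) (trans (cong (σ ⟨$⟩ˡ_) eq) (Perm.inverseˡ σ))

  insert-self : ∀ (i j : Fin (suc n)) (π : Permutation′ n) → insert i j π ⟨$⟩ʳ i ≡ j
  insert-self i j π with i Finₚ.≟ i
  ... | yes _  = refl
  ... | no i≢i = contradiction refl i≢i

  private
    lower : {f : Fin k → Fin (suc n)} → (∀ r → zero ≢ f r) → Fin k → Fin n
    lower f≢0 r = punchOut (f≢0 r)

    suc-lower : {f : Fin k → Fin (suc n)} (f≢0 : ∀ r → zero ≢ f r) → ∀ r → suc (lower f≢0 r) ≡ f r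
    suc-lower f≢0 r = Finₚ.punchIn-punchOut (f≢0 r)

    lower-injective : {f : Fin k → Fin (suc n)} (f≢0 : ∀ r → zero ≢ f r) →
                      Injective _≡_ _≡_ f → Injective _≡_ _≡_ (lower f≢0)
    lower-injective f≢0 f-inj eq = f-inj (Finₚ.punchOut-injective (f≢0 _) (f≢0 _) eq)

    sameOrder-suc : {f : Fin k → Fin m} {g : Fin k → Fin n} → SameOrder f g → SameOrder f (suc ∘ g)
    sameOrder-suc f~g r s =
      mk⇔ (ℕ.s≤s ∘ Equivalence.to (f~g r s)) (Equivalence.from (f~g r s) ∘ ℕ.s≤s⁻¹)

  data PunchView (i : Fin (suc n)) : Fin (suc n) → Set where
    self  : PunchView i i
    punch : ∀ j → PunchView i (punchIn i j)

  punchView : ∀ (i j : Fin (suc n)) → PunchView i j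
  punchView i j with i Finₚ.≟ j
  ... | yes refl = self
  ... | no i≢j   = subst (PunchView i) (Finₚ.punchIn-punchOut i≢j) (punch (punchOut i≢j))

  -- Induction on the range `n`. If the value `zero` is missed, all values are lowered by one. If it
  -- is taken at `i`, the other entries are lowered and standardized, and `i` receives the smallest
  -- rank.
  standardize : ∀ n (f : Fin k → Fin n) → Injective _≡_ _≡_ f →
                Σ[ τ ∈ Permutation′ k ] SameOrder (τ ⟨$⟩ʳ_) f
  standardize {zero}  n       f f-inj = Perm.id , λ ()
  standardize {suc k} zero    f f-inj = ⊥-elim (Finₚ.¬Fin0 (f zero))
  standardize {suc k} (suc n) f f-inj with any? (λ r → f r Finₚ.≟ zero)
  ... | no  f≢0 =
    let f≢0′ = λ r 0≡fr → f≢0 (r , sym 0≡fr)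
        τ , τ~f = standardize n (lower f≢0′) (lower-injective f≢0′ f-inj)
    in τ , sameOrder-trans (sameOrder-suc τ~f) (sameOrder-reflexive (suc-lower f≢0′))
  ... | yes (i , fi≡0) = insert i zero τ , same
    where
    f≢0 : ∀ r → zero ≢ f (punchIn i r)
    f≢0 r 0≡fr = Finₚ.punchInᵢ≢i i r (f-inj (sym (trans fi≡0 0≡fr)))

    rest = standardize n (lower f≢0) (lower-injective f≢0 (Finₚ.punchIn-injective i _ _ ∘ f-inj))
    τ    = proj₁ rest

    τ~rest : SameOrder (λ r → insert i zero τ ⟨$⟩ʳ punchIn i r) (λ r → f (punchIn i r))
    τ~rest = sameOrder-trans (sameOrder-reflexive (Perm.insert-punchIn i zero τ))
      (sameOrder-trans (sameOrder-sym (sameOrder-suc (sameOrder-sym (proj₂ rest))))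
      (sameOrder-trans (sameOrder-suc (λ r s → mk⇔ (λ x → x) (λ x → x))) (sameOrder-reflexive (suc-lower f≢0))))

    0<toℕ : ∀ {m} (j : Fin (suc m)) → zero ≢ j → zero {m} Fin.< j
    0<toℕ zero    0≢0 = contradiction refl 0≢0
    0<toℕ (suc j) _   = ℕ.s≤s ℕ.z≤n

    zero≢⇒< : ∀ {m} {a b : Fin (suc m)} → a ≡ zero → zero ≢ b → a Fin.< b
    zero≢⇒< refl 0≢b = 0<toℕ _ 0≢b

    ≮zero : ∀ {m} {a b : Fin (suc m)} → b ≡ zero → ¬ (a Fin.< b)
    ≮zero refl ()

    τ≢0 : ∀ r → zero ≢ insert i zero τ ⟨$⟩ʳ punchIn i r
    τ≢0 r eq = case trans eq (Perm.insert-punchIn i zero τ r) of λ ()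

    same : SameOrder (insert i zero τ ⟨$⟩ʳ_) f
    same r s with punchView i r | punchView i s
    ... | self    | self    = mk⇔ (λ lt → contradiction lt (Finₚ.<-irrefl refl))
                                  (λ lt → contradiction lt (Finₚ.<-irrefl refl))
    ... | self    | punch s = mk⇔
      (λ _ → zero≢⇒< fi≡0 (f≢0 s)) (λ _ → zero≢⇒< (insert-self i zero τ) (τ≢0 s))
    ... | punch r | self    = mk⇔
      (λ lt → contradiction lt (≮zero (insert-self i zero τ)))
      (λ lt → contradiction lt (≮zero fi≡0))
    ... | punch r | punch s = τ~rest r s

  strictlyMonotone⇒≥ : (g : Fin k → Fin n) → (∀ {r s} → r Fin.< s → g r Fin.< g s) →
                       ∀ r → toℕ r ℕ.≤ toℕ (g r)
  strictlyMonotone⇒≥ {suc k} g g-mono = <-weakInduction _ ℕ.z≤n λ r r≤gr →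
    ℕₚ.≤-trans (ℕ.s≤s (ℕₚ.≤-trans (ℕₚ.≤-reflexive (sym (Finₚ.toℕ-inject₁ r))) r≤gr))
               (g-mono (subst (ℕ._< toℕ (suc r)) (sym (Finₚ.toℕ-inject₁ r)) ℕₚ.≤-refl))

  private
    sameOrder⇒≤ : (α β : Permutation′ k) → SameOrder (α ⟨$⟩ʳ_) (β ⟨$⟩ʳ_) →
                  ∀ r → toℕ (α ⟨$⟩ʳ r) ℕ.≤ toℕ (β ⟨$⟩ʳ r)
    sameOrder⇒≤ α β α~β r = subst (λ s → toℕ (α ⟨$⟩ʳ r) ℕ.≤ toℕ (β ⟨$⟩ʳ s)) (Perm.inverseˡ α)
      (strictlyMonotone⇒≥ (λ p → β ⟨$⟩ʳ (α ⟨$⟩ˡ p))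
        (λ p<q → Equivalence.to (α~β _ _) (subst₂ Fin._<_ (sym (Perm.inverseʳ α)) (sym (Perm.inverseʳ α)) p<q))
        (α ⟨$⟩ʳ r))

  -- The inverse of `α` followed by `β` is strictly increasing on `Fin k` and so dominates the
  -- identity; exchanging `α` and `β` gives the other inequality.
  sameOrder⇒≈ : (α β : Permutation′ k) → SameOrder (α ⟨$⟩ʳ_) (β ⟨$⟩ʳ_) → α Perm.≈ β
  sameOrder⇒≈ α β α~β r = Finₚ.toℕ-injective
    (ℕₚ.≤-antisym (sameOrder⇒≤ α β α~β r) (sameOrder⇒≤ β α (sameOrder-sym α~β) r))

  ∑-arrangements : ∀ (π : Permutation′ k) (f : Fin k → Fin n) → Injective _≡_ _≡_ f →
    ∑[ ρ ∈ permutations k ] ⟦ sameOrder? (π ⟨$⟩ʳ_) (λ r → f (ρ ⟨$⟩ʳ r)) ⟧ ≡ 1ℤ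
  ∑-arrangements {k} {n} π f f-inj = trans
    (∑-cong (permutations k) λ ρ → ⟦⟧-cong _ (ρ ≟ₚ ρ₀) (to ρ) (from ρ))
    (Enumeration.once (permEnumeration k) ρ₀)
    where
    _≟ₚ_ = Enumeration._≟_ (permEnumeration k)
    τ = proj₁ (standardize n f f-inj)

    τ~f : SameOrder (τ ⟨$⟩ʳ_) f
    τ~f = proj₂ (standardize n f f-inj)

    -- The values `f (ρ r)` are ordered like `ρ` followed by `τ`, so this has to be `π`, and `ρ` has
    -- to be `π` followed by the inverse of `τ`.
    ρ₀ = π ∘ₚ Perm.flip τ

    to : ∀ ρ → SameOrder (π ⟨$⟩ʳ_) (λ r → f (ρ ⟨$⟩ʳ r)) → ρ Perm.≈ ρ₀
    to ρ π~fρ r = trans (sym (Perm.inverseˡ τ)) (cong (τ ⟨$⟩ˡ_) (sym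
      (sameOrder⇒≈ π (ρ ∘ₚ τ) (sameOrder-trans π~fρ (sameOrder-sym (sameOrder-∘ τ~f (ρ ⟨$⟩ʳ_)))) r)))

    from : ∀ ρ → ρ Perm.≈ ρ₀ → SameOrder (π ⟨$⟩ʳ_) (λ r → f (ρ ⟨$⟩ʳ r))
    from ρ ρ≈ρ₀ = sameOrder-trans
      (sameOrder-reflexive λ r → sym (trans (cong (τ ⟨$⟩ʳ_) (ρ≈ρ₀ r)) (Perm.inverseʳ τ)))
      (sameOrder-∘ τ~f (ρ ⟨$⟩ʳ_))

  -- Rearranging a permutation along an injective family of positions

  private
    alongᶠ : (Fin k → Fin n) → Permutation′ k → Fin n → Fin n
    alongᶠ i ρ p with any? (λ r → i r Finₚ.≟ p)
    ... | yes (r , _) = i (ρ ⟨$⟩ʳ r)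
    ... | no _        = p

    alongᶠ-on : ∀ {i : Fin k → Fin n} → Injective _≡_ _≡_ i → ∀ ρ r → alongᶠ i ρ (i r) ≡ i (ρ ⟨$⟩ʳ r)
    alongᶠ-on {i = i} i-inj ρ r with any? (λ s → i s Finₚ.≟ i r)
    ... | yes (s , is≡ir) = cong (λ t → i (ρ ⟨$⟩ʳ t)) (i-inj is≡ir)
    ... | no ∄s           = contradiction (r , refl) ∄s

    alongᶠ-off : ∀ (i : Fin k → Fin n) ρ {p} → (∀ r → i r ≢ p) → alongᶠ i ρ p ≡ p
    alongᶠ-off i ρ {p} p∉i with any? (λ s → i s Finₚ.≟ p)
    ... | yes (s , is≡p) = contradiction is≡p (p∉i s)
    ... | no _           = refl

    alongᶠ-inverse : ∀ {i : Fin k → Fin n} → Injective _≡_ _≡_ i → ∀ ρ ρ⁻¹ →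
                     (∀ r → ρ ⟨$⟩ʳ (ρ⁻¹ ⟨$⟩ʳ r) ≡ r) → ∀ p → alongᶠ i ρ (alongᶠ i ρ⁻¹ p) ≡ p
    alongᶠ-inverse {i = i} i-inj ρ ρ⁻¹ inv p = by-cases (any? λ r → i r Finₚ.≟ p)
      where
      by-cases : Dec (∃ λ r → i r ≡ p) → alongᶠ i ρ (alongᶠ i ρ⁻¹ p) ≡ p
      by-cases (yes (r , refl)) = trans (cong (alongᶠ i ρ) (alongᶠ-on i-inj ρ⁻¹ r))
                                        (trans (alongᶠ-on i-inj ρ (ρ⁻¹ ⟨$⟩ʳ r)) (cong i (inv r)))
      by-cases (no p∉i) = let p∉i′ = λ r ir≡p → p∉i (r , ir≡p) in
        trans (cong (alongᶠ i ρ) (alongᶠ-off i ρ⁻¹ p∉i′)) (alongᶠ-off i ρ p∉i′)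

  abstract
    -- The embedding of S_k into S_n as the group that permutes the positions `i r` among
    -- themselves; only `along-on` and `along-off` are used of it.
    along : (i : Fin k → Fin n) → Injective _≡_ _≡_ i → Permutation′ k → Permutation′ n
    along i i-inj ρ = Perm.permutation (alongᶠ i ρ) (alongᶠ i (Perm.flip ρ))
      (alongᶠ-inverse i-inj ρ (Perm.flip ρ) (λ _ → Perm.inverseʳ ρ))
      (alongᶠ-inverse i-inj (Perm.flip ρ) ρ (λ _ → Perm.inverseˡ ρ))

    along-on : ∀ {i : Fin k → Fin n} (i-inj : Injective _≡_ _≡_ i) ρ r →
               along i i-inj ρ ⟨$⟩ʳ i r ≡ i (ρ ⟨$⟩ʳ r)
    along-on = alongᶠ-on

    along-off : ∀ {i : Fin k → Fin n} (i-inj : Injective _≡_ _≡_ i) ρ {p} → (∀ r → i r ≢ p) →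
                along i i-inj ρ ⟨$⟩ʳ p ≡ p
    along-off _ = alongᶠ-off _

  patternAt : Permutation′ k → (Fin k → Fin n) → Permutation′ n → ℤ
  patternAt π i σ = ⟦ sameOrder? (π ⟨$⟩ʳ_) (λ r → σ ⟨$⟩ʳ i r) ⟧

  patternAt-ext : ∀ (π : Permutation′ k) (i : Fin k → Fin n) → Extensional (patternAt π i)
  patternAt-ext π i σ τ σ≈τ = ⟦⟧-cong _ _
    (λ π~σ → sameOrder-trans π~σ (sameOrder-reflexive λ r → σ≈τ (i r)))
    (λ π~τ → sameOrder-trans π~τ (sameOrder-reflexive λ r → sym (σ≈τ (i r))))

  -- Translating by `along i ρ` and summing over all `ρ` leaves `H` as it is, while by
  -- `∑-arrangements` the pattern appears for exactly one `ρ` at each `σ`. In other words, the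
  -- relative order at `i` is uniform and independent of every statistic that ignores rearrangements
  -- of these positions.
  ∑-patternAt : ∀ (π : Permutation′ k) {i : Fin k → Fin n} (i-inj : Injective _≡_ _≡_ i)
    (H : Permutation′ n → ℤ) → Extensional H → (∀ ρ σ → H (along i i-inj ρ ∘ₚ σ) ≡ H σ) →
    + (k !) * (∑[ σ ∈ permutations n ] patternAt π i σ * H σ) ≡ ∑ (permutations n) H
  ∑-patternAt {k} {n} π {i} i-inj H H-ext H-inv = begin
    + (k !) * ∑ Sₙ (λ σ → patternAt π i σ * H σ)
      ≡⟨ cong (λ l → + l * ∑ Sₙ (λ σ → patternAt π i σ * H σ)) (length-permutations k) ⟨
    + length Sₖ * ∑ Sₙ (λ σ → patternAt π i σ * H σ)
      ≡⟨ ∑-const Sₖ _ ⟨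
    (∑[ ρ ∈ Sₖ ] ∑[ σ ∈ Sₙ ] patternAt π i σ * H σ)
      ≡⟨ ∑-cong Sₖ (λ ρ → sym (∑Perm-translate (along i i-inj ρ)
           λ σ τ σ≈τ → cong₂ _*_ (patternAt-ext π i σ τ σ≈τ) (H-ext σ τ σ≈τ))) ⟩
    (∑[ ρ ∈ Sₖ ] ∑[ σ ∈ Sₙ ] patternAt π i (along i i-inj ρ ∘ₚ σ) * H (along i i-inj ρ ∘ₚ σ))
      ≡⟨ ∑-swap Sₖ Sₙ _ ⟩
    (∑[ σ ∈ Sₙ ] ∑[ ρ ∈ Sₖ ] patternAt π i (along i i-inj ρ ∘ₚ σ) * H (along i i-inj ρ ∘ₚ σ))
      ≡⟨ ∑-cong Sₙ (λ σ → ∑-cong Sₖ λ ρ → cong₂ _*_ (arranged σ ρ) (H-inv ρ σ)) ⟩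
    (∑[ σ ∈ Sₙ ] ∑[ ρ ∈ Sₖ ] arrangement σ ρ * H σ)
      ≡⟨ ∑-cong Sₙ (λ σ → trans (∑-*ʳ Sₖ (H σ) _) (trans
           (cong (_* H σ) (∑-arrangements π (λ r → σ ⟨$⟩ʳ i r) (λ eq → i-inj (⟨$⟩ʳ-injective σ eq)))) (*-identityˡ (H σ)))) ⟩
    ∑ Sₙ H ∎
    where
    open ≡-Reasoning
    Sₙ = permutations n
    Sₖ = permutations k

    arrangement : Permutation′ n → Permutation′ k → ℤ
    arrangement σ ρ = ⟦ sameOrder? (π ⟨$⟩ʳ_) (λ r → σ ⟨$⟩ʳ i (ρ ⟨$⟩ʳ r)) ⟧

    arranged : ∀ σ ρ → patternAt π i (along i i-inj ρ ∘ₚ σ) ≡ arrangement σ ρ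
    arranged σ ρ = let eq = λ r → cong (σ ⟨$⟩ʳ_) (along-on i-inj ρ r) in ⟦⟧-cong _ _
      (λ same → sameOrder-trans same (sameOrder-reflexive eq))
      (λ same → sameOrder-trans same (sameOrder-reflexive (sym ∘ eq)))

  ∑-patternAt-1 : ∀ (π : Permutation′ k) {i : Fin k → Fin n} → Injective _≡_ _≡_ i →
                  + (k !) * ∑ (permutations n) (patternAt π i) ≡ + (n !)
  ∑-patternAt-1 {k} {n} π {i} i-inj = begin
    + (k !) * ∑ Sₙ (patternAt π i)                        ≡⟨ cong (+ (k !) *_) (∑-cong Sₙ λ σ → sym (*-identityʳ _)) ⟩
    + (k !) * (∑[ σ ∈ Sₙ ] patternAt π i σ * 1ℤ)          ≡⟨ ∑-patternAt π i-inj (λ _ → 1ℤ) (λ _ _ _ → refl) (λ _ _ → refl) ⟩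
    (∑[ σ ∈ Sₙ ] 1ℤ)                                      ≡⟨ ∑-const Sₙ 1ℤ ⟩
    + length Sₙ * 1ℤ                                      ≡⟨ *-identityʳ _ ⟩
    + length Sₙ                                           ≡⟨ cong +_ (length-permutations n) ⟩
    + (n !)                                               ∎
    where
    open ≡-Reasoning
    Sₙ = permutations n

  -- The embedding of the integers in ℚ

  ι : ℤ → ℚ
  ι z = z / 1

  private
    toℚᵘ-ι : ∀ z → toℚᵘ (ι z) ℚᵘ.≃ mkℚᵘ z 0
    toℚᵘ-ι z = ℚₚ.toℚᵘ-fromℚᵘ (mkℚᵘ z 0)

  ι-+ : ∀ a b → ι (a + b) ≡ ι a ℚ.+ ι b
  ι-+ a b = ℚₚ.toℚᵘ-injective (begin
    toℚᵘ (ι (a + b))                   ≈⟨ toℚᵘ-ι (a + b) ⟩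
    mkℚᵘ (a + b) 0                     ≈⟨ *≡* (eq a b) ⟩
    mkℚᵘ a 0 ℚᵘ.+ mkℚᵘ b 0             ≈⟨ ℚᵘₚ.+-cong (ℚᵘₚ.≃-sym (toℚᵘ-ι a)) (ℚᵘₚ.≃-sym (toℚᵘ-ι b)) ⟩
    toℚᵘ (ι a) ℚᵘ.+ toℚᵘ (ι b)         ≈⟨ ℚₚ.toℚᵘ-homo-+ (ι a) (ι b) ⟨
    toℚᵘ (ι a ℚ.+ ι b)                 ∎)
    where
    open ℚᵘₚ.≃-Reasoning
    eq : ∀ a b → (a + b) * 1ℤ ≡ (a * 1ℤ + b * 1ℤ) * 1ℤ
    eq = solve-∀

  ι-* : ∀ a b → ι (a * b) ≡ ι a ℚ.* ι b
  ι-* a b = ℚₚ.toℚᵘ-injective (begin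
    toℚᵘ (ι (a * b))                   ≈⟨ toℚᵘ-ι (a * b) ⟩
    mkℚᵘ a 0 ℚᵘ.* mkℚᵘ b 0             ≈⟨ ℚᵘₚ.*-cong (ℚᵘₚ.≃-sym (toℚᵘ-ι a)) (ℚᵘₚ.≃-sym (toℚᵘ-ι b)) ⟩
    toℚᵘ (ι a) ℚᵘ.* toℚᵘ (ι b)         ≈⟨ ℚₚ.toℚᵘ-homo-* (ι a) (ι b) ⟨
    toℚᵘ (ι a ℚ.* ι b)                 ∎)
    where open ℚᵘₚ.≃-Reasoning

  ι-mono : ∀ {a b} → a ≤ b → ι a ℚ.≤ ι b
  ι-mono {a} {b} a≤b = ℚₚ.toℚᵘ-cancel-≤ (ℚᵘₚ.≤-trans (ℚᵘₚ.≤-reflexive (toℚᵘ-ι a))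
    (ℚᵘₚ.≤-trans (ℚᵘ.*≤* (*-monoʳ-≤-nonNeg 1ℤ a≤b)) (ℚᵘₚ.≤-reflexive (ℚᵘₚ.≃-sym (toℚᵘ-ι b)))))

  ι-*-recip : ∀ d .{{_ : ℕ.NonZero d}} → ι (+ d) ℚ.* (+ 1 / d) ≡ 1ℚ
  ι-*-recip d@(suc d-1) = ℚₚ.toℚᵘ-injective (begin
    toℚᵘ (ι (+ d) ℚ.* (+ 1 / d))          ≈⟨ ℚₚ.toℚᵘ-homo-* (ι (+ d)) (+ 1 / d) ⟩
    toℚᵘ (ι (+ d)) ℚᵘ.* toℚᵘ (+ 1 / d)    ≈⟨ ℚᵘₚ.*-cong (toℚᵘ-ι (+ d)) (ℚₚ.toℚᵘ-fromℚᵘ (mkℚᵘ (+ 1) d-1)) ⟩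
    mkℚᵘ (+ d) 0 ℚᵘ.* mkℚᵘ (+ 1) d-1      ≈⟨ *≡* (trans (eq (+ d)) (cong (λ x → 1ℤ * + suc x) (sym (ℕₚ.+-identityʳ d-1)))) ⟩
    ℚᵘ.1ℚᵘ                                 ∎)
    where
    open ℚᵘₚ.≃-Reasoning
    eq : ∀ d → d * 1ℤ * 1ℤ ≡ 1ℤ * d
    eq = solve-∀

  recip-pos : ∀ d .{{_ : ℕ.NonZero d}} → 0ℚ ℚ.< + 1 / d
  recip-pos d@(suc _) = ℚₚ.positive⁻¹ (+ 1 / d) {{ℚₚ.normalize-pos 1 d}}

  -- The variance bound from a test statistic

  private
    0≤q² : ∀ q → 0ℚ ℚ.≤ q ℚ.* q
    0≤q² q with ℚₚ.≤-total 0ℚ q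
    ... | inj₁ 0≤q = subst (ℚ._≤ q ℚ.* q) (ℚₚ.*-zeroʳ q) (ℚₚ.*-monoˡ-≤-nonNeg q {{ℚ.nonNegative 0≤q}} 0≤q)
    ... | inj₂ q≤0 = subst (ℚ._≤ q ℚ.* q) (ℚₚ.*-zeroʳ q) (ℚₚ.*-monoˡ-≤-nonPos q {{ℚ.nonPositive q≤0}} q≤0)

    open +-*-Solver using (solve; con; _:+_; _:*_; _:-_; _:=_)

    -- the expansion of 0 ≤ (x - m - t y)²
    tangent : ∀ x m t y → (t ℚ.+ t) ℚ.* (x ℚ.* y ℚ.- m ℚ.* y) ℚ.- t ℚ.* t ℚ.* (y ℚ.* y)
                          ℚ.≤ (x ℚ.- m) ℚ.* (x ℚ.- m)
    tangent x m t y = subst₂ ℚ._≤_ (ℚₚ.+-identityʳ _)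
      (solve 4 (λ x m t y → ((t :+ t) :* (x :* y :- m :* y) :- t :* t :* (y :* y)) :+ (x :- m :- t :* y) :* (x :- m :- t :* y)
                            := (x :- m) :* (x :- m)) refl x m t y)
      (ℚₚ.+-monoʳ-≤ ((t ℚ.+ t) ℚ.* (x ℚ.* y ℚ.- m ℚ.* y) ℚ.- t ℚ.* t ℚ.* (y ℚ.* y)) (0≤q² (x ℚ.- m ℚ.- t ℚ.* y)))

    module _ {A : Set} (X : A → ℕ) (Y : A → ℤ) (m t : ℚ) where

      tangents : ∀ xs →
        (t ℚ.+ t) ℚ.* (ι (∑[ a ∈ xs ] + X a * Y a) ℚ.- m ℚ.* ι (∑ xs Y)) ℚ.- t ℚ.* t ℚ.* ι (∑[ a ∈ xs ] Y a * Y a)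
        ℚ.≤ sumℚ (List.map (λ a → (fromℕ (X a) ℚ.- m) ℚ.* (fromℕ (X a) ℚ.- m)) xs)
      tangents []       = ℚₚ.≤-reflexive
        (solve 2 (λ m t → (t :+ t) :* (con 0ℚ :- m :* con 0ℚ) :- t :* t :* con 0ℚ := con 0ℚ) refl m t)
      tangents (a ∷ xs) = ℚₚ.≤-trans (ℚₚ.≤-reflexive eq)
        (ℚₚ.+-mono-≤ (tangent (ι (+ X a)) m t (ι (Y a))) (tangents xs))
        where
        eq : (t ℚ.+ t) ℚ.* (ι (∑[ a ∈ a ∷ xs ] + X a * Y a) ℚ.- m ℚ.* ι (∑ (a ∷ xs) Y))
               ℚ.- t ℚ.* t ℚ.* ι (∑[ a ∈ a ∷ xs ] Y a * Y a) ≡ _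
        eq rewrite ι-+ (+ X a * Y a) (∑[ a ∈ xs ] + X a * Y a) | ι-+ (Y a) (∑ xs Y)
                 | ι-+ (Y a * Y a) (∑[ a ∈ xs ] Y a * Y a) | ι-* (+ X a) (Y a) | ι-* (Y a) (Y a) =
          solve 7 (λ m t x y p q r →
              (t :+ t) :* (x :* y :+ p :- m :* (y :+ q)) :- t :* t :* (y :* y :+ r)
              := ((t :+ t) :* (x :* y :- m :* y) :- t :* t :* (y :* y))
                 :+ ((t :+ t) :* (p :- m :* q) :- t :* t :* r))
            refl m t (ι (+ X a)) (ι (Y a)) _ _ _

  -- With `t = T / d`, the covariance hypothesis makes `t` times the sum of `X Y` at least
  -- `n ! * W / d²`, and the last hypothesis makes `t²` times the sum of `Y²` at most that. Twice
  -- the former minus the latter is still `n ! * W / d²` or more. `T` carries the power of `n` in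
  -- the best `t`, `d` its constant.
  variance-≥ : ∀ {n} (X : Permutation′ n → ℕ) (Y : Permutation′ n → ℤ) (d T W : ℕ) .{{_ : ℕ.NonZero d}} →
    ∑ (permutations n) Y ≡ 0ℤ →
    + (n !) * + W ≤ + d * + T * (∑[ σ ∈ permutations n ] + X σ * Y σ) →
    + T * + T * (∑[ σ ∈ permutations n ] Y σ * Y σ) ≤ + (n !) * + W →
    (+ 1 / d) ℚ.* (+ 1 / d) ℚ.* fromℕ W ℚ.≤ Var (λ σ → fromℕ (X σ))
  variance-≥ {n} X Y d T W ∑Y≡0 cov var = begin
    e ℚ.* e ℚ.* ω
      ≡⟨ ℚₚ.*-identityˡ _ ⟨
    1ℚ ℚ.* (e ℚ.* e ℚ.* ω)
      ≡⟨ cong (ℚ._* (e ℚ.* e ℚ.* ω)) (ι-*-recip (n !)) ⟨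
    (N ℚ.* 1/N) ℚ.* (e ℚ.* e ℚ.* ω)
      ≡⟨ solve 4 (λ N i e w → (N :* i) :* (e :* e :* w) := i :* (e :* e :* (N :* w))) refl N 1/N e ω ⟩
    1/N ℚ.* (e ℚ.* e ℚ.* (N ℚ.* ω))
      ≤⟨ ℚₚ.*-monoˡ-≤-nonNeg 1/N {{ℚ.nonNegative (ℚₚ.<⇒≤ (recip-pos (n !)))}} (ℚₚ.≤-trans bound (tangents X Y μ t Sₙ)) ⟩
    Var (λ σ → fromℕ (X σ)) ∎
    where
    open ℚₚ.≤-Reasoning
    instance
      n!≢0 : ℕ.NonZero (n !)
      n!≢0 = n ℕₚ.!≢0
    Sₙ = permutations n
    e   = + 1 / d
    1/N = + 1 / (n !)
    N   = ι (+ (n !))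
    ω   = ι (+ W)
    t   = ι (+ T) ℚ.* e
    μ   = 𝔼 (λ σ → fromℕ (X σ))
    C   = ∑[ σ ∈ Sₙ ] + X σ * Y σ
    V   = ∑[ σ ∈ Sₙ ] Y σ * Y σ

    0≤e*e : 0ℚ ℚ.≤ e ℚ.* e
    0≤e*e = 0≤q² e

    cov′ : e ℚ.* e ℚ.* (N ℚ.* ω) ℚ.≤ t ℚ.* ι C
    cov′ = begin
      e ℚ.* e ℚ.* (N ℚ.* ω)                        ≡⟨ cong (e ℚ.* e ℚ.*_) (ι-* (+ (n !)) (+ W)) ⟨
      e ℚ.* e ℚ.* ι (+ (n !) * + W)                 ≤⟨ ℚₚ.*-monoˡ-≤-nonNeg (e ℚ.* e) {{ℚ.nonNegative 0≤e*e}} (ι-mono cov) ⟩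
      e ℚ.* e ℚ.* ι (+ d * + T * C)                 ≡⟨ cong (e ℚ.* e ℚ.*_) (trans (ι-* (+ d * + T) C) (cong (ℚ._* ι C) (ι-* (+ d) (+ T)))) ⟩
      e ℚ.* e ℚ.* (ι (+ d) ℚ.* ι (+ T) ℚ.* ι C)     ≡⟨ solve 4 (λ e d T C → e :* e :* (d :* T :* C) := (d :* e) :* (T :* e :* C)) refl e (ι (+ d)) (ι (+ T)) (ι C) ⟩
      (ι (+ d) ℚ.* e) ℚ.* (t ℚ.* ι C)               ≡⟨ cong (ℚ._* (t ℚ.* ι C)) (ι-*-recip d) ⟩
      1ℚ ℚ.* (t ℚ.* ι C)                            ≡⟨ ℚₚ.*-identityˡ _ ⟩
      t ℚ.* ι C                                      ∎

    var′ : t ℚ.* t ℚ.* ι V ℚ.≤ e ℚ.* e ℚ.* (N ℚ.* ω)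
    var′ = begin
      t ℚ.* t ℚ.* ι V                                ≡⟨ solve 3 (λ T e V → (T :* e) :* (T :* e) :* V := e :* e :* (T :* T :* V)) refl (ι (+ T)) e (ι V) ⟩
      e ℚ.* e ℚ.* (ι (+ T) ℚ.* ι (+ T) ℚ.* ι V)      ≡⟨ cong (e ℚ.* e ℚ.*_) (trans (ι-* (+ T * + T) V) (cong (ℚ._* ι V) (ι-* (+ T) (+ T)))) ⟨
      e ℚ.* e ℚ.* ι (+ T * + T * V)                  ≤⟨ ℚₚ.*-monoˡ-≤-nonNeg (e ℚ.* e) {{ℚ.nonNegative 0≤e*e}} (ι-mono var) ⟩
      e ℚ.* e ℚ.* ι (+ (n !) * + W)                  ≡⟨ cong (e ℚ.* e ℚ.*_) (ι-* (+ (n !)) (+ W)) ⟩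
      e ℚ.* e ℚ.* (N ℚ.* ω)                          ∎

    bound : e ℚ.* e ℚ.* (N ℚ.* ω) ℚ.≤
            (t ℚ.+ t) ℚ.* (ι C ℚ.- μ ℚ.* ι (∑ Sₙ Y)) ℚ.- t ℚ.* t ℚ.* ι V
    bound = begin
      e ℚ.* e ℚ.* (N ℚ.* ω)
        ≡⟨ solve 1 (λ q → q := (q :+ q) :- q) refl (e ℚ.* e ℚ.* (N ℚ.* ω)) ⟩
      (e ℚ.* e ℚ.* (N ℚ.* ω) ℚ.+ e ℚ.* e ℚ.* (N ℚ.* ω)) ℚ.- e ℚ.* e ℚ.* (N ℚ.* ω)
        ≤⟨ ℚₚ.+-mono-≤ (ℚₚ.+-mono-≤ cov′ cov′) (ℚₚ.neg-antimono-≤ var′) ⟩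
      (t ℚ.* ι C ℚ.+ t ℚ.* ι C) ℚ.- t ℚ.* t ℚ.* ι V
        ≡⟨ solve 4 (λ t C V m → (t :* C :+ t :* C) :- t :* t :* V := (t :+ t) :* (C :- m :* con 0ℚ) :- t :* t :* V) refl t (ι C) (ι V) μ ⟩
      -- `ι 0ℤ` evaluates to `0ℚ`, so the mean `μ`, of which nothing is known, drops out.
      (t ℚ.+ t) ℚ.* (ι C ℚ.- μ ℚ.* ι 0ℤ) ℚ.- t ℚ.* t ℚ.* ι V
        ≡⟨ cong (λ z → (t ℚ.+ t) ℚ.* (ι C ℚ.- μ ℚ.* ι z) ℚ.- t ℚ.* t ℚ.* ι V) ∑Y≡0 ⟨
      (t ℚ.+ t) ℚ.* (ι C ℚ.- μ ℚ.* ι (∑ Sₙ Y)) ℚ.- t ℚ.* t ℚ.* ι V ∎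

  -- Position vectors

  Admissible : Subset (ℕ.pred k) → Vec (Fin n) k → Set
  Admissible A v = Linked Fin._<_ v ×
    (∀ a → a ∈ A → toℕ (lookup v (right a)) ≡ suc (toℕ (lookup v (left a))))

  admissible? : ∀ (A : Subset (ℕ.pred k)) (v : Vec (Fin n) k) → Dec (Admissible A v)
  admissible? A v = linked? Finₚ._<?_ v ×-dec
    all? λ a → (a ∈? A) →-dec (toℕ (lookup v (right a)) ℕₚ.≟ suc (toℕ (lookup v (left a))))

  -- The condition on positions does not involve `σ`, so the number of occurrences is a sum of
  -- pattern indicators with nonrandom coefficients, and covariances can be computed one position
  -- vector at a time.
  occurrences-∑ : ∀ (π : Permutation′ k) A (σ : Permutation′ n) →
    + occurrences π A σ ≡ ∑[ v ∈ vectors n k ] ⟦ admissible? A v ⟧ * patternAt π (lookup v) σ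
  occurrences-∑ {k} {n} π A σ = trans
    (length-filter (isOccurrence? π A σ) (vectors n k))
    (∑-cong (vectors n k) λ v → ⟦⟧-× (admissible? A v) (sameOrder? (π ⟨$⟩ʳ_) (λ r → σ ⟨$⟩ʳ lookup v r))
      (isOccurrence? π A σ v)
      (λ (isOccurrence inc same adj) → (inc , adj) , same)
      (λ (inc , adj) same → isOccurrence inc same adj))

  sameOrder-strictlyMonotone : (f : Fin k → Fin n) → (∀ {r s} → r Fin.< s → f r Fin.< f s) →
                               SameOrder (λ r → r) f
  sameOrder-strictlyMonotone f f-mono r s = mk⇔ f-mono reflect
    where
    reflect : f r Fin.< f s → r Fin.< s
    reflect fr<fs with ℕₚ.<-cmp (toℕ r) (toℕ s)
    ... | tri< r<s _ _ = r<s
    ... | tri≈ _ r≡s _ = contradiction fr<fs (ℕₚ.<-irrefl (cong (toℕ ∘ f) (Finₚ.toℕ-injective r≡s)))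
    ... | tri> _ _ s<r = contradiction fr<fs (ℕₚ.<-asym (f-mono s<r))

  sameOrder-id⇒injective : {f : Fin k → Fin n} → SameOrder (λ r → r) f → Injective _≡_ _≡_ f
  sameOrder-id⇒injective id~f {r} {s} eq with ℕₚ.<-cmp (toℕ r) (toℕ s)
  ... | tri< r<s _ _ = contradiction (Equivalence.to (id~f r s) r<s) (ℕₚ.<-irrefl (cong toℕ eq))
  ... | tri≈ _ r≡s _ = Finₚ.toℕ-injective r≡s
  ... | tri> _ _ s<r = contradiction (Equivalence.to (id~f s r) s<r) (ℕₚ.<-irrefl (cong toℕ (sym eq)))

  linked⇒sameOrder-id : {v : Vec (Fin n) k} → Linked Fin._<_ v → SameOrder (λ r → r) (lookup v)
  linked⇒sameOrder-id v↑ = sameOrder-strictlyMonotone _ (lookup⁺ Finₚ.<-trans v↑)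

  linked⇒injective : {v : Vec (Fin n) k} → Linked Fin._<_ v → Injective _≡_ _≡_ (lookup v)
  linked⇒injective v↑ = sameOrder-id⇒injective (linked⇒sameOrder-id v↑)

  occurrences-ext : ∀ (π : Permutation′ k) A → Extensional {n} (λ σ → + occurrences π A σ)
  occurrences-ext {k} {n} π A σ τ σ≈τ = trans (occurrences-∑ π A σ) (trans
    (∑-cong (vectors n k) λ v → cong (⟦ admissible? A v ⟧ *_) (patternAt-ext π (lookup v) σ τ σ≈τ))
    (sym (occurrences-∑ π A τ)))

  linked-tabulate : (f : Fin k → Fin n) → (∀ {r s} → r Fin.< s → f r Fin.< f s) → Linked Fin._<_ (Vec.tabulate f)
  linked-tabulate {zero}        f f-mono = []
  linked-tabulate {suc zero}    f f-mono = [-]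
  linked-tabulate {suc (suc k)} f f-mono =
    f-mono (ℕ.s≤s ℕ.z≤n) ∷ linked-tabulate (f ∘ suc) (f-mono ∘ ℕ.s≤s)

  ∑-product : ∀ (xs : List A) (ys : List B) f g → ∑ xs f * ∑ ys g ≡ ∑[ x ∈ xs ] ∑[ y ∈ ys ] f x * g y
  ∑-product xs ys f g = trans (sym (∑-*ʳ xs (∑ ys g) f)) (∑-cong xs λ x → sym (∑-*ˡ ys (f x) g))

  -- Expanding the square leaves at most the diagonal, as the cross terms are nonpositive. For
  -- disjoint windows they vanish; for the box they are correlations between small values.
  ∑-square-≤ : ∀ (xs : List A) (Y : Fin m → A → ℤ) →
    (∀ p q → p ≢ q → ∑[ x ∈ xs ] Y p x * Y q x ≤ 0ℤ) →
    ∑[ x ∈ xs ] (∑[ p ∈ allFin m ] Y p x) * (∑[ q ∈ allFin m ] Y q x) ≤ ∑[ p ∈ allFin m ] ∑[ x ∈ xs ] Y p x * Y p x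
  ∑-square-≤ {m = m} xs Y cross = begin
    (∑[ x ∈ xs ] (∑[ p ∈ Fₘ ] Y p x) * (∑[ q ∈ Fₘ ] Y q x))
      ≡⟨ ∑-cong xs (λ x → ∑-product Fₘ Fₘ (λ p → Y p x) (λ q → Y q x)) ⟩
    (∑[ x ∈ xs ] ∑[ p ∈ Fₘ ] ∑[ q ∈ Fₘ ] Y p x * Y q x)
      ≡⟨ ∑-swap xs Fₘ _ ⟩
    (∑[ p ∈ Fₘ ] ∑[ x ∈ xs ] ∑[ q ∈ Fₘ ] Y p x * Y q x)
      ≡⟨ ∑-cong Fₘ (λ p → ∑-swap xs Fₘ _) ⟩
    (∑[ p ∈ Fₘ ] ∑[ q ∈ Fₘ ] ∑[ x ∈ xs ] Y p x * Y q x)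
      ≤⟨ ∑-mono Fₘ (λ p → ∑-mono Fₘ λ q → diagonal p q) ⟩
    (∑[ p ∈ Fₘ ] ∑[ q ∈ Fₘ ] ⟦ q Finₚ.≟ p ⟧ * (∑[ x ∈ xs ] Y p x * Y q x))
      ≡⟨ ∑-cong Fₘ (λ p → ∑-pick (finEnumeration m) p (λ q → ∑[ x ∈ xs ] Y p x * Y q x) λ { refl → refl }) ⟩
    (∑[ p ∈ Fₘ ] ∑[ x ∈ xs ] Y p x * Y p x) ∎
    where
    open ≤-Reasoning
    Fₘ = allFin m

    diagonal : ∀ p q → ∑[ x ∈ xs ] Y p x * Y q x ≤ ⟦ q Finₚ.≟ p ⟧ * (∑[ x ∈ xs ] Y p x * Y q x)
    diagonal p q with q Finₚ.≟ p
    ... | yes _  = ≤-reflexive (sym (*-identityˡ _))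
    ... | no q≢p = cross p q (q≢p ∘ sym)

  exclusive : (P? : Dec P) (Q? : Dec Q) → (P → ¬ Q) → ⟦ P? ⟧ + ⟦ Q? ⟧ ≤ 1ℤ
  exclusive (yes p) (yes q) ¬pq = contradiction q (¬pq p)
  exclusive (yes p) (no _)  ¬pq = ≤-refl
  exclusive (no _)  (yes q) ¬pq = ≤-refl
  exclusive (no _)  (no _)  ¬pq = +≤+ ℕ.z≤n

  ⟦⟧-difference² : (P? : Dec P) (Q? : Dec Q) → (⟦ P? ⟧ - ⟦ Q? ⟧) * (⟦ P? ⟧ - ⟦ Q? ⟧) ≤ 1ℤ
  ⟦⟧-difference² (yes _) (yes _) = +≤+ ℕ.z≤n
  ⟦⟧-difference² (yes _) (no _)  = ≤-refl
  ⟦⟧-difference² (no _)  (yes _) = ≤-refl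
  ⟦⟧-difference² (no _)  (no _)  = +≤+ ℕ.z≤n

  -- Local rearrangements in disjoint windows

  module DisjointWindows {L M n : ℕ} (window : Fin M → Fin L → Fin n)
    (window-inj : ∀ q → Injective _≡_ _≡_ (window q))
    (window-disjoint : ∀ {q q′ r r′} → window q r ≡ window q′ r′ → q ≡ q′)
    (τ : Permutation′ L) (Xℕ : Permutation′ n → ℕ) (X-ext : Extensional λ σ → + Xℕ σ)
    (s : ℤ) (s*s≡1 : s * s ≡ 1ℤ)
    (gain : ∀ q σ → SameOrder (λ r → r) (λ r → σ ⟨$⟩ʳ window q r) →
      1ℤ ≤ s * (+ Xℕ (along (window q) (window-inj q) τ ∘ₚ σ) - + Xℕ σ))
    where

    private
      Sₙ = permutations n

      X : Permutation′ n → ℤ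
      X σ = + Xℕ σ

      shuffle : Fin M → Permutation′ n
      shuffle q = along (window q) (window-inj q) τ

      p⁺ p⁻ y : Fin M → Permutation′ n → ℤ
      p⁺ q = patternAt τ (window q)
      p⁻ q = patternAt Perm.id (window q)
      y q σ = s * (p⁺ q σ - p⁻ q σ)

      cancel-L! : ∀ {a b} → + (L ℕ.!) * a ≡ + (L ℕ.!) * b → a ≡ b
      cancel-L! {a} {b} = *-cancelˡ-≡ (+ (L ℕ.!)) a b {{ℕ.>-nonZero (ℕₚ.1≤n! L)}}

      y-ext : ∀ q → Extensional (y q)
      y-ext q σ σ′ σ≈σ′ = cong₂ (λ a b → s * (a - b))
        (patternAt-ext τ (window q) σ σ′ σ≈σ′) (patternAt-ext Perm.id (window q) σ σ′ σ≈σ′)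

      ∑y*H : ∀ q (H : Permutation′ n → ℤ) →
             ∑[ σ ∈ Sₙ ] y q σ * H σ ≡ s * ((∑[ σ ∈ Sₙ ] p⁺ q σ * H σ) - (∑[ σ ∈ Sₙ ] p⁻ q σ * H σ))
      ∑y*H q H = begin
        (∑[ σ ∈ Sₙ ] y q σ * H σ)                             ≡⟨ ∑-cong Sₙ (λ σ → expand s (p⁺ q σ) (p⁻ q σ) (H σ)) ⟩
        (∑[ σ ∈ Sₙ ] s * (p⁺ q σ * H σ - p⁻ q σ * H σ))       ≡⟨ ∑-*ˡ Sₙ s _ ⟩
        s * (∑[ σ ∈ Sₙ ] (p⁺ q σ * H σ - p⁻ q σ * H σ))       ≡⟨ cong (s *_) (∑-- Sₙ _ _) ⟩
        s * ((∑[ σ ∈ Sₙ ] p⁺ q σ * H σ) - (∑[ σ ∈ Sₙ ] p⁻ q σ * H σ)) ∎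
        where
        open ≡-Reasoning
        expand : ∀ s a b h → s * (a - b) * h ≡ s * (a * h - b * h)
        expand = solve-∀

      -- By `∑-patternAt` the two patterns compared by `y q` carry the same share 1 / L! of the sum
      -- of `H`. With `H = 1` this gives mean 0, with `H = y q′` the orthogonality of different
      -- windows.
      ∑y*H≡0 : ∀ q (H : Permutation′ n → ℤ) → Extensional H →
               (∀ ρ σ → H (along (window q) (window-inj q) ρ ∘ₚ σ) ≡ H σ) → ∑[ σ ∈ Sₙ ] y q σ * H σ ≡ 0ℤ
      ∑y*H≡0 q H H-ext H-inv = trans (∑y*H q H) (trans
        (cong (s *_) (i≡j⇒i-j≡0 (cancel-L! (trans (∑-patternAt τ (window-inj q) H H-ext H-inv)
                                         (sym (∑-patternAt Perm.id (window-inj q) H H-ext H-inv))))))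
        (*-zeroʳ s))

    statistic : Permutation′ n → ℤ
    statistic σ = ∑[ q ∈ allFin M ] y q σ

    ∑-statistic : ∑ Sₙ statistic ≡ 0ℤ
    ∑-statistic = trans (∑-swap Sₙ (allFin M) _) (∑-≡0 (allFin M) λ q →
      trans (∑-cong Sₙ λ σ → sym (*-identityʳ (y q σ))) (∑y*H≡0 q (λ _ → 1ℤ) (λ _ _ _ → refl) (λ _ _ → refl)))

    ∑-statistic² : ∑[ σ ∈ Sₙ ] statistic σ * statistic σ ≤ + M * + (n !)
    ∑-statistic² = begin
      (∑[ σ ∈ Sₙ ] statistic σ * statistic σ)             ≤⟨ ∑-square-≤ Sₙ y (λ q q′ q≢q′ → ≤-reflexive (orthogonal q q′ q≢q′)) ⟩
      (∑[ q ∈ allFin M ] ∑[ σ ∈ Sₙ ] y q σ * y q σ)       ≤⟨ ∑-mono (allFin M) (λ q → ∑-mono Sₙ λ σ → y²≤1 q σ) ⟩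
      (∑[ q ∈ allFin M ] ∑[ σ ∈ Sₙ ] 1ℤ)                  ≡⟨ ∑-const (allFin M) _ ⟩
      + length (allFin M) * (∑[ σ ∈ Sₙ ] 1ℤ)              ≡⟨ cong₂ _*_ (cong +_ (length-tabulate {n = M} (λ q → q)))
                                                             (trans (∑-const Sₙ 1ℤ) (trans (*-identityʳ _) (cong +_ (length-permutations n)))) ⟩
      + M * + (n !) ∎
      where
      open ≤-Reasoning
      orthogonal : ∀ q q′ → q ≢ q′ → ∑[ σ ∈ Sₙ ] y q σ * y q′ σ ≡ 0ℤ
      orthogonal q q′ q≢q′ = ∑y*H≡0 q (y q′) (y-ext q′) λ ρ σ →
        cong₂ (λ a b → s * (a - b)) (fixed τ ρ σ) (fixed Perm.id ρ σ)
        where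
        fixed : ∀ α ρ σ → patternAt α (window q′) (along (window q) (window-inj q) ρ ∘ₚ σ) ≡ patternAt α (window q′) σ
        fixed α ρ σ = let eq = λ r → cong (σ ⟨$⟩ʳ_) (along-off (window-inj q) ρ {window q′ r} λ r′ eq → q≢q′ (window-disjoint eq)) in
          ⟦⟧-cong _ _ (λ same → sameOrder-trans same (sameOrder-reflexive eq))
                      (λ same → sameOrder-trans same (sameOrder-reflexive (sym ∘ eq)))

      y²≤1 : ∀ q σ → y q σ * y q σ ≤ 1ℤ
      y²≤1 q σ = ≤-trans (≤-reflexive (trans (square s (p⁺ q σ) (p⁻ q σ))
        (trans (cong (_* ((p⁺ q σ - p⁻ q σ) * (p⁺ q σ - p⁻ q σ))) s*s≡1) (*-identityˡ _))))
        (⟦⟧-difference² (sameOrder? (τ ⟨$⟩ʳ_) (λ r → σ ⟨$⟩ʳ window q r))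
                        (sameOrder? (λ r → r) (λ r → σ ⟨$⟩ʳ window q r)))
        where
        square : ∀ s a b → s * (a - b) * (s * (a - b)) ≡ s * s * ((a - b) * (a - b))
        square = solve-∀

    -- Composing with `shuffle q` turns an increasing window into one ordered like `τ`, so by
    -- translation the sum of `p⁺ q σ * X σ` is that of `p⁻ q σ * X (shuffle q ∘ₚ σ)`. Each window
    -- thus contributes the event `p⁻ q`, of probability 1 / L!, times a gain of at least 1.
    ∑-X*statistic : + M * + (n !) ≤ + (L ℕ.!) * (∑[ σ ∈ Sₙ ] X σ * statistic σ)
    ∑-X*statistic = begin
      + M * + (n !)
        ≡⟨ cong (λ l → + l * + (n !)) (length-tabulate {n = M} (λ q → q)) ⟨
      + length (allFin M) * + (n !)
        ≡⟨ ∑-const (allFin M) (+ (n !)) ⟨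
      (∑[ q ∈ allFin M ] + (n !))
        ≡⟨ ∑-cong (allFin M) (λ q → sym (∑-patternAt-1 Perm.id (window-inj q))) ⟩
      (∑[ q ∈ allFin M ] + (L ℕ.!) * ∑ Sₙ (p⁻ q))
        ≡⟨ ∑-*ˡ (allFin M) (+ (L ℕ.!)) _ ⟩
      + (L ℕ.!) * (∑[ q ∈ allFin M ] ∑ Sₙ (p⁻ q))
        ≤⟨ *-monoˡ-≤-nonNeg (+ (L ℕ.!)) (∑-mono (allFin M) λ q → covariance q) ⟩
      + (L ℕ.!) * (∑[ q ∈ allFin M ] ∑[ σ ∈ Sₙ ] y q σ * X σ)
        ≡⟨ cong (+ (L ℕ.!) *_) (trans (sym (∑-swap Sₙ (allFin M) _)) (∑-cong Sₙ λ σ →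
             trans (∑-*ʳ (allFin M) (X σ) _) (*-comm (statistic σ) (X σ)))) ⟩
      + (L ℕ.!) * (∑[ σ ∈ Sₙ ] X σ * statistic σ) ∎
      where
      open ≤-Reasoning

      p⁺-shuffle : ∀ q σ → p⁺ q (shuffle q ∘ₚ σ) ≡ p⁻ q σ
      p⁺-shuffle q σ = ⟦⟧-cong _ _
        (λ τ~σ → sameOrder-trans (sameOrder-reflexive λ r → sym (Perm.inverseʳ τ))
          (sameOrder-trans (sameOrder-∘ τ~σ (τ ⟨$⟩ˡ_))
          (sameOrder-reflexive λ r → cong (σ ⟨$⟩ʳ_) (trans (along-on (window-inj q) τ (τ ⟨$⟩ˡ r)) (cong (window q) (Perm.inverseʳ τ))))))
        (λ id~σ → sameOrder-trans (sameOrder-∘ id~σ (τ ⟨$⟩ʳ_))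
          (sameOrder-reflexive λ r → cong (σ ⟨$⟩ʳ_) (sym (along-on (window-inj q) τ r))))

      covariance : ∀ q → ∑ Sₙ (p⁻ q) ≤ ∑[ σ ∈ Sₙ ] y q σ * X σ
      covariance q = begin
        ∑ Sₙ (p⁻ q)
          ≤⟨ ∑-mono Sₙ gain′ ⟩
        (∑[ σ ∈ Sₙ ] s * (p⁻ q σ * X (shuffle q ∘ₚ σ) - p⁻ q σ * X σ))
          ≡⟨ trans (∑-*ˡ Sₙ s _) (cong (s *_) (∑-- Sₙ _ _)) ⟩
        s * ((∑[ σ ∈ Sₙ ] p⁻ q σ * X (shuffle q ∘ₚ σ)) - (∑[ σ ∈ Sₙ ] p⁻ q σ * X σ))
          ≡⟨ cong (λ z → s * (z - (∑[ σ ∈ Sₙ ] p⁻ q σ * X σ))) (trans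
               (∑-cong Sₙ λ σ → cong (_* X (shuffle q ∘ₚ σ)) (sym (p⁺-shuffle q σ)))
               (∑Perm-translate (shuffle q) λ σ σ′ σ≈σ′ →
                 cong₂ _*_ (patternAt-ext τ (window q) σ σ′ σ≈σ′) (X-ext σ σ′ σ≈σ′))) ⟩
        s * ((∑[ σ ∈ Sₙ ] p⁺ q σ * X σ) - (∑[ σ ∈ Sₙ ] p⁻ q σ * X σ))
          ≡⟨ ∑y*H q X ⟨
        (∑[ σ ∈ Sₙ ] y q σ * X σ) ∎
        where
        unit : ∀ s a b → s * (a - b) ≡ s * (1ℤ * a - 1ℤ * b)
        unit = solve-∀

        gain′ : ∀ σ → p⁻ q σ ≤ s * (p⁻ q σ * X (shuffle q ∘ₚ σ) - p⁻ q σ * X σ)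
        gain′ σ with sameOrder? (λ r → r) (λ r → σ ⟨$⟩ʳ window q r)
        ... | yes inc = ≤-trans (gain q σ inc) (≤-reflexive (unit s (X (shuffle q ∘ₚ σ)) (X σ)))
        ... | no _    = ≤-reflexive (sym (*-zeroʳ s))

    -- The number `M` of windows is proportional to `n`, so the covariance and the second moment of
    -- the statistic both have order `n`, and a constant `t = 1 / (L ! * c)` will do. The exponent 1
    -- is `2 j - 1` for a single block.
    variance : ∀ c .{{_ : ℕ.NonZero c}} .{{_ : ℕ.NonZero (L ! ℕ.* c)}} → M ℕ.≤ n → n ℕ.≤ c ℕ.* M →
      (+ 1 / (L ! ℕ.* c)) ℚ.* (+ 1 / (L ! ℕ.* c)) ℚ.* fromℕ (n ℕ.^ 1) ℚ.≤ Var (λ σ → fromℕ (Xℕ σ))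
    variance c M≤n n≤cM = variance-≥ Xℕ statistic (L ! ℕ.* c) 1 (n ℕ.^ 1) ∑-statistic
      (begin
        + (n !) * + (n ℕ.^ 1)                    ≡⟨ cong (λ e → + (n !) * + e) (ℕₚ.*-identityʳ n) ⟩
        + (n !) * + n                            ≤⟨ *-monoˡ-≤-nonNeg (+ (n !)) (+≤+ n≤cM) ⟩
        + (n !) * + (c ℕ.* M)                    ≡⟨ cong (+ (n !) *_) (pos-* c M) ⟩
        + (n !) * (+ c * + M)                    ≡⟨ rotate (+ (n !)) (+ c) (+ M) ⟩
        + c * (+ M * + (n !))                    ≤⟨ *-monoˡ-≤-nonNeg (+ c) ∑-X*statistic ⟩
        + c * (+ (L !) * XY)                     ≡⟨ regroup (+ c) (+ (L !)) XY ⟩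
        + (L !) * + c * + 1 * XY                 ≡⟨ cong (λ e → e * + 1 * XY) (pos-* (L !) c) ⟨
        + (L ! ℕ.* c) * + 1 * XY                 ∎)
      (begin
        + 1 * + 1 * (∑[ σ ∈ Sₙ ] statistic σ * statistic σ)  ≡⟨ *-identityˡ _ ⟩
        (∑[ σ ∈ Sₙ ] statistic σ * statistic σ)              ≤⟨ ∑-statistic² ⟩
        + M * + (n !)                                         ≤⟨ *-monoʳ-≤-nonNeg (+ (n !)) (+≤+ M≤n) ⟩
        + n * + (n !)                                         ≡⟨ *-comm (+ n) (+ (n !)) ⟩
        + (n !) * + n                                         ≡⟨ cong (λ e → + (n !) * + e) (ℕₚ.*-identityʳ n) ⟨
        + (n !) * + (n ℕ.^ 1)                                 ∎)
      where
      open ≤-Reasoning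
      XY = ∑[ σ ∈ Sₙ ] X σ * statistic σ
      rotate : ∀ a b c → a * (b * c) ≡ b * (c * a)
      rotate = solve-∀
      regroup : ∀ c l x → c * (l * x) ≡ l * c * + 1 * x
      regroup = solve-∀

  sameOrder-shift : (f : Fin k → Fin m) (g : Fin k → Fin n) (c : ℕ) →
                    (∀ r → toℕ (g r) ≡ c ℕ.+ toℕ (f r)) → SameOrder f g
  sameOrder-shift f g c eq r s = mk⇔
    (λ lt → subst₂ ℕ._<_ (sym (eq r)) (sym (eq s)) (ℕₚ.+-monoʳ-< c lt))
    (λ lt → ℕₚ.+-cancelˡ-< c _ _ (subst₂ ℕ._<_ (eq r) (eq s) lt))

  -- Consecutive patterns

  module Consecutive (k′ : ℕ) (π : Permutation′ (suc k′)) (A : Subset k′) (full : ∀ a → a ∈ A)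
    (n L M : ℕ) (L≡3k : L ≡ suc k′ ℕ.+ (suc k′ ℕ.+ suc k′)) (ML≤n : M ℕ.* L ℕ.≤ n) where

    private
      mid : Fin (suc k′) → Fin L
      mid r = Fin.cast (sym L≡3k) (suc k′ Fin.↑ʳ (r Fin.↑ˡ (suc k′)))

      toℕ-mid : ∀ r → toℕ (mid r) ≡ suc k′ ℕ.+ toℕ r
      toℕ-mid r = trans (Finₚ.toℕ-cast (sym L≡3k) (suc k′ Fin.↑ʳ (r Fin.↑ˡ (suc k′)))) (trans (Finₚ.toℕ-↑ʳ (suc k′) (r Fin.↑ˡ (suc k′))) (cong (suc k′ ℕ.+_) (Finₚ.toℕ-↑ˡ r (suc k′))))

      id~mid : SameOrder (λ r → r) mid
      id~mid = sameOrder-shift (λ r → r) mid (suc k′) toℕ-mid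

      mid-inj : Injective _≡_ _≡_ mid
      mid-inj = sameOrder-id⇒injective id~mid

      window : Fin M → Fin L → Fin n
      window q r = Fin.inject≤ (Fin.combine q r) ML≤n

      toℕ-window : ∀ q r → toℕ (window q r) ≡ L ℕ.* toℕ q ℕ.+ toℕ r
      toℕ-window q r = trans (Finₚ.toℕ-inject≤ (Fin.combine q r) ML≤n) (Finₚ.toℕ-combine q r)

      id~window : ∀ q → SameOrder (λ r → r) (window q)
      id~window q = sameOrder-shift (λ r → r) (window q) _ (toℕ-window q)

      window-inj : ∀ q → Injective _≡_ _≡_ (window q)
      window-inj q = sameOrder-id⇒injective (id~window q)

      window-disjoint : ∀ {q q′ r r′} → window q r ≡ window q′ r′ → q ≡ q′
      window-disjoint {q} {q′} {r} {r′} eq =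
        proj₁ (Finₚ.combine-injective q r q′ r′ (Finₚ.inject≤-injective ML≤n ML≤n _ _ eq))

      admissible-toℕ : ∀ (v : Vec (Fin n) (suc k′)) → Admissible A v →
                       ∀ r → toℕ (lookup v r) ≡ toℕ (lookup v zero) ℕ.+ toℕ r
      admissible-toℕ v (_ , adj) = <-weakInduction _ (sym (ℕₚ.+-identityʳ _)) λ a ih →
        trans (adj a (full a)) (trans (cong suc (trans ih (cong (toℕ (lookup v zero) ℕ.+_) (Finₚ.toℕ-inject₁ a))))
                                      (sym (ℕₚ.+-suc _ (toℕ a))))

      Touches : Fin M → Vec (Fin n) (suc k′) → Set
      Touches q v = ∃ λ r → ∃ λ x → lookup v r ≡ window q (mid x)

      touches? : ∀ q v → Dec (Touches q v)
      touches? q v = any? λ r → any? λ x → lookup v r Finₚ.≟ window q (mid x)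

      -- With a single block, `v` occupies `suc k′` consecutive positions. If one of them is in the
      -- middle third of the window, the outer thirds have room for the rest; hence the length three
      -- times `suc k′`.
      inWindow : ∀ q v → Admissible A v → Touches q v → ∀ s → Σ[ y ∈ Fin L ] lookup v s ≡ window q y
      inWindow q v adm (r , x , vr≡) s = Fin.fromℕ< z<L , Finₚ.toℕ-injective
        (trans (ℕₚ.+-cancelʳ-≡ (toℕ r) _ _ eq)
               (sym (trans (toℕ-window q _) (cong (L ℕ.* toℕ q ℕ.+_) (Finₚ.toℕ-fromℕ< z<L)))))
        where
        -- The offset of `lookup v s` in the window: `lookup v r` has offset `suc k′ + x`, and
        -- `lookup v s` lies `s - r` further. The subtraction does not truncate because
        -- `r < suc k′`.
        z = suc k′ ℕ.+ toℕ x ℕ.+ toℕ s ℕ.∸ toℕ r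

        z+r≡ : z ℕ.+ toℕ r ≡ suc k′ ℕ.+ toℕ x ℕ.+ toℕ s
        z+r≡ = ℕₚ.m∸n+n≡m (ℕₚ.≤-trans (ℕₚ.<⇒≤ (Finₚ.toℕ<n r))
                 (ℕₚ.≤-trans (ℕₚ.m≤m+n (suc k′) (toℕ x)) (ℕₚ.m≤m+n _ (toℕ s))))

        z<L : z ℕ.< L
        z<L = ℕₚ.≤-<-trans (ℕₚ.m∸n≤m _ (toℕ r)) (subst₂ ℕ._<_ (sym (ℕₚ.+-assoc (suc k′) (toℕ x) (toℕ s))) (sym L≡3k)
                (ℕₚ.+-monoʳ-< (suc k′) (ℕₚ.+-mono-< (Finₚ.toℕ<n x) (Finₚ.toℕ<n s))))

        v₀ = toℕ (lookup v zero)

        v₀+r≡ : v₀ ℕ.+ toℕ r ≡ L ℕ.* toℕ q ℕ.+ (suc k′ ℕ.+ toℕ x)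
        v₀+r≡ = trans (sym (admissible-toℕ v adm r)) (trans (cong toℕ vr≡)
                  (trans (toℕ-window q (mid x)) (cong (L ℕ.* toℕ q ℕ.+_) (toℕ-mid x))))

        eq : toℕ (lookup v s) ℕ.+ toℕ r ≡ L ℕ.* toℕ q ℕ.+ z ℕ.+ toℕ r
        eq = begin
          toℕ (lookup v s) ℕ.+ toℕ r                        ≡⟨ cong (ℕ._+ toℕ r) (admissible-toℕ v adm s) ⟩
          v₀ ℕ.+ toℕ s ℕ.+ toℕ r                            ≡⟨ ℕₚ.+-assoc v₀ _ _ ⟩
          v₀ ℕ.+ (toℕ s ℕ.+ toℕ r)                          ≡⟨ cong (v₀ ℕ.+_) (ℕₚ.+-comm (toℕ s) (toℕ r)) ⟩
          v₀ ℕ.+ (toℕ r ℕ.+ toℕ s)                          ≡⟨ ℕₚ.+-assoc v₀ _ _ ⟨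
          v₀ ℕ.+ toℕ r ℕ.+ toℕ s                            ≡⟨ cong (ℕ._+ toℕ s) v₀+r≡ ⟩
          L ℕ.* toℕ q ℕ.+ (suc k′ ℕ.+ toℕ x) ℕ.+ toℕ s           ≡⟨ ℕₚ.+-assoc (L ℕ.* toℕ q) _ _ ⟩
          L ℕ.* toℕ q ℕ.+ (suc k′ ℕ.+ toℕ x ℕ.+ toℕ s)           ≡⟨ cong (L ℕ.* toℕ q ℕ.+_) z+r≡ ⟨
          L ℕ.* toℕ q ℕ.+ (z ℕ.+ toℕ r)                     ≡⟨ ℕₚ.+-assoc (L ℕ.* toℕ q) _ _ ⟨
          L ℕ.* toℕ q ℕ.+ z ℕ.+ toℕ r                       ∎
          where open ≡-Reasoning

      Increasing : Fin M → Permutation′ n → Set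
      Increasing q σ = SameOrder (λ r → r) (λ r → σ ⟨$⟩ʳ window q r)

      -- By `inWindow` the whole of `v` lies where `σ` increases. So in an increasing window the
      -- touching admissible vectors are either all occurrences or none is, according to whether `π`
      -- is the identity.
      increasing-inside : ∀ q σ v → Increasing q σ → Admissible A v → Touches q v →
                          SameOrder (λ r → r) (λ r → σ ⟨$⟩ʳ lookup v r)
      increasing-inside q σ v inc adm touch =
        sameOrder-trans (linked⇒sameOrder-id (proj₁ adm))
        (sameOrder-trans (sameOrder-reflexive (proj₂ ∘ position))
        (sameOrder-trans (sameOrder-sym (sameOrder-∘ (id~window q) y))
        (sameOrder-trans (sameOrder-∘ inc y)
        (sameOrder-reflexive (λ r → cong (σ ⟨$⟩ʳ_) (sym (proj₂ (position r))))))))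
        where
        position = inWindow q v adm touch
        y = proj₁ ∘ position

      block : Fin M → Vec (Fin n) (suc k′)
      block q = Vec.tabulate (window q ∘ mid)

      lookup-block : ∀ q r → lookup (block q) r ≡ window q (mid r)
      lookup-block q = lookup∘tabulate (window q ∘ mid)

      block-touches : ∀ q → Touches q (block q)
      block-touches q = zero , zero , lookup-block q zero

      block-admissible : ∀ q → Admissible A (block q)
      block-admissible q =
        linked-tabulate (window q ∘ mid) (λ r<s → Equivalence.to (id~window q _ _) (Equivalence.to (id~mid _ _) r<s)) ,
        λ a _ → trans (toℕ-block (suc a)) (trans (ℕₚ.+-suc _ (toℕ a))
          (cong suc (sym (trans (toℕ-block (inject₁ a)) (cong (L ℕ.* toℕ q ℕ.+ suc k′ ℕ.+_) (Finₚ.toℕ-inject₁ a))))))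
        where
        toℕ-block : ∀ r → toℕ (lookup (block q) r) ≡ L ℕ.* toℕ q ℕ.+ suc k′ ℕ.+ toℕ r
        toℕ-block r = trans (cong toℕ (lookup-block q r)) (trans (toℕ-window q (mid r))
          (trans (cong (L ℕ.* toℕ q ℕ.+_) (toℕ-mid r)) (sym (ℕₚ.+-assoc (L ℕ.* toℕ q) (suc k′) (toℕ r)))))

    module Rearranged (ρ₀ : Permutation′ (suc k′)) where

      τ : Permutation′ L
      τ = along mid mid-inj ρ₀

      shuffle : Fin M → Permutation′ n
      shuffle q = along (window q) (window-inj q) τ

      shuffle-block : ∀ q r → shuffle q ⟨$⟩ʳ lookup (block q) r ≡ lookup (block q) (ρ₀ ⟨$⟩ʳ r)
      shuffle-block q r = begin
        shuffle q ⟨$⟩ʳ lookup (block q) r      ≡⟨ cong (shuffle q ⟨$⟩ʳ_) (lookup-block q r) ⟩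
        shuffle q ⟨$⟩ʳ window q (mid r)        ≡⟨ along-on (window-inj q) τ (mid r) ⟩
        window q (τ ⟨$⟩ʳ mid r)                ≡⟨ cong (window q) (along-on mid-inj ρ₀ r) ⟩
        window q (mid (ρ₀ ⟨$⟩ʳ r))             ≡⟨ lookup-block q (ρ₀ ⟨$⟩ʳ r) ⟨
        lookup (block q) (ρ₀ ⟨$⟩ʳ r)           ∎
        where open ≡-Reasoning

      -- A position of `v` inside the window lies in one of the outer thirds, which `τ` fixes.
      shuffle-away : ∀ q v → ¬ Touches q v → ∀ s → shuffle q ⟨$⟩ʳ lookup v s ≡ lookup v s
      shuffle-away q v away s = by-cases (any? λ y → window q y Finₚ.≟ lookup v s)
        where
        open ≡-Reasoning
        by-cases : Dec (∃ λ y → window q y ≡ lookup v s) → shuffle q ⟨$⟩ʳ lookup v s ≡ lookup v s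
        by-cases (no v∉w)        = along-off (window-inj q) τ (λ y wy≡ → v∉w (y , wy≡))
        by-cases (yes (y , wy≡)) = begin
          shuffle q ⟨$⟩ʳ lookup v s   ≡⟨ cong (shuffle q ⟨$⟩ʳ_) wy≡ ⟨
          shuffle q ⟨$⟩ʳ window q y   ≡⟨ along-on (window-inj q) τ y ⟩
          window q (τ ⟨$⟩ʳ y)         ≡⟨ cong (window q) (along-off mid-inj ρ₀ λ x midx≡y →
                                           away (s , x , sym (trans (cong (window q) midx≡y) wy≡))) ⟩
          window q y                  ≡⟨ wy≡ ⟩
          lookup v s                  ∎

      patternAt-away : ∀ q v σ → ¬ Touches q v →
                       patternAt π (lookup v) (shuffle q ∘ₚ σ) ≡ patternAt π (lookup v) σ
      patternAt-away q v σ away = let eq = λ r → cong (σ ⟨$⟩ʳ_) (shuffle-away q v away r) in ⟦⟧-cong _ _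
        (λ same → sameOrder-trans same (sameOrder-reflexive eq))
        (λ same → sameOrder-trans same (sameOrder-reflexive (sym ∘ eq)))

      occ : Permutation′ n → Vec (Fin n) (suc k′) → ℤ
      occ σ v = ⟦ admissible? A v ⟧ * patternAt π (lookup v) σ

      _≟ᵥ_ = Enumeration._≟_ (vecEnumeration n (suc k′))

      block-shuffled : ∀ q σ → Increasing q σ → SameOrder (ρ₀ ⟨$⟩ʳ_) (λ r → (shuffle q ∘ₚ σ) ⟨$⟩ʳ lookup (block q) r)
      block-shuffled q σ inc = sameOrder-trans
        (sameOrder-∘ (increasing-inside q σ (block q) inc (block-admissible q) (block-touches q)) (ρ₀ ⟨$⟩ʳ_))
        (sameOrder-reflexive λ r → cong (σ ⟨$⟩ʳ_) (sym (shuffle-block q r)))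

      occ-adm : ∀ σ v → Admissible A v → occ σ v ≡ patternAt π (lookup v) σ
      occ-adm σ v adm = trans (cong (_* patternAt π (lookup v) σ) (⟦⟧-yes (admissible? A v) adm)) (*-identityˡ _)

      occ-¬adm : ∀ σ v → ¬ Admissible A v → occ σ v ≡ 0ℤ
      occ-¬adm σ v ¬adm = trans (cong (_* patternAt π (lookup v) σ) (⟦⟧-no (admissible? A v) ¬adm)) (*-zeroˡ (patternAt π (lookup v) σ))

      -- The increment 1 is written as the sum over `v` of the indicator of `block q`, so that the
      -- comparison can be made vector by vector: the middle block has to win, the other touching
      -- vectors must not lose, and the rest stay equal.
      compare : ∀ q (τ σ′ : Permutation′ n) →
        (∀ v → Admissible A v → Touches q v → patternAt π (lookup v) τ + ⟦ v ≟ᵥ block q ⟧ ≤ patternAt π (lookup v) σ′) →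
        (∀ v → ¬ Touches q v → patternAt π (lookup v) τ ≡ patternAt π (lookup v) σ′) →
        + occurrences π A τ + 1ℤ ≤ + occurrences π A σ′
      compare q τ σ′ touching away = begin
        + occurrences π A τ + 1ℤ
          ≡⟨ cong₂ _+_ (occurrences-∑ π A τ) (sym (Enumeration.once (vecEnumeration n (suc k′)) (block q))) ⟩
        ∑ V (occ τ) + ∑ V (λ v → ⟦ v ≟ᵥ block q ⟧)
          ≡⟨ ∑-+ V (occ τ) _ ⟨
        ∑ V (λ v → occ τ v + ⟦ v ≟ᵥ block q ⟧)
          ≤⟨ ∑-mono V pointwise ⟩
        ∑ V (occ σ′)
          ≡⟨ occurrences-∑ π A σ′ ⟨
        + occurrences π A σ′ ∎
        where
        open ≤-Reasoning
        V = vectors n (suc k′)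

        pointwise : ∀ v → occ τ v + ⟦ v ≟ᵥ block q ⟧ ≤ occ σ′ v
        pointwise v = by-cases (admissible? A v) (touches? q v)
          where
          by-cases : Dec (Admissible A v) → Dec (Touches q v) → occ τ v + ⟦ v ≟ᵥ block q ⟧ ≤ occ σ′ v
          by-cases (no ¬adm) _ = ≤-reflexive (trans
            (cong₂ _+_ (occ-¬adm τ v ¬adm) (⟦⟧-no (v ≟ᵥ block q) λ v≡ → ¬adm (subst (Admissible A) (sym v≡) (block-admissible q))))
            (sym (occ-¬adm σ′ v ¬adm)))
          by-cases (yes adm) (yes touch) =
            subst₂ _≤_ (cong (_+ ⟦ v ≟ᵥ block q ⟧) (sym (occ-adm τ v adm))) (sym (occ-adm σ′ v adm)) (touching v adm touch)
          by-cases (yes adm) (no ¬touch) = ≤-reflexive (trans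
            (cong₂ _+_ (trans (occ-adm τ v adm) (away v ¬touch)) (⟦⟧-no (v ≟ᵥ block q) λ v≡ → ¬touch (subst (Touches q) (sym v≡) (block-touches q))))
            (trans (+-identityʳ _) (sym (occ-adm σ′ v adm))))

      -- Before the rearrangement no touching vector is an occurrence, so nothing can be lost;
      -- afterwards the middle block is one.
      gain⁺ : ¬ (π Perm.≈ Perm.id) → ρ₀ Perm.≈ π → ∀ q σ → Increasing q σ →
              + occurrences π A σ + 1ℤ ≤ + occurrences π A (shuffle q ∘ₚ σ)
      gain⁺ π≉id ρ₀≈π q σ inc = compare q σ (shuffle q ∘ₚ σ) touching
        (λ v away → sym (patternAt-away q v σ away))
        where
        touching : ∀ v → Admissible A v → Touches q v →
          patternAt π (lookup v) σ + ⟦ v ≟ᵥ block q ⟧ ≤ patternAt π (lookup v) (shuffle q ∘ₚ σ)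
        touching v adm touch = subst (λ z → z + ⟦ v ≟ᵥ block q ⟧ ≤ patternAt π (lookup v) (shuffle q ∘ₚ σ))
          (sym (⟦⟧-no (sameOrder? (π ⟨$⟩ʳ_) (λ r → σ ⟨$⟩ʳ lookup v r)) λ π~σ → π≉id (sameOrder⇒≈ π Perm.id
            (sameOrder-trans π~σ (sameOrder-sym (increasing-inside q σ v inc adm touch))))))
          (subst (_≤ patternAt π (lookup v) (shuffle q ∘ₚ σ)) (sym (+-identityˡ ⟦ v ≟ᵥ block q ⟧))
            (⟦⟧-mono (v ≟ᵥ block q) _ λ { refl →
              sameOrder-trans (sameOrder-reflexive (sym ∘ ρ₀≈π)) (block-shuffled q σ inc) }))

      -- The opposite extreme: every touching admissible vector is already an occurrence, so nothing
      -- can be gained, and the rearrangement destroys the one at the middle block.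
      gain⁻ : π Perm.≈ Perm.id → ¬ (ρ₀ Perm.≈ π) → ∀ q σ → Increasing q σ →
              + occurrences π A (shuffle q ∘ₚ σ) + 1ℤ ≤ + occurrences π A σ
      gain⁻ π≈id ρ₀≉π q σ inc = compare q (shuffle q ∘ₚ σ) σ touching (λ v → patternAt-away q v σ)
        where
        touching : ∀ v → Admissible A v → Touches q v →
          patternAt π (lookup v) (shuffle q ∘ₚ σ) + ⟦ v ≟ᵥ block q ⟧ ≤ patternAt π (lookup v) σ
        touching v adm touch = subst (patternAt π (lookup v) (shuffle q ∘ₚ σ) + ⟦ v ≟ᵥ block q ⟧ ≤_)
          (sym (⟦⟧-yes (sameOrder? (π ⟨$⟩ʳ_) (λ r → σ ⟨$⟩ʳ lookup v r))
            (sameOrder-trans (sameOrder-reflexive π≈id) (increasing-inside q σ v inc adm touch))))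
          (exclusive (sameOrder? (π ⟨$⟩ʳ_) (λ r → (shuffle q ∘ₚ σ) ⟨$⟩ʳ lookup v r)) (v ≟ᵥ block q)
            λ { π~σ refl → ρ₀≉π (sameOrder⇒≈ ρ₀ π (sameOrder-trans (block-shuffled q σ inc) (sameOrder-sym π~σ))) })

    variance : ∀ {ρ} → ¬ (ρ Perm.≈ Perm.id) → ∀ c .{{_ : ℕ.NonZero c}} .{{_ : ℕ.NonZero (L ! ℕ.* c)}} → M ℕ.≤ n → n ℕ.≤ c ℕ.* M →
      (+ 1 / (L ! ℕ.* c)) ℚ.* (+ 1 / (L ! ℕ.* c)) ℚ.* fromℕ (n ℕ.^ 1) ℚ.≤ Var {n} (λ σ → fromℕ (occurrences π A σ))
    variance {ρ} ρ≉id = by-cases (all? λ r → π ⟨$⟩ʳ r Finₚ.≟ r)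
      where
      module R⁺ = Rearranged π
      -- For `π = id` rearranging by `π` would change nothing; some `ρ ≠ id` takes its place, and
      -- the sign becomes -1.
      module R⁻ = Rearranged ρ

      difference : ∀ a b → a + 1ℤ ≤ b → 1ℤ ≤ b - a
      difference a b a+1≤b = ≤-trans (≤-reflexive (eq a)) (+-monoˡ-≤ (- a) a+1≤b)
        where
        eq : ∀ a → 1ℤ ≡ a + 1ℤ - a
        eq = solve-∀

      negate : ∀ a b → b - a ≡ -1ℤ * (a - b)
      negate = solve-∀

      by-cases : Dec (π Perm.≈ Perm.id) → _
      by-cases (no π≉id) = DisjointWindows.variance window window-inj window-disjoint R⁺.τ
        (occurrences π A) (occurrences-ext π A) 1ℤ refl λ q σ inc →
          ≤-trans (difference (+ occurrences π A σ) _ (R⁺.gain⁺ π≉id (λ _ → refl) q σ inc))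
                  (≤-reflexive (sym (*-identityˡ _)))
      by-cases (yes π≈id) = DisjointWindows.variance window window-inj window-disjoint R⁻.τ
        (occurrences π A) (occurrences-ext π A) -1ℤ refl λ q σ inc →
          ≤-trans (difference (+ occurrences π A (R⁻.shuffle q ∘ₚ σ)) (+ occurrences π A σ)
                    (R⁻.gain⁻ π≈id (λ ρ≈π → ρ≉id λ r → trans (ρ≈π r) (π≈id r)) q σ inc))
                  (≤-reflexive (negate (+ occurrences π A (R⁻.shuffle q ∘ₚ σ)) (+ occurrences π A σ)))

  -- The constant is kept in the form `1 / d²` in which `variance-≥` delivers it.
  VarianceGrowth : Permutation′ k → Subset (ℕ.pred k) → ℕ → Set
  VarianceGrowth π A e = Σ[ d ∈ ℕ ] Σ[ d≢0 ∈ ℕ.NonZero d ] Σ[ n₀ ∈ ℕ ] (∀ n → n₀ ℕ.≤ n →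
    let instance _ = d≢0 in
    (+ 1 / d) ℚ.* (+ 1 / d) ℚ.* fromℕ (n ℕ.^ e) ℚ.≤ Var {n} (λ σ → fromℕ (occurrences π A σ)))

  -- The remainder is at most `l`, hence at most `l` times the quotient, which is positive.
  ≤-2*quotient : ∀ n l .{{_ : ℕ.NonZero l}} → l ℕ.≤ n → n ℕ.≤ 2 ℕ.* l ℕ.* (n ℕ./ l)
  ≤-2*quotient n l l≤n = begin
    n                                 ≡⟨ m≡m%n+[m/n]*n n l ⟩
    n ℕ.% l ℕ.+ n ℕ./ l ℕ.* l         ≤⟨ ℕₚ.+-monoˡ-≤ _ (m%n≤n n l) ⟩
    l ℕ.+ n ℕ./ l ℕ.* l               ≡⟨ cong₂ ℕ._+_ (sym (ℕₚ.*-identityʳ l)) (ℕₚ.*-comm (n ℕ./ l) l) ⟩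
    l ℕ.* 1 ℕ.+ l ℕ.* (n ℕ./ l)       ≤⟨ ℕₚ.+-monoˡ-≤ _ (ℕₚ.*-monoʳ-≤ l (m≥n⇒m/n>0 l≤n)) ⟩
    l ℕ.* (n ℕ./ l) ℕ.+ l ℕ.* (n ℕ./ l) ≡⟨ cong (l ℕ.* (n ℕ./ l) ℕ.+_) (sym (ℕₚ.+-identityʳ _)) ⟩
    2 ℕ.* (l ℕ.* (n ℕ./ l))           ≡⟨ ℕₚ.*-assoc 2 l _ ⟨
    2 ℕ.* l ℕ.* (n ℕ./ l)             ∎
    where open ℕₚ.≤-Reasoning

  consecutive-growth : (π : Permutation′ (suc (suc k))) (A : Subset (suc k)) → (∀ a → a ∈ A) → VarianceGrowth π A 1
  consecutive-growth {k} π A full = from-length _ refl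
    where
    from-length : ∀ l → l ≡ suc (suc k) ℕ.+ (suc (suc k) ℕ.+ suc (suc k)) → VarianceGrowth π A 1
    from-length l@(suc _) l≡3k = l ! ℕ.* (2 ℕ.* l) , d≢0 , l , λ n l≤n →
      Consecutive.variance (suc k) π A full n l (n ℕ./ l) l≡3k (m/n*n≤m n l)
        -- A rearrangement other than the identity exists because `π` has size at least 2.
        {Perm.transpose zero (suc zero)} (λ swap≈id → case swap≈id zero of λ ())
        (2 ℕ.* l) {{_}} {{d≢0}} (m/n≤m n l) (≤-2*quotient n l l≤n)
      where
      d≢0 : ℕ.NonZero (l ! ℕ.* (2 ℕ.* l))
      d≢0 = ℕₚ.m*n≢0 (l !) (2 ℕ.* l) {{l ℕₚ.!≢0}}

  -- Integer inequalities and sums over positions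

  0≤* : ∀ a b → 0ℤ ≤ a → 0ℤ ≤ b → 0ℤ ≤ a * b
  0≤* (+ m) (+ n) _ _ = ≤-trans (+≤+ ℕ.z≤n) (≤-reflexive (pos-* m n))

  0≤square : ∀ z → 0ℤ ≤ z * z
  0≤square (+ m)      = 0≤* (+ m) (+ m) (+≤+ ℕ.z≤n) (+≤+ ℕ.z≤n)
  0≤square (-[1+ m ]) = +≤+ ℕ.z≤n

  -- Polynomial inequalities are proved below by certificates: the ring solver identifies the
  -- difference of the two sides with an expression that is visibly nonnegative.
  ≤-by : ∀ {a b} c → b - a ≡ c → 0ℤ ≤ c → a ≤ b
  ≤-by c eq 0≤c = 0≤i-j⇒j≤i (≤-trans 0≤c (≤-reflexive (sym eq)))

  fin⇒nonZero : Fin n → ℕ.NonZero n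
  fin⇒nonZero {suc n} _ = _

  ∑-allFin-suc : ∀ n (f : Fin (suc n) → ℤ) → ∑ (allFin (suc n)) f ≡ f zero + (∑[ p ∈ allFin n ] f (suc p))
  ∑-allFin-suc n f = +-congˡ (f zero) (trans (cong (λ l → ∑ l f) (sym (map-tabulate (λ p → p) suc))) (∑-map suc (allFin n) f))

  ∑-below : ∀ {n h} → h ℕ.≤ n → ∑[ p ∈ allFin n ] ⟦ toℕ p ℕₚ.<? h ⟧ ≡ + h
  ∑-below {n} {zero}  _ = ∑-≡0 (allFin n) λ p → ⟦⟧-no (toℕ p ℕₚ.<? 0) λ ()
  ∑-below {suc n} {suc h} (ℕ.s≤s h≤n) = trans (∑-allFin-suc n (λ p → ⟦ toℕ p ℕₚ.<? suc h ⟧)) (+-congˡ 1ℤ (trans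
    (∑-cong (allFin n) λ p → ⟦⟧-cong (suc (toℕ p) ℕₚ.<? suc h) (toℕ p ℕₚ.<? h) ℕ.s≤s⁻¹ ℕ.s≤s)
    (∑-below h≤n)))

  ∑Fin-term-≤ : ∀ (f : Fin n → ℤ) → (∀ p → 0ℤ ≤ f p) → ∀ q → f q ≤ ∑ (allFin n) f
  ∑Fin-term-≤ {n} f 0≤f q = ≤-trans (≤-reflexive (sym (∑-pick (finEnumeration n) q f (cong f))))
    (∑-mono (allFin n) λ p → selected p (p Finₚ.≟ q))
    where
    selected : ∀ p (d : Dec (p ≡ q)) → ⟦ d ⟧ * f p ≤ f p
    selected p (yes _) = ≤-reflexive (*-identityˡ (f p))
    selected p (no _)  = ≤-trans (≤-reflexive (*-zeroˡ (f p))) (0≤f p)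

  ∑Fin-const : ∀ n c → ∑[ p ∈ allFin n ] c ≡ + n * c
  ∑Fin-const n c = trans (∑-const (allFin n) c) (cong (λ l → + l * c) (length-tabulate {n = n} (λ p → p)))

  ∑Perm-const : ∀ n c → ∑[ σ ∈ permutations n ] c ≡ + (n !) * c
  ∑Perm-const n c = trans (∑-const (permutations n) c) (cong (λ l → + l * c) (length-permutations n))

  ∑-image : ∀ {i : Fin k → Fin n} → Injective _≡_ _≡_ i → ∀ (f : Fin n → ℤ) →
            (∀ {p} → (∀ r → i r ≢ p) → f p ≡ 0ℤ) →
            ∑ (allFin n) f ≡ ∑[ r ∈ allFin k ] f (i r)
  ∑-image {k} {n} {i} i-inj f f-off = begin
    ∑ (allFin n) f
      ≡⟨ ∑-cong (allFin n) (λ p → sym (spread p (any? λ r → i r Finₚ.≟ p))) ⟩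
    (∑[ p ∈ allFin n ] ∑[ r ∈ allFin k ] ⟦ p Finₚ.≟ i r ⟧ * f p)
      ≡⟨ ∑-swap (allFin n) (allFin k) _ ⟩
    (∑[ r ∈ allFin k ] ∑[ p ∈ allFin n ] ⟦ p Finₚ.≟ i r ⟧ * f p)
      ≡⟨ ∑-cong (allFin k) (λ r → ∑-pick (finEnumeration n) (i r) f (cong f)) ⟩
    (∑[ r ∈ allFin k ] f (i r)) ∎
    where
    open ≡-Reasoning
    spread : ∀ p → Dec (∃ λ r → i r ≡ p) → ∑[ r ∈ allFin k ] ⟦ p Finₚ.≟ i r ⟧ * f p ≡ f p
    spread p (yes (s , refl)) = trans (∑-*ʳ (allFin k) (f p) _) (trans (cong (_* f p)
      (trans (∑-cong (allFin k) λ r → ⟦⟧-cong (i s Finₚ.≟ i r) (r Finₚ.≟ s) (λ eq → sym (i-inj eq)) (λ eq → cong i (sym eq)))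
             (Enumeration.once (finEnumeration k) s))) (*-identityˡ (f p)))
    spread p (no p∉i) = trans (∑-≡0 (allFin k) λ r →
      trans (cong (_* f p) (⟦⟧-no (p Finₚ.≟ i r) λ p≡ir → p∉i (r , sym p≡ir))) (*-zeroˡ (f p)))
      (sym (f-off λ r ir≡p → p∉i (r , ir≡p)))

  transpose-first : ∀ (p q : Fin n) → Perm.transpose p q ⟨$⟩ʳ p ≡ q
  transpose-first p q with p Finₚ.≟ p
  ... | yes _  = refl
  ... | no p≢p = contradiction refl p≢p

  transpose-other : ∀ (p q : Fin n) {r} → r ≢ p → r ≢ q → Perm.transpose p q ⟨$⟩ʳ r ≡ r
  transpose-other p q {r} r≢p r≢q with r Finₚ.≟ p
  ... | yes r≡p = contradiction r≡p r≢p
  ... | no _ with r Finₚ.≟ q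
  ...   | yes r≡q = contradiction r≡q r≢q
  ...   | no _    = refl

  -- Small values

  module SmallValues {n h : ℕ} (h≤n : h ℕ.≤ n) where

    small : Fin n → Permutation′ n → ℤ
    small p σ = ⟦ toℕ (σ ⟨$⟩ʳ p) ℕₚ.<? h ⟧

    -- centred, and scaled by n to stay in ℤ
    D : Fin n → Permutation′ n → ℤ
    D p σ = + n * small p σ - + h

    private Sₙ = permutations n

    small-cong : ∀ {p q σ τ} → σ ⟨$⟩ʳ p ≡ τ ⟨$⟩ʳ q → small p σ ≡ small q τ
    small-cong eq = cong (λ x → ⟦ toℕ x ℕₚ.<? h ⟧) eq

    D-cong : ∀ {p q σ τ} → σ ⟨$⟩ʳ p ≡ τ ⟨$⟩ʳ q → D p σ ≡ D q τ
    D-cong {p} {q} {σ} {τ} eq = cong (λ z → + n * z - + h) (small-cong {p} {q} {σ} {τ} eq)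

    D-ext : ∀ p → Extensional (D p)
    D-ext p σ τ σ≈τ = D-cong {p} {p} {σ} {τ} (σ≈τ p)

    D-transpose : ∀ p q σ → D p (Perm.transpose p q ∘ₚ σ) ≡ D q σ
    D-transpose p q σ = D-cong {p} {q} {Perm.transpose p q ∘ₚ σ} {σ} (cong (σ ⟨$⟩ʳ_) (transpose-first p q))

    D-transpose-other : ∀ p q {r} → r ≢ p → r ≢ q → ∀ σ → D r (Perm.transpose p q ∘ₚ σ) ≡ D r σ
    D-transpose-other p q {r} r≢p r≢q σ = D-cong {r} {r} {Perm.transpose p q ∘ₚ σ} {σ} (cong (σ ⟨$⟩ʳ_) (transpose-other p q r≢p r≢q))

    -- Valid for each `σ` separately, because a permutation takes exactly `h` values below `h`.
    -- Means, correlations and covariances with a pattern are all derived from this identity.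
    ∑ₚ-D : ∀ σ → ∑[ p ∈ allFin n ] D p σ ≡ 0ℤ
    ∑ₚ-D σ = begin
      (∑[ p ∈ allFin n ] D p σ)                                  ≡⟨ ∑-- (allFin n) _ _ ⟩
      (∑[ p ∈ allFin n ] + n * small p σ) - (∑[ p ∈ allFin n ] + h)
        ≡⟨ cong₂ _-_ (trans (∑-*ˡ (allFin n) (+ n) _) (cong (+ n *_)
             (trans (∑Fin-permute σ (λ p → ⟦ toℕ p ℕₚ.<? h ⟧)) (∑-below h≤n)))) (∑Fin-const n (+ h)) ⟩
      + n * + h - + n * + h                                       ≡⟨ +-inverseʳ (+ n * + h) ⟩
      0ℤ                                                          ∎
      where open ≡-Reasoning

    -- Transpositions make the sums for all positions equal, and together they vanish by `∑ₚ-D`.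
    ∑-D : ∀ p → ∑ Sₙ (D p) ≡ 0ℤ
    ∑-D p = *-cancelˡ-≡ (+ n) _ _ {{fin⇒nonZero p}} (begin
      + n * ∑ Sₙ (D p)                           ≡⟨ ∑Fin-const n _ ⟨
      (∑[ q ∈ allFin n ] ∑ Sₙ (D p))             ≡⟨ ∑-cong (allFin n) (λ q → sym (∑Perm-translate (Perm.transpose p q) (D-ext p))) ⟩
      (∑[ q ∈ allFin n ] ∑[ σ ∈ Sₙ ] D p (Perm.transpose p q ∘ₚ σ))
                                                 ≡⟨ ∑-cong (allFin n) (λ q → ∑-cong Sₙ (D-transpose p q)) ⟩
      (∑[ q ∈ allFin n ] ∑ Sₙ (D q))             ≡⟨ ∑-swap (allFin n) Sₙ _ ⟩
      (∑[ σ ∈ Sₙ ] ∑[ q ∈ allFin n ] D q σ)      ≡⟨ ∑-≡0 Sₙ ∑ₚ-D ⟩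
      0ℤ                                         ≡⟨ *-zeroʳ (+ n) ⟨
      + n * 0ℤ                                   ∎)
      where open ≡-Reasoning

    ∑-small : ∀ p → + n * ∑ Sₙ (small p) ≡ + h * + (n !)
    ∑-small p = begin
      + n * ∑ Sₙ (small p)                            ≡⟨ ∑-*ˡ Sₙ (+ n) (small p) ⟨
      (∑[ σ ∈ Sₙ ] + n * small p σ)                   ≡⟨ i-j≡0⇒i≡j _ _ (trans (sym (∑-- Sₙ _ _)) (∑-D p)) ⟩
      (∑[ σ ∈ Sₙ ] + h)                               ≡⟨ ∑Perm-const n (+ h) ⟩
      + (n !) * + h                                   ≡⟨ *-comm (+ (n !)) (+ h) ⟩
      + h * + (n !)                                   ∎
      where open ≡-Reasoning

    -- by exchangeability all off-diagonal sums agree, and together with the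
    -- diagonal they add up to 0
    ∑-DD≤0 : ∀ {p q} → p ≢ q → ∑[ σ ∈ Sₙ ] D p σ * D q σ ≤ 0ℤ
    ∑-DD≤0 {p} {q} p≢q = by-sign (≤-total (E q) 0ℤ)
      where
      E : Fin n → ℤ
      E r = ∑[ σ ∈ Sₙ ] D p σ * D r σ

      E-same : ∀ r → r ≢ p → E q ≡ E r
      E-same r r≢p = trans
        (sym (∑Perm-translate (Perm.transpose q r) λ σ τ σ≈τ → cong₂ _*_ (D-ext p σ τ σ≈τ) (D-ext q σ τ σ≈τ)))
        (∑-cong Sₙ λ σ → cong₂ _*_ (D-transpose-other q r p≢q (λ p≡r → r≢p (sym p≡r)) σ) (D-transpose q r σ))

      ∑-E : ∑ (allFin n) E ≡ 0ℤ
      ∑-E = trans (∑-swap (allFin n) Sₙ _) (∑-≡0 Sₙ λ σ →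
        trans (∑-*ˡ (allFin n) (D p σ) _) (trans (cong (D p σ *_) (∑ₚ-D σ)) (*-zeroʳ (D p σ))))

      by-sign : E q ≤ 0ℤ ⊎ 0ℤ ≤ E q → E q ≤ 0ℤ
      by-sign (inj₁ Eq≤0) = Eq≤0
      by-sign (inj₂ 0≤Eq) = ≤-trans (∑Fin-term-≤ E 0≤E q) (≤-reflexive ∑-E)
        where
        0≤E : ∀ r → 0ℤ ≤ E r
        0≤E r with r Finₚ.≟ p
        ... | yes refl = ∑-0≤ Sₙ λ σ → 0≤square (D p σ)
        ... | no r≢p   = ≤-trans 0≤Eq (≤-reflexive (E-same r r≢p))

    -- The nonpositive correlation of `D p` and `D q`, expanded: two given positions both hold small
    -- values with probability at most (h/n)².
    ∑-small² : ∀ {p q} → p ≢ q → + n * + n * (∑[ σ ∈ Sₙ ] small p σ * small q σ) ≤ + h * + h * + (n !)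
    ∑-small² {p} {q} p≢q = ≤-by (- (∑[ σ ∈ Sₙ ] D p σ * D q σ)) certificate (neg-mono-≤ (∑-DD≤0 p≢q))
      where
      b = ∑[ σ ∈ Sₙ ] small p σ * small q σ

      expand : ∀ n h a b → (n * a - h) * (n * b - h) ≡ n * n * (a * b) + (h * h - h * (n * a + n * b))
      expand = solve-∀

      ∑DD : ∑[ σ ∈ Sₙ ] D p σ * D q σ ≡ + n * + n * b + (+ (n !) * (+ h * + h) - + h * (+ n * ∑ Sₙ (small p) + + n * ∑ Sₙ (small q)))
      ∑DD = begin
        (∑[ σ ∈ Sₙ ] D p σ * D q σ)
          ≡⟨ ∑-cong Sₙ (λ σ → expand (+ n) (+ h) (small p σ) (small q σ)) ⟩
        (∑[ σ ∈ Sₙ ] (+ n * + n * (small p σ * small q σ) + (+ h * + h - + h * (+ n * small p σ + + n * small q σ))))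
          ≡⟨ trans (∑-+ Sₙ _ _) (cong₂ _+_ (∑-*ˡ Sₙ (+ n * + n) _) (trans (∑-- Sₙ _ _) (cong₂ _-_ (∑Perm-const n _)
               (trans (∑-*ˡ Sₙ (+ h) _) (cong (+ h *_) (trans (∑-+ Sₙ _ _) (cong₂ _+_ (∑-*ˡ Sₙ (+ n) _) (∑-*ˡ Sₙ (+ n) _)))))))) ⟩
        + n * + n * b + (+ (n !) * (+ h * + h) - + h * (+ n * ∑ Sₙ (small p) + + n * ∑ Sₙ (small q))) ∎
        where open ≡-Reasoning

      collect : ∀ n h N b → h * h * N - n * n * b ≡ - (n * n * b + (N * (h * h) - h * (h * N + h * N)))
      collect = solve-∀

      certificate : + h * + h * + (n !) - + n * + n * b ≡ - (∑[ σ ∈ Sₙ ] D p σ * D q σ)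
      certificate = trans (collect (+ n) (+ h) (+ (n !)) b) (cong -_ (sym (trans ∑DD
        (cong₂ (λ x y → + n * + n * b + (+ (n !) * (+ h * + h) - + h * (x + y))) (∑-small p) (∑-small q)))))

    -- Covariances with the indicator of an order pattern

    module _ (π : Permutation′ k) {i : Fin k → Fin n} (i-inj : Injective _≡_ _≡_ i) where

      private
        pat = patternAt π i

      G : Fin n → ℤ
      G p = ∑[ σ ∈ Sₙ ] pat σ * D p σ

      k!≢0 : ℕ.NonZero (k !)
      k!≢0 = k ℕₚ.!≢0

      -- `D p` does not change when the positions `i` are rearranged, so it is independent of the
      -- pattern, and its mean is 0.
      G-off : ∀ {p} → (∀ r → i r ≢ p) → G p ≡ 0ℤ
      G-off {p} p∉i = *-cancelˡ-≡ (+ (k !)) _ _ {{k!≢0}} (trans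
        (∑-patternAt π i-inj (D p) (D-ext p) λ ρ σ → D-cong {p} {p} {along i i-inj ρ ∘ₚ σ} {σ} (cong (σ ⟨$⟩ʳ_) (along-off i-inj ρ p∉i)))
        (trans (∑-D p) (sym (*-zeroʳ (+ (k !))))))

      ∑-G : ∑ (allFin n) G ≡ 0ℤ
      ∑-G = trans (∑-swap (allFin n) Sₙ _) (∑-≡0 Sₙ λ σ →
        trans (∑-*ˡ (allFin n) (pat σ) _) (trans (cong (pat σ *_) (∑ₚ-D σ)) (*-zeroʳ (pat σ))))

      private
        S = ∑ Sₙ pat

        G-expand : ∀ p → G p ≡ + n * (∑[ σ ∈ Sₙ ] pat σ * small p σ) - + h * S
        G-expand p = trans (∑-cong Sₙ λ σ → expand (+ n) (+ h) (pat σ) (small p σ))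
          (trans (∑-- Sₙ _ _) (cong₂ _-_ (∑-*ˡ Sₙ (+ n) _) (∑-*ˡ Sₙ (+ h) _)))
          where
          expand : ∀ n h a b → a * (n * b - h) ≡ n * (a * b) - h * a
          expand = solve-∀

      -- This is `D p ≥ - h` averaged over the pattern. The bound is crude, but it is applied only
      -- at the rare bad position vectors.
      -G≤ : ∀ p → - G p ≤ + h * + (n !)
      -G≤ p = begin
        - G p                                      ≡⟨ cong -_ (G-expand p) ⟩
        - (+ n * T - + h * S)                      ≡⟨ flip (+ n * T) (+ h * S) ⟩
        + h * S - + n * T                          ≤⟨ +-monoʳ-≤ (+ h * S) (neg-mono-≤ 0≤nT) ⟩
        + h * S + 0ℤ                               ≡⟨ +-identityʳ _ ⟩
        + h * S                                    ≤⟨ *-monoˡ-≤-nonNeg (+ h) (∑-mono Sₙ λ σ → ⟦⟧≤1 _) ⟩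
        + h * (∑[ σ ∈ Sₙ ] 1ℤ)                     ≡⟨ cong (+ h *_) (trans (∑Perm-const n 1ℤ) (*-identityʳ _)) ⟩
        + h * + (n !)                              ∎
        where
        open ≤-Reasoning
        T = ∑[ σ ∈ Sₙ ] pat σ * small p σ
        0≤nT : 0ℤ ≤ + n * T
        0≤nT = 0≤* (+ n) T (+≤+ ℕ.z≤n) (∑-0≤ Sₙ λ σ → 0≤* (pat σ) (small p σ) (0≤⟦⟧ _) (0≤⟦⟧ _))
        flip : ∀ a b → - (a - b) ≡ b - a
        flip = solve-∀

      module _ {m₀ : Fin k} (m₀-min : ∀ {r} → r ≢ m₀ → π ⟨$⟩ʳ m₀ Fin.< π ⟨$⟩ʳ r)
               (2k!h≤n : 2 ℕ.* (k !) ℕ.* h ℕ.≤ n) where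

        -- a small value at a position other than the minimum forces a second
        -- small value, which is too unlikely to make up for - h
        ≤-G : ∀ {r} → r ≢ m₀ → + h * + (n !) ≤ + 2 * + (k !) * - G (i r)
        ≤-G {r} r≢m₀ = *-cancelˡ-≤-pos _ _ (+ n) {{0<n}}
          -- The first summand is nonnegative because `2 k! h ≤ n`, the second by `∑-small²`. The
          -- identity uses that `n !` is `k !` times `S`.
          (≤-by ((+ n - + 2 * + (k !) * + h) * (+ h * + (n !)) + + 2 * + (k !) * (+ h * + h * + (n !) - + n * + n * T))
            certificate
            (+-mono-≤ (0≤* (+ n - + 2 * + (k !) * + h) (+ h * + (n !)) (i≤j⇒0≤j-i 2k!h≤n′) (0≤* (+ h) (+ (n !)) (+≤+ ℕ.z≤n) (+≤+ ℕ.z≤n)))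
                      (0≤* (+ 2 * + (k !)) (+ h * + h * + (n !) - + n * + n * T) (0≤* (+ 2) (+ (k !)) (+≤+ ℕ.z≤n) (+≤+ ℕ.z≤n)) (i≤j⇒0≤j-i nnT≤))))
          where
          0<n : Positive (+ n)
          0<n = ℤpositive (fin⇒nonZero (i r))
            where
            ℤpositive : ∀ {n} → ℕ.NonZero n → Positive (+ n)
            ℤpositive {suc n} _ = _

          T = ∑[ σ ∈ Sₙ ] pat σ * small (i r) σ

          2k!h≤n′ : + 2 * + (k !) * + h ≤ + n
          2k!h≤n′ = ≤-trans (≤-reflexive (trans (cong (_* + h) (sym (pos-* 2 (k !)))) (sym (pos-* (2 ℕ.* (k !)) h)))) (+≤+ 2k!h≤n)

          two-small : ∀ σ → pat σ * small (i r) σ ≤ small (i r) σ * small (i m₀) σ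
          two-small σ with sameOrder? (π ⟨$⟩ʳ_) (λ s → σ ⟨$⟩ʳ i s) | toℕ (σ ⟨$⟩ʳ i r) ℕₚ.<? h | toℕ (σ ⟨$⟩ʳ i m₀) ℕₚ.<? h
          ... | yes _   | yes _  | yes _    = ≤-refl
          ... | yes π~σ | yes lt | no ¬lt   = contradiction (ℕₚ.<-trans (Equivalence.to (π~σ m₀ r) (m₀-min r≢m₀)) lt) ¬lt
          ... | yes _   | no _   | d        = ≤-reflexive (sym (*-zeroˡ ⟦ d ⟧))
          ... | no _    | d      | d′       = ≤-trans (≤-reflexive (*-zeroˡ ⟦ d ⟧)) (0≤* ⟦ d ⟧ ⟦ d′ ⟧ (0≤⟦⟧ d) (0≤⟦⟧ d′))

          nnT≤ : + n * + n * T ≤ + h * + h * + (n !)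
          nnT≤ = ≤-trans (monoˡ (∑-mono Sₙ two-small)) (∑-small² λ ir≡im₀ → r≢m₀ (i-inj ir≡im₀))
            where
            monoˡ : ∀ {a b} → a ≤ b → + n * + n * a ≤ + n * + n * b
            monoˡ a≤b = ≤-trans (≤-reflexive (*-assoc (+ n) (+ n) _))
              (≤-trans (*-monoˡ-≤-nonNeg (+ n) (*-monoˡ-≤-nonNeg (+ n) a≤b)) (≤-reflexive (sym (*-assoc (+ n) (+ n) _))))

          expand : ∀ n h N F S T → N ≡ F * S →
            n * (+ 2 * F * - (n * T - h * S)) - n * (h * N) ≡
            (n - + 2 * F * h) * (h * N) + + 2 * F * (h * h * N - n * n * T)
          expand n h N F S T refl = identity n h F S T
            where
            identity : ∀ n h F S T →
              n * (+ 2 * F * - (n * T - h * S)) - n * (h * (F * S)) ≡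
              (n - + 2 * F * h) * (h * (F * S)) + + 2 * F * (h * h * (F * S) - n * n * T)
            identity = solve-∀

          certificate : + n * (+ 2 * + (k !) * - G (i r)) - + n * (+ h * + (n !)) ≡
            (+ n - + 2 * + (k !) * + h) * (+ h * + (n !)) + + 2 * + (k !) * (+ h * + h * + (n !) - + n * + n * T)
          certificate = trans (cong (λ z → + n * (+ 2 * + (k !) * - z) - + n * (+ h * + (n !))) (G-expand (i r)))
            (expand (+ n) (+ h) (+ (n !)) (+ (k !)) S T (sym (∑-patternAt-1 π i-inj)))

  signed-difference≥-1 : ∀ {s} → s ≡ 1ℤ ⊎ s ≡ -1ℤ → (P? : Dec P) (Q? : Dec Q) → -1ℤ ≤ s * (⟦ P? ⟧ - ⟦ Q? ⟧)
  signed-difference≥-1 (inj₁ refl) (yes _) (yes _) = -≤+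
  signed-difference≥-1 (inj₁ refl) (yes _) (no _)  = -≤+
  signed-difference≥-1 (inj₁ refl) (no _)  (yes _) = ≤-refl
  signed-difference≥-1 (inj₁ refl) (no _)  (no _)  = -≤+
  signed-difference≥-1 (inj₂ refl) (yes _) (yes _) = -≤+
  signed-difference≥-1 (inj₂ refl) (yes _) (no _)  = ≤-refl
  signed-difference≥-1 (inj₂ refl) (no _)  (yes _) = -≤+
  signed-difference≥-1 (inj₂ refl) (no _)  (no _)  = -≤+

  sign² : ∀ {s} → s ≡ 1ℤ ⊎ s ≡ -1ℤ → s * s ≡ 1ℤ
  sign² (inj₁ refl) = refl
  sign² (inj₂ refl) = refl

  -- The box count as a test statistic

  module BoxCount {n h : ℕ} (h≤n : h ℕ.≤ n) (s : ℤ) (s-sign : s ≡ 1ℤ ⊎ s ≡ -1ℤ) where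

    open SmallValues h≤n

    private
      Sₙ = permutations n
      N  = + (n !)

    inBox : Fin n → ℤ
    inBox p = ⟦ toℕ p ℕₚ.<? h ⟧

    -- The sign `s` is there to make the covariance with the number of occurrences positive; it will
    -- be chosen by the block that contains the minimum of `π`.
    y : Fin n → Permutation′ n → ℤ
    y p σ = s * (inBox p * D p σ)

    boxCount : Permutation′ n → ℤ
    boxCount σ = ∑[ p ∈ allFin n ] y p σ

    ∑-boxCount : ∑ Sₙ boxCount ≡ 0ℤ
    ∑-boxCount = trans (∑-swap Sₙ (allFin n) _) (∑-≡0 (allFin n) λ p →
      trans (∑-*ˡ Sₙ s _) (trans (cong (s *_) (trans (∑-*ˡ Sₙ (inBox p) (D p)) (trans (cong (inBox p *_) (∑-D p)) (*-zeroʳ (inBox p))))) (*-zeroʳ s)))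

    private
      y*y : ∀ p q σ → y p σ * y q σ ≡ inBox p * inBox q * (D p σ * D q σ)
      y*y p q σ = trans (regroup s (inBox p) (inBox q) (D p σ) (D q σ))
                        (trans (cong (_* (inBox p * inBox q * (D p σ * D q σ))) (sign² s-sign)) (*-identityˡ _))
        where
        regroup : ∀ s a b x z → s * (a * x) * (s * (b * z)) ≡ s * s * (a * b * (x * z))
        regroup = solve-∀

      0≤*≤0 : ∀ a b → 0ℤ ≤ a → b ≤ 0ℤ → a * b ≤ 0ℤ
      0≤*≤0 a b 0≤a b≤0 = ≤-by (a * - b) (eq a b) (0≤* a (- b) 0≤a (neg-mono-≤ b≤0))
        where
        eq : ∀ a b → 0ℤ - a * b ≡ a * - b
        eq = solve-∀

      cross≤0 : ∀ p q → p ≢ q → ∑[ σ ∈ Sₙ ] y p σ * y q σ ≤ 0ℤ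
      cross≤0 p q p≢q = ≤-trans
        (≤-reflexive (trans (∑-cong Sₙ (y*y p q)) (∑-*ˡ Sₙ (inBox p * inBox q) _)))
        (0≤*≤0 (inBox p * inBox q) (∑[ σ ∈ Sₙ ] D p σ * D q σ) (0≤* (inBox p) (inBox q) (0≤⟦⟧ _) (0≤⟦⟧ _)) (∑-DD≤0 p≢q))

      bounded² : ∀ (P? Q? : Dec P) (n h : ℤ) (R? : Dec R) → 0ℤ ≤ h → h ≤ n →
                 ⟦ P? ⟧ * ⟦ P? ⟧ * ((n * ⟦ R? ⟧ - h) * (n * ⟦ R? ⟧ - h)) ≤ n * n
      bounded² (no _) _ n h R? 0≤h h≤n = ≤-trans (≤-reflexive (*-zeroˡ ((n * ⟦ R? ⟧ - h) * (n * ⟦ R? ⟧ - h)))) (0≤square n)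
      bounded² (yes _) _ n h (no _) 0≤h h≤n = ≤-by ((n - h) * (n - h) + + 2 * (h * (n - h))) (eq n h)
        (+-mono-≤ (0≤square (n - h)) (0≤* (+ 2) (h * (n - h)) (+≤+ ℕ.z≤n) (0≤* h (n - h) 0≤h (i≤j⇒0≤j-i h≤n))))
        where
        eq : ∀ n h → n * n - 1ℤ * 1ℤ * ((n * 0ℤ - h) * (n * 0ℤ - h)) ≡ (n - h) * (n - h) + + 2 * (h * (n - h))
        eq = solve-∀
      bounded² (yes _) _ n h (yes _) 0≤h h≤n = ≤-by (h * h + + 2 * (h * (n - h))) (eq n h)
        (+-mono-≤ (0≤square h) (0≤* (+ 2) (h * (n - h)) (+≤+ ℕ.z≤n) (0≤* h (n - h) 0≤h (i≤j⇒0≤j-i h≤n))))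
        where
        eq : ∀ n h → n * n - 1ℤ * 1ℤ * ((n * 1ℤ - h) * (n * 1ℤ - h)) ≡ h * h + + 2 * (h * (n - h))
        eq = solve-∀

    -- Nonpositive correlation leaves `n` diagonal terms, each at most `n²` since `D` takes only the
    -- values `n - h` and `- h`. The trivial bound of order n⁴ would be too weak.
    ∑-boxCount² : ∑[ σ ∈ Sₙ ] boxCount σ * boxCount σ ≤ + n * (N * (+ n * + n))
    ∑-boxCount² = begin
      (∑[ σ ∈ Sₙ ] boxCount σ * boxCount σ)            ≤⟨ ∑-square-≤ Sₙ y cross≤0 ⟩
      (∑[ p ∈ allFin n ] ∑[ σ ∈ Sₙ ] y p σ * y p σ)    ≤⟨ ∑-mono (allFin n) (λ p → ∑-mono Sₙ λ σ → ≤-trans (≤-reflexive (y*y p p σ))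
                                                            (bounded² (toℕ p ℕₚ.<? h) (toℕ p ℕₚ.<? h) (+ n) (+ h) (toℕ (σ ⟨$⟩ʳ p) ℕₚ.<? h) (+≤+ ℕ.z≤n) (+≤+ h≤n))) ⟩
      (∑[ p ∈ allFin n ] ∑[ σ ∈ Sₙ ] + n * + n)        ≡⟨ trans (∑Fin-const n _) (cong (+ n *_) (∑Perm-const n (+ n * + n))) ⟩
      + n * (N * (+ n * + n))                          ∎
      where open ≤-Reasoning

    -- The case distinction on the block of the minimum is packed into the hypotheses, so that both
    -- cases share the computation. The weight of `r` records whether the boundary `h` separates the
    -- position of the minimum from that of `r`, and in which direction.
    module Covariance {k : ℕ} (π : Permutation′ k) (A : Subset (ℕ.pred k)) {m₀ : Fin k}
      (m₀-min : ∀ {r} → r ≢ m₀ → π ⟨$⟩ʳ m₀ Fin.< π ⟨$⟩ʳ r) (2k!h≤n : 2 ℕ.* (k !) ℕ.* h ℕ.≤ n)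
      {Good Bad : Vec (Fin n) k → Set} (good? : ∀ v → Dec (Good v)) (bad? : ∀ v → Dec (Bad v))
      (weight≥0 : ∀ v → Admissible A v → ¬ Bad v → ∀ r → 0ℤ ≤ s * (inBox (lookup v m₀) - inBox (lookup v r)))
      (weight≡1 : ∀ v → Admissible A v → Good v → ∃ λ r → s * (inBox (lookup v m₀) - inBox (lookup v r)) ≡ 1ℤ)
      (good⇒¬bad : ∀ v → Good v → ¬ Bad v)
      where

      private
        U = + h * N
        F = + (k !)

        0≤U : 0ℤ ≤ U
        0≤U = 0≤* (+ h) N (+≤+ ℕ.z≤n) (+≤+ ℕ.z≤n)

        adm : Vec (Fin n) k → ℤ
        adm v = ⟦ admissible? A v ⟧

        Z : Vec (Fin n) k → ℤ
        Z v = ∑[ p ∈ allFin n ] inBox p * (∑[ σ ∈ Sₙ ] patternAt π (lookup v) σ * D p σ)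

      #good #bad : ℤ
      #good = ∑[ v ∈ vectors n k ] adm v * ⟦ good? v ⟧
      #bad  = ∑[ v ∈ vectors n k ] adm v * ⟦ bad? v ⟧

      private
        module Pointwise (v : Vec (Fin n) k) (v-adm : Admissible A v) where

          v-inj = linked⇒injective (proj₁ v-adm)
          G′ = G π v-inj

          w : Fin k → ℤ
          w r = s * (inBox (lookup v m₀) - inBox (lookup v r))

          term : Fin k → ℤ
          term r = w r * - G′ (lookup v r)

          -- Since `G′` adds up to 0 over all positions, the constant `cₘ` may be subtracted from
          -- the indicator of the box. This removes the term at `m₀`, where `≤-G` says nothing, and
          -- by `G-off` only the other positions of `v` remain.
          s*Z : s * Z v ≡ ∑ (allFin k) term
          s*Z = begin
            s * (∑[ p ∈ allFin n ] inBox p * G′ p)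
              ≡⟨ cong (s *_) (∑-cong (allFin n) λ p → split (inBox p) cₘ (G′ p)) ⟩
            s * (∑[ p ∈ allFin n ] ((inBox p - cₘ) * G′ p + cₘ * G′ p))
              ≡⟨ cong (s *_) (trans (∑-+ (allFin n) (λ p → (inBox p - cₘ) * G′ p) (λ p → cₘ * G′ p)) (+-congˡ (∑[ p ∈ allFin n ] (inBox p - cₘ) * G′ p)
                   (trans (∑-*ˡ (allFin n) cₘ G′) (trans (cong (cₘ *_) (∑-G π v-inj)) (*-zeroʳ cₘ))))) ⟩
            s * ((∑[ p ∈ allFin n ] (inBox p - cₘ) * G′ p) + 0ℤ)
              ≡⟨ cong (s *_) (trans (+-identityʳ _) (∑-image v-inj (λ p → (inBox p - cₘ) * G′ p)
                   λ {p} p∉v → trans (cong ((inBox p - cₘ) *_) (G-off π v-inj p∉v)) (*-zeroʳ (inBox p - cₘ)))) ⟩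
            s * (∑[ r ∈ allFin k ] (inBox (lookup v r) - cₘ) * G′ (lookup v r))
              ≡⟨ ∑-*ˡ (allFin k) s _ ⟨
            (∑[ r ∈ allFin k ] s * ((inBox (lookup v r) - cₘ) * G′ (lookup v r)))
              ≡⟨ ∑-cong (allFin k) (λ r → flip s cₘ (inBox (lookup v r)) (G′ (lookup v r))) ⟩
            ∑ (allFin k) term ∎
            where
            open ≡-Reasoning
            cₘ = inBox (lookup v m₀)
            split : ∀ a b g → a * g ≡ (a - b) * g + b * g
            split = solve-∀
            flip : ∀ s b a g → s * ((a - b) * g) ≡ s * (b - a) * - g
            flip = solve-∀

          wₘ≡0 : w m₀ ≡ 0ℤ
          wₘ≡0 = trans (cong (s *_) (+-inverseʳ (inBox (lookup v m₀)))) (*-zeroʳ s)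

          U≤2F-G : ∀ {r} → r ≢ m₀ → U ≤ + 2 * F * - G′ (lookup v r)
          U≤2F-G = ≤-G π v-inj m₀-min 2k!h≤n

          0≤-G : ∀ {r} → r ≢ m₀ → 0ℤ ≤ - G′ (lookup v r)
          0≤-G {r} r≢m₀ = *-cancelˡ-≤-pos 0ℤ (- G′ (lookup v r)) (+ (2 ℕ.* k !)) {{0<2F}} (≤-trans (≤-reflexive (*-zeroʳ (+ (2 ℕ.* k !))))
            (≤-trans 0≤U (≤-trans (U≤2F-G r≢m₀) (≤-reflexive (cong (_* - G′ (lookup v r)) (sym (pos-* 2 (k !))))))))
            where
            0<2F : Positive (+ (2 ℕ.* k !))
            0<2F = helper (ℕₚ.m*n≢0 2 (k !) {{_}} {{k ℕₚ.!≢0}})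
              where
              helper : ∀ {m} → ℕ.NonZero m → Positive (+ m)
              helper {suc m} _ = _

          term≥0 : ¬ Bad v → ∀ r → 0ℤ ≤ term r
          term≥0 ¬bad r = by-cases (r Finₚ.≟ m₀)
            where
            by-cases : Dec (r ≡ m₀) → 0ℤ ≤ term r
            by-cases (yes refl) = ≤-reflexive (sym (trans (cong (_* - G′ (lookup v m₀)) wₘ≡0) (*-zeroˡ (- G′ (lookup v m₀)))))
            by-cases (no r≢m₀)  = 0≤* (w r) (- G′ (lookup v r)) (weight≥0 v v-adm ¬bad r) (0≤-G r≢m₀)

          -- Away from `m₀` the weight is at least -1 and `- G′` lies between 0 and `U`; at `m₀` the
          -- weight is 0.
          term≥-U : ∀ r → - U ≤ term r
          term≥-U r = by-cases (r Finₚ.≟ m₀)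
            where
            g = - G′ (lookup v r)
            eq : ∀ w g u → w * g - - u ≡ (w - -1ℤ) * g + (u - g)
            eq = solve-∀
            by-cases : Dec (r ≡ m₀) → - U ≤ term r
            by-cases (yes refl) = ≤-trans (neg-mono-≤ 0≤U) (≤-reflexive (sym (trans (cong (_* - G′ (lookup v m₀)) wₘ≡0) (*-zeroˡ (- G′ (lookup v m₀))))))
            by-cases (no r≢m₀)  = ≤-by ((w r - -1ℤ) * g + (U - g)) (eq (w r) g U)
              (+-mono-≤ (0≤* (w r - -1ℤ) g (i≤j⇒0≤j-i (signed-difference≥-1 s-sign (toℕ (lookup v m₀) ℕₚ.<? h) (toℕ (lookup v r) ℕₚ.<? h))) (0≤-G r≢m₀))
                        (i≤j⇒0≤j-i (-G≤ π v-inj (lookup v r))))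

          -- A good vector has a term of weight 1, worth at least `U / (2 k!)`, and no negative
          -- term. A bad one loses at most `U` in each of its `k` terms, whence the factor `2 k! k`.
          -- All others contribute nonnegatively.
          bound : U * (⟦ good? v ⟧ - + 2 * F * + k * ⟦ bad? v ⟧) ≤ + 2 * F * (s * Z v)
          bound = ≤-trans (by-cases (good? v) (bad? v)) (≤-reflexive (cong (+ 2 * F *_) (sym s*Z)))
            where
            2F* : ∀ {a b} → a ≤ b → + 2 * F * a ≤ + 2 * F * b
            2F* {a} {b} a≤b = ≤-trans (≤-reflexive (*-assoc (+ 2) F a))
              (≤-trans (*-monoˡ-≤-nonNeg (+ 2) (*-monoˡ-≤-nonNeg F a≤b)) (≤-reflexive (sym (*-assoc (+ 2) F b))))

            zero-good : ∀ u b → u * (0ℤ - b * 0ℤ) ≡ 0ℤ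
            zero-good = solve-∀
            one-good : ∀ u b → u * (1ℤ - b * 0ℤ) ≡ u
            one-good = solve-∀
            one-bad : ∀ u f k → u * (0ℤ - + 2 * f * k * 1ℤ) ≡ + 2 * f * (k * - u)
            one-bad = solve-∀

            by-cases : (g : Dec (Good v)) (b : Dec (Bad v)) → U * (⟦ g ⟧ - + 2 * F * + k * ⟦ b ⟧) ≤ + 2 * F * ∑ (allFin k) term
            by-cases (yes good) (yes bad) = contradiction bad (good⇒¬bad v good)
            by-cases (no _) (no ¬bad) = ≤-trans (≤-reflexive (trans (zero-good U (+ 2 * F * + k)) (sym (*-zeroʳ (+ 2 * F)))))
              (2F* (∑-0≤ (allFin k) (term≥0 ¬bad)))
            by-cases (no _) (yes bad) = ≤-trans (≤-reflexive (one-bad U F (+ k)))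
              (2F* (≤-trans (≤-reflexive (sym (∑Fin-const k (- U)))) (∑-mono (allFin k) term≥-U)))
            by-cases (yes good) (no ¬bad) = ≤-trans (≤-reflexive (one-good U (+ 2 * F * + k)))
              (≤-trans (U≤2F-G r≢m₀) (≤-trans (≤-reflexive (cong (+ 2 * F *_) (sym (trans (cong (_* - G′ (lookup v r)) w≡1) (*-identityˡ _)))))
                (2F* (∑Fin-term-≤ term (term≥0 ¬bad) r))))
              where
              r   = proj₁ (weight≡1 v v-adm good)
              w≡1 = proj₂ (weight≡1 v v-adm good)
              r≢m₀ : r ≢ m₀
              r≢m₀ r≡m₀ = case trans (sym w≡1) (trans (cong w r≡m₀) wₘ≡0) of λ ()

        ∑-X*boxCount : ∑[ σ ∈ Sₙ ] + occurrences π A σ * boxCount σ ≡ ∑[ v ∈ vectors n k ] adm v * (s * Z v)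
        ∑-X*boxCount = begin
          (∑[ σ ∈ Sₙ ] + occurrences π A σ * boxCount σ)
            ≡⟨ ∑-cong Sₙ (λ σ → trans (cong (_* boxCount σ) (occurrences-∑ π A σ)) (sym (∑-*ʳ V (boxCount σ) _))) ⟩
          (∑[ σ ∈ Sₙ ] ∑[ v ∈ V ] adm v * pat v σ * boxCount σ)
            ≡⟨ ∑-swap Sₙ V _ ⟩
          (∑[ v ∈ V ] ∑[ σ ∈ Sₙ ] adm v * pat v σ * boxCount σ)
            ≡⟨ ∑-cong V (λ v → trans (∑-cong Sₙ λ σ → *-assoc (adm v) (pat v σ) (boxCount σ)) (∑-*ˡ Sₙ (adm v) _)) ⟩
          (∑[ v ∈ V ] adm v * (∑[ σ ∈ Sₙ ] pat v σ * boxCount σ))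
            ≡⟨ ∑-cong V (λ v → cong (adm v *_) (expand v)) ⟩
          (∑[ v ∈ V ] adm v * (s * Z v)) ∎
          where
          open ≡-Reasoning
          V = vectors n k
          pat : Vec (Fin n) k → Permutation′ n → ℤ
          pat v = patternAt π (lookup v)

          regroup : ∀ a s x d → a * (s * (x * d)) ≡ s * (x * (a * d))
          regroup = solve-∀

          expand : ∀ v → ∑[ σ ∈ Sₙ ] pat v σ * boxCount σ ≡ s * Z v
          expand v = begin
            (∑[ σ ∈ Sₙ ] pat v σ * boxCount σ)
              ≡⟨ ∑-cong Sₙ (λ σ → trans (sym (∑-*ˡ (allFin n) (pat v σ) _)) (∑-cong (allFin n) λ p → regroup (pat v σ) s (inBox p) (D p σ))) ⟩
            (∑[ σ ∈ Sₙ ] ∑[ p ∈ allFin n ] s * (inBox p * (pat v σ * D p σ)))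
              ≡⟨ ∑-swap Sₙ (allFin n) _ ⟩
            (∑[ p ∈ allFin n ] ∑[ σ ∈ Sₙ ] s * (inBox p * (pat v σ * D p σ)))
              ≡⟨ ∑-cong (allFin n) (λ p → trans (∑-*ˡ Sₙ s _) (cong (s *_) (∑-*ˡ Sₙ (inBox p) _))) ⟩
            (∑[ p ∈ allFin n ] s * (inBox p * (∑[ σ ∈ Sₙ ] pat v σ * D p σ)))
              ≡⟨ ∑-*ˡ (allFin n) s _ ⟩
            s * Z v ∎

      covariance-≥ : U * (#good - + 2 * F * + k * #bad) ≤ + 2 * F * (∑[ σ ∈ Sₙ ] + occurrences π A σ * boxCount σ)
      covariance-≥ = begin
        U * (#good - β * #bad)
          ≡⟨ cong (U *_) (trans (cong (λ z → #good - z) (sym (∑-*ˡ V β (λ v → adm v * ⟦ bad? v ⟧)))) (sym (∑-- V (λ v → adm v * ⟦ good? v ⟧) (λ v → β * (adm v * ⟦ bad? v ⟧))))) ⟩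
        U * (∑[ v ∈ V ] (adm v * ⟦ good? v ⟧ - β * (adm v * ⟦ bad? v ⟧)))
          ≡⟨ ∑-*ˡ V U _ ⟨
        (∑[ v ∈ V ] U * (adm v * ⟦ good? v ⟧ - β * (adm v * ⟦ bad? v ⟧)))
          ≤⟨ ∑-mono V pointwise ⟩
        (∑[ v ∈ V ] + 2 * F * (adm v * (s * Z v)))
          ≡⟨ ∑-*ˡ V (+ 2 * F) _ ⟩
        + 2 * F * (∑[ v ∈ V ] adm v * (s * Z v))
          ≡⟨ cong (+ 2 * F *_) (sym ∑-X*boxCount) ⟩
        + 2 * F * (∑[ σ ∈ Sₙ ] + occurrences π A σ * boxCount σ) ∎
        where
        open ≤-Reasoning
        V = vectors n k
        β = + 2 * F * + k

        unit : ∀ u g b x → u * (1ℤ * g - b * (1ℤ * x)) ≡ u * (g - b * x)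
        unit = solve-∀
        vanish : ∀ u g b x f z → u * (0ℤ * g - b * (0ℤ * x)) ≡ f * (0ℤ * z)
        vanish = solve-∀

        pointwise : ∀ v → U * (adm v * ⟦ good? v ⟧ - β * (adm v * ⟦ bad? v ⟧)) ≤ + 2 * F * (adm v * (s * Z v))
        pointwise v with admissible? A v
        ... | yes v-adm = ≤-trans (≤-reflexive (unit U ⟦ good? v ⟧ β ⟦ bad? v ⟧))
                            (≤-trans (Pointwise.bound v v-adm) (≤-reflexive (cong (+ 2 * F *_) (sym (*-identityˡ (s * Z v))))))
        ... | no _      = ≤-reflexive (vanish U ⟦ good? v ⟧ β ⟦ bad? v ⟧ (+ 2 * F) (s * Z v))

  -- Counting position vectors

  ∑-vectors-suc : ∀ n k (f : Vec (Fin n) (suc k) → ℤ) →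
    ∑ (vectors n (suc k)) f ≡ ∑[ x ∈ allFin n ] ∑[ v ∈ vectors n k ] f (x ∷ v)
  ∑-vectors-suc n k f = ∑-cartesianProductWith _∷_ (allFin n) (vectors n k) f

  ∑-weighted-≤ : ∀ (xs : List A) (f g : A → ℤ) c → (∀ x → 0ℤ ≤ f x) → (∀ x → g x ≤ c) →
                 ∑[ x ∈ xs ] f x * g x ≤ ∑ xs f * c
  ∑-weighted-≤ xs f g c 0≤f g≤c = ≤-trans
    (∑-mono xs λ x → *-monoˡ-≤-nonNeg (f x) {{nonNegative (0≤f x)}} (g≤c x)) (≤-reflexive (∑-*ʳ xs c f))

  module _ {n : ℕ} where

    private
      Fₙ = allFin n

    ∑-toℕ : ∀ {m} (m<n : m ℕ.< n) (f : Fin n → ℤ) →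
            ∑[ y ∈ Fₙ ] ⟦ toℕ y ℕₚ.≟ m ⟧ * f y ≡ f (Fin.fromℕ< m<n)
    ∑-toℕ {m} m<n f = trans
      (∑-cong Fₙ λ y → cong (_* f y) (⟦⟧-cong (toℕ y ℕₚ.≟ m) (y Finₚ.≟ Fin.fromℕ< m<n)
        (λ eq → Finₚ.toℕ-injective (trans eq (sym (Finₚ.toℕ-fromℕ< m<n)))) (λ { refl → Finₚ.toℕ-fromℕ< m<n })))
      (∑-pick (finEnumeration n) (Fin.fromℕ< m<n) f (cong f))

    ∑-toℕ≤1 : ∀ m → ∑[ y ∈ Fₙ ] ⟦ toℕ y ℕₚ.≟ m ⟧ ≤ 1ℤ
    ∑-toℕ≤1 m with m ℕₚ.<? n
    ... | yes m<n = ≤-reflexive (trans (∑-cong Fₙ λ y → sym (*-identityʳ _)) (∑-toℕ m<n (λ _ → 1ℤ)))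
    ... | no m≮n  = ≤-trans (≤-reflexive (∑-≡0 Fₙ λ y → ⟦⟧-no (toℕ y ℕₚ.≟ m) λ { refl → m≮n (Finₚ.toℕ<n y) })) (+≤+ ℕ.z≤n)

    Follows : Subset k → Fin n → Vec (Fin n) k → Set
    Follows []            x []      = ⊤
    Follows (inside  ∷ A) x (y ∷ v) = toℕ y ≡ suc (toℕ x) × Follows A y v
    Follows (outside ∷ A) x (y ∷ v) = Follows A y v

    follows? : ∀ (A : Subset k) x v → Dec (Follows A x v)
    follows? []            x []      = yes tt
    follows? (inside  ∷ A) x (y ∷ v) = (toℕ y ℕₚ.≟ suc (toℕ x)) ×-dec follows? A y v
    follows? (outside ∷ A) x (y ∷ v) = follows? A y v

    adjacent⇒follows : ∀ (A : Subset k) x (v : Vec (Fin n) k) →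
      (∀ a → a ∈ A → toℕ (lookup v a) ≡ suc (toℕ (lookup (x ∷ v) (inject₁ a)))) → Follows A x v
    adjacent⇒follows []            x []      adj = tt
    adjacent⇒follows (inside  ∷ A) x (y ∷ v) adj = adj zero here , adjacent⇒follows A y v (λ a a∈A → adj (suc a) (there a∈A))
    adjacent⇒follows (outside ∷ A) x (y ∷ v) adj = adjacent⇒follows A y v (λ a a∈A → adj (suc a) (there a∈A))

    private
      ⟦follows⟧ : ∀ (A : Subset k) x y v → ⟦ follows? (inside ∷ A) x (y ∷ v) ⟧ ≡ ⟦ toℕ y ℕₚ.≟ suc (toℕ x) ⟧ * ⟦ follows? A y v ⟧
      ⟦follows⟧ A x y v = ⟦⟧-× (toℕ y ℕₚ.≟ suc (toℕ x)) (follows? A y v) _ (λ p → p) _,_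

    -- An adjacency leaves at most one choice for the next entry, a new block at most `n`. With the
    -- first entry fixed, `∣ ∁ A ∣ = j - 1` block starts remain.
    ∑-follows : ∀ (A : Subset k) x → ∑[ v ∈ vectors n k ] ⟦ follows? A x v ⟧ ≤ + (n ℕ.^ ∣ ∁ A ∣)
    ∑-follows []            x = ≤-refl
    ∑-follows {suc k} (inside ∷ A) x = begin
      ∑ (vectors n (suc k)) (λ v → ⟦ follows? (inside ∷ A) x v ⟧)
        ≡⟨ ∑-vectors-suc n k _ ⟩
      (∑[ y ∈ Fₙ ] ∑[ v ∈ vectors n k ] ⟦ follows? (inside ∷ A) x (y ∷ v) ⟧)
        ≡⟨ ∑-cong Fₙ (λ y → trans (∑-cong (vectors n k) (⟦follows⟧ A x y)) (∑-*ˡ (vectors n k) ⟦ toℕ y ℕₚ.≟ suc (toℕ x) ⟧ _)) ⟩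
      (∑[ y ∈ Fₙ ] ⟦ toℕ y ℕₚ.≟ suc (toℕ x) ⟧ * (∑[ v ∈ vectors n k ] ⟦ follows? A y v ⟧))
        ≤⟨ ∑-weighted-≤ Fₙ _ _ (+ (n ℕ.^ ∣ ∁ A ∣)) (λ y → 0≤⟦⟧ _) (∑-follows A) ⟩
      (∑[ y ∈ Fₙ ] ⟦ toℕ y ℕₚ.≟ suc (toℕ x) ⟧) * + (n ℕ.^ ∣ ∁ A ∣)
        ≤⟨ *-monoʳ-≤-nonNeg (+ (n ℕ.^ ∣ ∁ A ∣)) (∑-toℕ≤1 (suc (toℕ x))) ⟩
      1ℤ * + (n ℕ.^ ∣ ∁ A ∣)
        ≡⟨ *-identityˡ _ ⟩
      + (n ℕ.^ ∣ ∁ A ∣) ∎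
      where open ≤-Reasoning
    ∑-follows {suc k} (outside ∷ A) x = begin
      ∑ (vectors n (suc k)) (λ v → ⟦ follows? (outside ∷ A) x v ⟧)
        ≡⟨ ∑-vectors-suc n k _ ⟩
      (∑[ y ∈ Fₙ ] ∑[ v ∈ vectors n k ] ⟦ follows? A y v ⟧)
        ≤⟨ ∑-mono Fₙ (∑-follows A) ⟩
      (∑[ y ∈ Fₙ ] + (n ℕ.^ ∣ ∁ A ∣))
        ≡⟨ trans (∑Fin-const n _) (sym (pos-* n (n ℕ.^ ∣ ∁ A ∣))) ⟩
      + (n ℕ.^ suc ∣ ∁ A ∣) ∎
      where open ≤-Reasoning

    module _ {h : ℕ} (h≤n : h ℕ.≤ n) where

      private
        low : Fin n → ℤ
        low y = ⟦ toℕ y ℕₚ.<? h ⟧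

      -- As `a ∉ A`, the entry `lookup v a` starts a new block, so confining it to the first `h`
      -- positions replaces one factor `n` by `h`.
      ∑-follows-low : ∀ (A : Subset k) x {a} → a ∉ A →
        + n * (∑[ v ∈ vectors n k ] ⟦ follows? A x v ⟧ * low (lookup v a)) ≤ + h * + (n ℕ.^ ∣ ∁ A ∣)
      ∑-follows-low {suc k} (inside ∷ A) x {zero} a∉A = contradiction here a∉A
      ∑-follows-low {suc k} (inside ∷ A) x {suc a} a∉A = begin
        + n * ∑ (vectors n (suc k)) (λ v → ⟦ follows? (inside ∷ A) x v ⟧ * low (lookup v (suc a)))
          ≡⟨ cong (+ n *_) (∑-vectors-suc n k _) ⟩
        + n * (∑[ y ∈ Fₙ ] ∑[ v ∈ vectors n k ] ⟦ follows? (inside ∷ A) x (y ∷ v) ⟧ * low (lookup v a))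
          ≡⟨ cong (+ n *_) (∑-cong Fₙ λ y → trans
               (∑-cong (vectors n k) λ v → trans (cong (_* low (lookup v a)) (⟦follows⟧ A x y v))
                                               (*-assoc ⟦ toℕ y ℕₚ.≟ suc (toℕ x) ⟧ ⟦ follows? A y v ⟧ (low (lookup v a))))
               (∑-*ˡ (vectors n k) ⟦ toℕ y ℕₚ.≟ suc (toℕ x) ⟧ _)) ⟩
        + n * (∑[ y ∈ Fₙ ] ⟦ toℕ y ℕₚ.≟ suc (toℕ x) ⟧ * T y)
          ≡⟨ trans (sym (∑-*ˡ Fₙ (+ n) _)) (∑-cong Fₙ λ y → swap (+ n) ⟦ toℕ y ℕₚ.≟ suc (toℕ x) ⟧ (T y)) ⟩
        (∑[ y ∈ Fₙ ] ⟦ toℕ y ℕₚ.≟ suc (toℕ x) ⟧ * (+ n * T y))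
          ≤⟨ ∑-weighted-≤ Fₙ _ _ β (λ y → 0≤⟦⟧ _) (λ y → ∑-follows-low A y (a∉A ∘ there)) ⟩
        (∑[ y ∈ Fₙ ] ⟦ toℕ y ℕₚ.≟ suc (toℕ x) ⟧) * β
          ≤⟨ *-monoʳ-≤-nonNeg β {{nonNegative (0≤* (+ h) (+ (n ℕ.^ ∣ ∁ A ∣)) (+≤+ ℕ.z≤n) (+≤+ ℕ.z≤n))}} (∑-toℕ≤1 (suc (toℕ x))) ⟩
        1ℤ * β
          ≡⟨ *-identityˡ β ⟩
        β ∎
        where
        open ≤-Reasoning
        β = + h * + (n ℕ.^ ∣ ∁ A ∣)
        T : Fin n → ℤ
        T y = ∑[ v ∈ vectors n k ] ⟦ follows? A y v ⟧ * low (lookup v a)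
        swap : ∀ n e t → n * (e * t) ≡ e * (n * t)
        swap = solve-∀
      ∑-follows-low {suc k} (outside ∷ A) x {zero} a∉A = begin
        + n * ∑ (vectors n (suc k)) (λ v → ⟦ follows? (outside ∷ A) x v ⟧ * low (lookup v zero))
          ≡⟨ cong (+ n *_) (∑-vectors-suc n k _) ⟩
        + n * (∑[ y ∈ Fₙ ] ∑[ v ∈ vectors n k ] ⟦ follows? A y v ⟧ * low y)
          ≡⟨ cong (+ n *_) (∑-cong Fₙ λ y → trans (∑-*ʳ (vectors n k) (low y) _) (*-comm _ (low y))) ⟩
        + n * (∑[ y ∈ Fₙ ] low y * (∑[ v ∈ vectors n k ] ⟦ follows? A y v ⟧))
          ≤⟨ *-monoˡ-≤-nonNeg (+ n) (∑-weighted-≤ Fₙ low _ (+ (n ℕ.^ ∣ ∁ A ∣)) (λ y → 0≤⟦⟧ _) (∑-follows A)) ⟩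
        + n * (∑ Fₙ low * + (n ℕ.^ ∣ ∁ A ∣))
          ≡⟨ cong (λ z → + n * (z * + (n ℕ.^ ∣ ∁ A ∣))) (∑-below h≤n) ⟩
        + n * (+ h * + (n ℕ.^ ∣ ∁ A ∣))
          ≡⟨ swap (+ n) (+ h) (+ (n ℕ.^ ∣ ∁ A ∣)) ⟩
        + h * (+ n * + (n ℕ.^ ∣ ∁ A ∣))
          ≡⟨ cong (+ h *_) (pos-* n (n ℕ.^ ∣ ∁ A ∣)) ⟨
        + h * + (n ℕ.^ suc ∣ ∁ A ∣) ∎
        where
        open ≤-Reasoning
        swap : ∀ n e t → n * (e * t) ≡ e * (n * t)
        swap = solve-∀
      ∑-follows-low {suc k} (outside ∷ A) x {suc a} a∉A = begin
        + n * ∑ (vectors n (suc k)) (λ v → ⟦ follows? (outside ∷ A) x v ⟧ * low (lookup v (suc a)))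
          ≡⟨ cong (+ n *_) (∑-vectors-suc n k _) ⟩
        + n * (∑[ y ∈ Fₙ ] ∑[ v ∈ vectors n k ] ⟦ follows? A y v ⟧ * low (lookup v a))
          ≡⟨ ∑-*ˡ Fₙ (+ n) _ ⟨
        (∑[ y ∈ Fₙ ] + n * (∑[ v ∈ vectors n k ] ⟦ follows? A y v ⟧ * low (lookup v a)))
          ≤⟨ ∑-mono Fₙ (λ y → ∑-follows-low A y (a∉A ∘ there)) ⟩
        (∑[ y ∈ Fₙ ] + h * + (n ℕ.^ ∣ ∁ A ∣))
          ≡⟨ ∑Fin-const n _ ⟩
        + n * (+ h * + (n ℕ.^ ∣ ∁ A ∣))
          ≡⟨ swap (+ n) (+ h) (+ (n ℕ.^ ∣ ∁ A ∣)) ⟩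
        + h * (+ n * + (n ℕ.^ ∣ ∁ A ∣))
          ≡⟨ cong (+ h *_) (pos-* n (n ℕ.^ ∣ ∁ A ∣)) ⟨
        + h * + (n ℕ.^ suc ∣ ∁ A ∣) ∎
        where
        open ≤-Reasoning
        swap : ∀ n e t → n * (e * t) ≡ e * (n * t)
        swap = solve-∀

    -- Lower bound: the t-th block after the first starts in [b + (t-1) u , b + t u),
    -- early enough for the rest of the vector to fit in if it were one block

    module _ (u : ℕ) where

      Spread : Subset k → ℕ → Fin n → Vec (Fin n) k → Set
      Spread []                    b x []      = ⊤
      Spread (inside ∷ A)          b x (y ∷ v) = toℕ y ≡ suc (toℕ x) × Spread A b y v
      Spread {suc k} (outside ∷ A) b x (y ∷ v) = (b ℕ.≤ toℕ y × toℕ y ℕ.+ k ℕ.< b ℕ.+ u) × Spread A (b ℕ.+ u) y v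

      spread? : ∀ (A : Subset k) b x v → Dec (Spread A b x v)
      spread? []                    b x []      = yes tt
      spread? (inside ∷ A)          b x (y ∷ v) = (toℕ y ℕₚ.≟ suc (toℕ x)) ×-dec spread? A b y v
      spread? {suc k} (outside ∷ A) b x (y ∷ v) =
        ((b ℕₚ.≤? toℕ y) ×-dec (toℕ y ℕ.+ k ℕₚ.<? b ℕ.+ u)) ×-dec spread? A (b ℕ.+ u) y v

      private
        next : ∀ {x y : Fin n} {b} → toℕ x ℕ.+ suc k ℕ.< b → toℕ y ≡ suc (toℕ x) → toℕ y ℕ.+ k ℕ.< b
        next {k} {x} lt y≡ = ℕₚ.≤-<-trans (ℕₚ.≤-reflexive (sym (trans (ℕₚ.+-suc (toℕ x) k) (cong (ℕ._+ k) (sym y≡))))) lt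

      spread⇒linked : ∀ (A : Subset k) b x v → toℕ x ℕ.+ k ℕ.< b → Spread A b x v → Linked Fin._<_ (x ∷ v)
      spread⇒linked []            b x []      lt _        = [-]
      spread⇒linked (inside ∷ A)  b x (y ∷ v) lt (y≡ , p) =
        ℕₚ.≤-reflexive (sym y≡) ∷ spread⇒linked A b y v (next {x = x} {y} lt y≡) p
      spread⇒linked (outside ∷ A) b x (y ∷ v) lt ((b≤y , lt′) , p) =
        ℕₚ.<-≤-trans (ℕₚ.≤-<-trans (ℕₚ.m≤m+n (toℕ x) _) lt) b≤y ∷ spread⇒linked A (b ℕ.+ u) y v lt′ p

      spread⇒adjacent : ∀ (A : Subset k) b x v → Spread A b x v →
        ∀ a → a ∈ A → toℕ (lookup v a) ≡ suc (toℕ (lookup (x ∷ v) (inject₁ a)))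
      spread⇒adjacent (inside ∷ A)  b x (y ∷ v) (y≡ , p) zero    here         = y≡
      spread⇒adjacent (inside ∷ A)  b x (y ∷ v) (y≡ , p) (suc a) (there a∈A) = spread⇒adjacent A b y v p a a∈A
      spread⇒adjacent (outside ∷ A) b x (y ∷ v) (_  , p) (suc a) (there a∈A) = spread⇒adjacent A (b ℕ.+ u) y v p a a∈A

      spread⇒high : ∀ (A : Subset k) b x v → Spread A b x v → ∀ a → a ∉ A → b ℕ.≤ toℕ (lookup v a)
      spread⇒high (inside ∷ A)  b x (y ∷ v) (_ , p) zero a∉A = contradiction here a∉A
      spread⇒high (outside ∷ A) b x (y ∷ v) ((b≤y , _) , p) zero a∉A = b≤y
      spread⇒high (inside ∷ A)  b x (y ∷ v) (_ , p) (suc a) a∉A = spread⇒high A b y v p a (a∉A ∘ there)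
      spread⇒high (outside ∷ A) b x (y ∷ v) (_ , p) (suc a) a∉A =
        ℕₚ.≤-trans (ℕₚ.m≤m+n b u) (spread⇒high A (b ℕ.+ u) y v p a (a∉A ∘ there))

      -- The invariant `toℕ x + k < b` reserves room below `b` for all `k` remaining entries, so a
      -- block can be continued whatever its length. At a new block each of the `w` starts in
      -- `[b , b + w)` restores the invariant for `b + u`, because `w + l ≤ u` and `k ≤ l`.
      ∑-spread : ∀ w {l} → w ℕ.+ l ℕ.≤ u → ∀ (A : Subset k) b x → k ℕ.≤ l → toℕ x ℕ.+ k ℕ.< b → b ℕ.+ k ℕ.* u ℕ.≤ n →
                 + (w ℕ.^ ∣ ∁ A ∣) ≤ ∑[ v ∈ vectors n k ] ⟦ spread? A b x v ⟧
      ∑-spread w w+l≤u [] b x k≤l lt b≤ = ≤-refl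
      ∑-spread {suc k} w w+l≤u (inside ∷ A) b x k≤l lt b≤ = begin
        + (w ℕ.^ ∣ ∁ A ∣)
          ≤⟨ ∑-spread w w+l≤u A b y (ℕₚ.≤-trans (ℕₚ.n≤1+n k) k≤l) (next {x = x} {y} lt (Finₚ.toℕ-fromℕ< x+1<n))
               (ℕₚ.≤-trans (ℕₚ.+-monoʳ-≤ b (ℕₚ.m≤n+m (k ℕ.* u) u)) b≤) ⟩
        (∑[ v ∈ vectors n k ] ⟦ spread? A b y v ⟧)
          ≡⟨ ∑-toℕ x+1<n (λ y → ∑[ v ∈ vectors n k ] ⟦ spread? A b y v ⟧) ⟨
        (∑[ y ∈ Fₙ ] ⟦ toℕ y ℕₚ.≟ suc (toℕ x) ⟧ * (∑[ v ∈ vectors n k ] ⟦ spread? A b y v ⟧))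
          ≡⟨ ∑-cong Fₙ (λ y → trans (sym (∑-*ˡ (vectors n k) ⟦ toℕ y ℕₚ.≟ suc (toℕ x) ⟧ _)) (∑-cong (vectors n k) λ v →
               sym (⟦⟧-× (toℕ y ℕₚ.≟ suc (toℕ x)) (spread? A b y v) (spread? (inside ∷ A) b x (y ∷ v)) (λ p → p) _,_))) ⟩
        (∑[ y ∈ Fₙ ] ∑[ v ∈ vectors n k ] ⟦ spread? (inside ∷ A) b x (y ∷ v) ⟧)
          ≡⟨ ∑-vectors-suc n k _ ⟨
        ∑ (vectors n (suc k)) (λ v → ⟦ spread? (inside ∷ A) b x v ⟧) ∎
        where
        open ≤-Reasoning
        x+1<n : suc (toℕ x) ℕ.< n
        x+1<n = ℕₚ.<-≤-trans (ℕₚ.≤-<-trans (ℕₚ.≤-trans (ℕ.s≤s (ℕₚ.m≤m+n (toℕ x) k)) (ℕₚ.≤-reflexive (sym (ℕₚ.+-suc (toℕ x) k)))) lt)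
                  (ℕₚ.≤-trans (ℕₚ.m≤m+n b _) b≤)
        y = Fin.fromℕ< x+1<n
      ∑-spread {suc k} w {l} w+l≤u (outside ∷ A) b x k≤l lt b≤ = begin
        + (w ℕ.* w ℕ.^ ∣ ∁ A ∣)
          ≡⟨ pos-* w (w ℕ.^ ∣ ∁ A ∣) ⟩
        + w * W
          ≡⟨ cong (_* W) range ⟨
        -- The starts in `[b , b + w)` are counted as a difference of two initial segments, both
        -- given by `∑-below`.
        (∑[ y ∈ Fₙ ] (⟦ toℕ y ℕₚ.<? b ℕ.+ w ⟧ - ⟦ toℕ y ℕₚ.<? b ⟧)) * W
          ≡⟨ ∑-*ʳ Fₙ W _ ⟨
        (∑[ y ∈ Fₙ ] (⟦ toℕ y ℕₚ.<? b ℕ.+ w ⟧ - ⟦ toℕ y ℕₚ.<? b ⟧) * W)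
          ≤⟨ ∑-mono Fₙ step ⟩
        (∑[ y ∈ Fₙ ] ⟦ start? y ⟧ * (∑[ v ∈ vectors n k ] ⟦ spread? A (b ℕ.+ u) y v ⟧))
          ≡⟨ ∑-cong Fₙ (λ y → trans (sym (∑-*ˡ (vectors n k) ⟦ start? y ⟧ _)) (∑-cong (vectors n k) λ v →
               sym (⟦⟧-× (start? y) (spread? A (b ℕ.+ u) y v) (spread? (outside ∷ A) b x (y ∷ v)) (λ p → p) _,_))) ⟩
        (∑[ y ∈ Fₙ ] ∑[ v ∈ vectors n k ] ⟦ spread? (outside ∷ A) b x (y ∷ v) ⟧)
          ≡⟨ ∑-vectors-suc n k _ ⟨
        ∑ (vectors n (suc k)) (λ v → ⟦ spread? (outside ∷ A) b x v ⟧) ∎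
        where
        open ≤-Reasoning
        W = + (w ℕ.^ ∣ ∁ A ∣)

        start? : ∀ y → Dec (b ℕ.≤ toℕ y × toℕ y ℕ.+ k ℕ.< b ℕ.+ u)
        start? y = (b ℕₚ.≤? toℕ y) ×-dec (toℕ y ℕ.+ k ℕₚ.<? b ℕ.+ u)

        k≤l′ = ℕₚ.≤-trans (ℕₚ.n≤1+n k) k≤l

        w≤u : w ℕ.≤ u
        w≤u = ℕₚ.≤-trans (ℕₚ.m≤m+n w l) w+l≤u

        b+w≤n : b ℕ.+ w ℕ.≤ n
        b+w≤n = ℕₚ.≤-trans (ℕₚ.+-monoʳ-≤ b (ℕₚ.≤-trans w≤u (ℕₚ.m≤m+n u (k ℕ.* u)))) b≤

        range : ∑[ y ∈ Fₙ ] (⟦ toℕ y ℕₚ.<? b ℕ.+ w ⟧ - ⟦ toℕ y ℕₚ.<? b ⟧) ≡ + w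
        range = trans (∑-- Fₙ _ _) (trans (cong₂ _-_ (∑-below b+w≤n) (∑-below (ℕₚ.≤-trans (ℕₚ.m≤m+n b w) b+w≤n)))
          (trans (cong (_- + b) (pos-+ b w)) (drop (+ b) (+ w))))
          where
          drop : ∀ b w → b + w - b ≡ w
          drop = solve-∀

        step : ∀ y → (⟦ toℕ y ℕₚ.<? b ℕ.+ w ⟧ - ⟦ toℕ y ℕₚ.<? b ⟧) * W ≤ ⟦ start? y ⟧ * (∑[ v ∈ vectors n k ] ⟦ spread? A (b ℕ.+ u) y v ⟧)
        step y = by-cases (toℕ y ℕₚ.<? b ℕ.+ w) (toℕ y ℕₚ.<? b)
          where
          S = ∑[ v ∈ vectors n k ] ⟦ spread? A (b ℕ.+ u) y v ⟧
          0≤rhs : 0ℤ ≤ ⟦ start? y ⟧ * S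
          0≤rhs = 0≤* ⟦ start? y ⟧ S (0≤⟦⟧ _) (∑-0≤ (vectors n k) λ v → 0≤⟦⟧ _)
          by-cases : (d : Dec (toℕ y ℕ.< b ℕ.+ w)) (e : Dec (toℕ y ℕ.< b)) → (⟦ d ⟧ - ⟦ e ⟧) * W ≤ ⟦ start? y ⟧ * S
          by-cases (yes y<b+w) (no y≮b) = ≤-trans (≤-reflexive (*-identityˡ W)) (≤-trans
            (∑-spread w w+l≤u A (b ℕ.+ u) y k≤l′ y+k<b+u (ℕₚ.≤-trans (ℕₚ.≤-reflexive (ℕₚ.+-assoc b u (k ℕ.* u))) b≤))
            (≤-reflexive (sym (trans (cong (_* S) (⟦⟧-yes (start? y) (ℕₚ.≮⇒≥ y≮b , y+k<b+u))) (*-identityˡ S)))))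
            where
            y+k<b+u : toℕ y ℕ.+ k ℕ.< b ℕ.+ u
            y+k<b+u = ℕₚ.<-≤-trans (ℕₚ.+-monoˡ-< k y<b+w) (ℕₚ.≤-trans (ℕₚ.≤-reflexive (ℕₚ.+-assoc b w k))
              (ℕₚ.+-monoʳ-≤ b (ℕₚ.≤-trans (ℕₚ.+-monoʳ-≤ w k≤l′) w+l≤u)))
          by-cases (yes _) (yes _)  = ≤-trans (≤-reflexive (*-zeroˡ W)) 0≤rhs
          by-cases (no _)  (no _)   = ≤-trans (≤-reflexive (*-zeroˡ W)) 0≤rhs
          by-cases (no y≮) (yes lt) = contradiction (ℕₚ.<-≤-trans lt (ℕₚ.m≤m+n b w)) y≮

  lookup-mono : {v : Vec (Fin n) k} → Linked Fin._<_ v → ∀ {r s} → toℕ r ℕ.≤ toℕ s → toℕ (lookup v r) ℕ.≤ toℕ (lookup v s)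
  lookup-mono {v = v} v↑ {r} {s} r≤s with ℕₚ.m≤n⇒m<n∨m≡n r≤s
  ... | inj₁ r<s = ℕₚ.<⇒≤ (lookup⁺ Finₚ.<-trans v↑ r<s)
  ... | inj₂ r≡s = ℕₚ.≤-reflexive (cong (λ t → toℕ (lookup v t)) (Finₚ.toℕ-injective r≡s))

  lookup-firstBlock : ∀ (A : Subset k) (v : Vec (Fin n) (suc k)) → Admissible A v →
    ∀ r → (∀ a → toℕ a ℕ.< toℕ r → a ∈ A) → toℕ (lookup v r) ≡ toℕ (lookup v zero) ℕ.+ toℕ r
  lookup-firstBlock A v (_ , adj) = <-weakInduction _ (λ _ → sym (ℕₚ.+-identityʳ _)) λ a ih below∈A →
    trans (adj a (below∈A a ℕₚ.≤-refl))
    (trans (cong suc (trans (ih λ b b<a → below∈A b (ℕₚ.<-trans b<a (ℕ.s≤s (ℕₚ.≤-reflexive (Finₚ.toℕ-inject₁ a)))))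
                            (cong (toℕ (lookup v zero) ℕ.+_) (Finₚ.toℕ-inject₁ a))))
           (sym (ℕₚ.+-suc _ (toℕ a))))

  -- Good, boundary and crowded position vectors

  module GoodVectors {k n h : ℕ} (h≤n : h ℕ.≤ n) (A : Subset k) where

    private
      V = vectors n (suc k)
      o = ∣ ∁ A ∣

      adm : Vec (Fin n) (suc k) → ℤ
      adm v = ⟦ admissible? A v ⟧

    -- For admissible vectors: exactly the first block lies before the boundary `h`. The margin
    -- `suc k` is the length of the whole vector, hence enough for the first block whatever its
    -- length.
    Good : Vec (Fin n) (suc k) → Set
    Good v = toℕ (lookup v zero) ℕ.+ suc k ℕ.< h × (∀ a → a ∉ A → h ℕ.≤ toℕ (lookup v (suc a)))

    good? : ∀ v → Dec (Good v)
    good? v = (toℕ (lookup v zero) ℕ.+ suc k ℕₚ.<? h) ×-dec all? λ a → ¬? (a ∈? A) →-dec (h ℕₚ.≤? toℕ (lookup v (suc a)))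

    -- Each of the `h - suc k` first entries that respect the margin is completed by `∑-spread`,
    -- started at `b = h`.
    ∑-good : ∀ {u w} → w ℕ.+ k ℕ.≤ u → h ℕ.+ k ℕ.* u ℕ.≤ n →
             + (h ℕ.∸ suc k) * + (w ℕ.^ o) ≤ ∑[ v ∈ V ] adm v * ⟦ good? v ⟧
    ∑-good {u} {w} w+k≤u h+ku≤n = begin
      + (h ℕ.∸ suc k) * W
        ≡⟨ cong (_* W) (∑-below (ℕₚ.≤-trans (ℕₚ.m∸n≤m h (suc k)) h≤n)) ⟨
      (∑[ x ∈ allFin n ] ⟦ toℕ x ℕₚ.<? h ℕ.∸ suc k ⟧) * W
        ≡⟨ ∑-*ʳ (allFin n) W _ ⟨
      (∑[ x ∈ allFin n ] ⟦ toℕ x ℕₚ.<? h ℕ.∸ suc k ⟧ * W)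
        ≤⟨ ∑-mono (allFin n) (λ x → first x (toℕ x ℕₚ.<? h ℕ.∸ suc k)) ⟩
      (∑[ x ∈ allFin n ] ⟦ start? x ⟧ * (∑[ v ∈ vectors n k ] ⟦ spread? u A h x v ⟧))
        ≡⟨ ∑-cong (allFin n) (λ x → sym (∑-*ˡ (vectors n k) ⟦ start? x ⟧ _)) ⟩
      (∑[ x ∈ allFin n ] ∑[ v ∈ vectors n k ] ⟦ start? x ⟧ * ⟦ spread? u A h x v ⟧)
        ≤⟨ ∑-mono (allFin n) (λ x → ∑-mono (vectors n k) λ v → pointwise x v (start? x) (spread? u A h x v)) ⟩
      (∑[ x ∈ allFin n ] ∑[ v ∈ vectors n k ] adm (x ∷ v) * ⟦ good? (x ∷ v) ⟧)
        ≡⟨ ∑-vectors-suc n k _ ⟨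
      (∑[ v ∈ V ] adm v * ⟦ good? v ⟧) ∎
      where
      open ≤-Reasoning
      W = + (w ℕ.^ o)

      start? : ∀ x → Dec (toℕ x ℕ.+ suc k ℕ.< h)
      start? x = toℕ x ℕ.+ suc k ℕₚ.<? h

      weaken : ∀ {x} → x ℕ.+ suc k ℕ.< h → x ℕ.+ k ℕ.< h
      weaken {x} lt = ℕₚ.≤-<-trans (ℕₚ.+-monoʳ-≤ x (ℕₚ.n≤1+n k)) lt

      first : ∀ x (d : Dec (toℕ x ℕ.< h ℕ.∸ suc k)) →
              ⟦ d ⟧ * W ≤ ⟦ start? x ⟧ * (∑[ v ∈ vectors n k ] ⟦ spread? u A h x v ⟧)
      first x (no _) = ≤-trans (≤-reflexive (*-zeroˡ W)) (0≤* ⟦ start? x ⟧ (∑[ v ∈ vectors n k ] ⟦ spread? u A h x v ⟧)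
        (0≤⟦⟧ (start? x)) (∑-0≤ (vectors n k) λ v → 0≤⟦⟧ _))
      first x (yes x<h∸k) = ≤-trans (≤-reflexive (*-identityˡ W)) (≤-trans
        (∑-spread u w w+k≤u A h x ℕₚ.≤-refl (weaken x+k<h) h+ku≤n)
        (≤-reflexive (sym (trans (cong (_* (∑[ v ∈ vectors n k ] ⟦ spread? u A h x v ⟧)) (⟦⟧-yes (start? x) x+k<h)) (*-identityˡ _)))))
        where
        x+k<h : toℕ x ℕ.+ suc k ℕ.< h
        x+k<h = ℕₚ.<-≤-trans (ℕₚ.+-monoˡ-< (suc k) x<h∸k) (ℕₚ.≤-reflexive (ℕₚ.m∸n+n≡m {h} {suc k}
          (ℕₚ.<⇒≤ (ℕₚ.m∸n≢0⇒n<m {h} {suc k} (ℕₚ.>⇒≢ (ℕₚ.≤-<-trans ℕ.z≤n x<h∸k))))))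

      pointwise : ∀ x v (d : Dec (toℕ x ℕ.+ suc k ℕ.< h)) (e : Dec (Spread u A h x v)) →
                  ⟦ d ⟧ * ⟦ e ⟧ ≤ adm (x ∷ v) * ⟦ good? (x ∷ v) ⟧
      pointwise x v (no _) e = ≤-trans (≤-reflexive (*-zeroˡ ⟦ e ⟧)) (0≤* (adm (x ∷ v)) ⟦ good? (x ∷ v) ⟧ (0≤⟦⟧ _) (0≤⟦⟧ _))
      pointwise x v (yes _) (no _) = 0≤* (adm (x ∷ v)) ⟦ good? (x ∷ v) ⟧ (0≤⟦⟧ _) (0≤⟦⟧ _)
      pointwise x v (yes x+k<h) (yes p) = ≤-reflexive (sym (cong₂ _*_
        (⟦⟧-yes (admissible? A (x ∷ v)) (spread⇒linked u A h x v (weaken x+k<h) p , spread⇒adjacent u A h x v p))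
        (⟦⟧-yes (good? (x ∷ v)) (x+k<h , spread⇒high u A h x v p))))

    private
      adm≤follows : ∀ x v → adm (x ∷ v) ≤ ⟦ follows? A x v ⟧
      adm≤follows x v = ⟦⟧-mono (admissible? A (x ∷ v)) (follows? A x v) λ (_ , adj) → adjacent⇒follows A x v adj

    Boundary : Vec (Fin n) (suc k) → Set
    Boundary v = toℕ (lookup v zero) ℕ.< h × h ℕ.≤ toℕ (lookup v zero) ℕ.+ suc k

    boundary? : ∀ v → Dec (Boundary v)
    boundary? v = (toℕ (lookup v zero) ℕₚ.<? h) ×-dec (h ℕₚ.≤? toℕ (lookup v zero) ℕ.+ suc k)

    -- Only `suc k` first entries are close enough to `h`; the rest is counted by `∑-follows`. This
    -- is smaller than the number of good vectors by a factor of order `h`.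
    ∑-boundary : ∑[ v ∈ V ] adm v * ⟦ boundary? v ⟧ ≤ + suc k * + (n ℕ.^ o)
    ∑-boundary = begin
      (∑[ v ∈ V ] adm v * ⟦ boundary? v ⟧)
        ≡⟨ ∑-vectors-suc n k _ ⟩
      (∑[ x ∈ allFin n ] ∑[ v ∈ vectors n k ] adm (x ∷ v) * near x)
        ≤⟨ ∑-mono (allFin n) (λ x → ≤-trans (≤-reflexive (trans (∑-*ʳ (vectors n k) (near x) _) (*-comm _ (near x))))
             (*-monoˡ-≤-nonNeg (near x) {{nonNegative (0≤⟦⟧ _)}} (≤-trans (∑-mono (vectors n k) (adm≤follows x)) (∑-follows A x)))) ⟩
      (∑[ x ∈ allFin n ] near x * + (n ℕ.^ o))
        ≡⟨ ∑-*ʳ (allFin n) (+ (n ℕ.^ o)) near ⟩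
      ∑ (allFin n) near * + (n ℕ.^ o)
        ≤⟨ *-monoʳ-≤-nonNeg (+ (n ℕ.^ o)) few ⟩
      + suc k * + (n ℕ.^ o) ∎
      where
      open ≤-Reasoning
      near : Fin n → ℤ
      near x = ⟦ (toℕ x ℕₚ.<? h) ×-dec (h ℕₚ.≤? toℕ x ℕ.+ suc k) ⟧

      h∸k≤h : h ℕ.∸ suc k ℕ.≤ h
      h∸k≤h = ℕₚ.m∸n≤m h (suc k)

      few : ∑ (allFin n) near ≤ + suc k
      few = begin
        ∑ (allFin n) near
          ≤⟨ ∑-mono (allFin n) (λ x → pointwise x) ⟩
        (∑[ x ∈ allFin n ] (⟦ toℕ x ℕₚ.<? h ⟧ - ⟦ toℕ x ℕₚ.<? h ℕ.∸ suc k ⟧))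
          ≡⟨ trans (∑-- (allFin n) _ _) (cong₂ _-_ (∑-below h≤n) (∑-below (ℕₚ.≤-trans h∸k≤h h≤n))) ⟩
        + h - + (h ℕ.∸ suc k)
          ≤⟨ ≤-by (+ (suc k ℕ.+ (h ℕ.∸ suc k)) - + h) (trans (shift (+ suc k) (+ h) (+ (h ℕ.∸ suc k)))
               (cong (_- + h) (sym (pos-+ (suc k) (h ℕ.∸ suc k))))) (i≤j⇒0≤j-i (+≤+ (ℕₚ.m≤n+m∸n h (suc k)))) ⟩
        + suc k ∎
        where
        shift : ∀ k h d → k - (h - d) ≡ k + d - h
        shift = solve-∀

        pointwise : ∀ x → near x ≤ ⟦ toℕ x ℕₚ.<? h ⟧ - ⟦ toℕ x ℕₚ.<? h ℕ.∸ suc k ⟧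
        pointwise x = by-cases (toℕ x ℕₚ.<? h ℕ.∸ suc k)
          where
          by-cases : (d : Dec (toℕ x ℕ.< h ℕ.∸ suc k)) → near x ≤ ⟦ toℕ x ℕₚ.<? h ⟧ - ⟦ d ⟧
          by-cases (no _) = ≤-trans (⟦⟧-mono _ (toℕ x ℕₚ.<? h) proj₁) (≤-reflexive (sym (+-identityʳ _)))
          by-cases (yes lt) = ≤-trans (≤-reflexive (⟦⟧-no ((toℕ x ℕₚ.<? h) ×-dec (h ℕₚ.≤? toℕ x ℕ.+ suc k)) far))
            (≤-reflexive (sym (cong (_- 1ℤ) (⟦⟧-yes (toℕ x ℕₚ.<? h) (ℕₚ.<-≤-trans lt h∸k≤h)))))
            where
            far : ¬ (toℕ x ℕ.< h × h ℕ.≤ toℕ x ℕ.+ suc k)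
            far (_ , h≤x+k) = ℕₚ.<-irrefl refl (ℕₚ.<-≤-trans lt (ℕₚ.≤-trans (ℕₚ.∸-monoˡ-≤ (suc k) h≤x+k) (ℕₚ.≤-reflexive (ℕₚ.m+n∸n≡m (toℕ x) (suc k)))))

    Crowded : Fin k → Vec (Fin n) (suc k) → Set
    Crowded a v = toℕ (lookup v zero) ℕ.< h × toℕ (lookup v (suc a)) ℕ.< h

    crowded? : ∀ a v → Dec (Crowded a v)
    crowded? a v = (toℕ (lookup v zero) ℕₚ.<? h) ×-dec (toℕ (lookup v (suc a)) ℕₚ.<? h)

    -- Two block starts are confined to the first `h` positions: the first entry and the one at
    -- `suc a`. Compared with the good vectors a factor of order `h / n` is gained, which is small
    -- by the choice of `h` and not by letting `n` grow.
    ∑-crowded : ∀ {a} → a ∉ A → + n * (∑[ v ∈ V ] adm v * ⟦ crowded? a v ⟧) ≤ + h * (+ h * + (n ℕ.^ o))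
    ∑-crowded {a} a∉A = begin
      + n * (∑[ v ∈ V ] adm v * ⟦ crowded? a v ⟧)
        ≡⟨ cong (+ n *_) (∑-vectors-suc n k _) ⟩
      + n * (∑[ x ∈ allFin n ] ∑[ v ∈ vectors n k ] adm (x ∷ v) * ⟦ crowded? a (x ∷ v) ⟧)
        ≤⟨ *-monoˡ-≤-nonNeg (+ n) (∑-mono (allFin n) λ x → ≤-trans (∑-mono (vectors n k) (pointwise x)) (≤-reflexive (∑-*ˡ (vectors n k) (low x) _))) ⟩
      + n * (∑[ x ∈ allFin n ] low x * T x)
        ≡⟨ trans (sym (∑-*ˡ (allFin n) (+ n) _)) (∑-cong (allFin n) λ x → swap (+ n) (low x) (T x)) ⟩
      (∑[ x ∈ allFin n ] low x * (+ n * T x))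
        ≤⟨ ∑-weighted-≤ (allFin n) low _ (+ h * + (n ℕ.^ o)) (λ x → 0≤⟦⟧ _) (λ x → ∑-follows-low h≤n A x a∉A) ⟩
      ∑ (allFin n) low * (+ h * + (n ℕ.^ o))
        ≡⟨ cong (_* (+ h * + (n ℕ.^ o))) (∑-below h≤n) ⟩
      + h * (+ h * + (n ℕ.^ o)) ∎
      where
      open ≤-Reasoning
      low : Fin n → ℤ
      low x = ⟦ toℕ x ℕₚ.<? h ⟧

      T : Fin n → ℤ
      T x = ∑[ v ∈ vectors n k ] ⟦ follows? A x v ⟧ * low (lookup v a)

      swap : ∀ n e t → n * (e * t) ≡ e * (n * t)
      swap = solve-∀

      pointwise : ∀ x v → adm (x ∷ v) * ⟦ crowded? a (x ∷ v) ⟧ ≤ low x * (⟦ follows? A x v ⟧ * low (lookup v a))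
      pointwise x v = begin
        adm (x ∷ v) * ⟦ crowded? a (x ∷ v) ⟧
          ≤⟨ *-monoʳ-≤-nonNeg ⟦ crowded? a (x ∷ v) ⟧ {{nonNegative (0≤⟦⟧ _)}} (adm≤follows x v) ⟩
        ⟦ follows? A x v ⟧ * ⟦ crowded? a (x ∷ v) ⟧
          ≡⟨ cong (⟦ follows? A x v ⟧ *_) (⟦⟧-× (toℕ x ℕₚ.<? h) (toℕ (lookup v a) ℕₚ.<? h) (crowded? a (x ∷ v)) (λ p → p) _,_) ⟩
        ⟦ follows? A x v ⟧ * (low x * low (lookup v a))
          ≡⟨ swap ⟦ follows? A x v ⟧ (low x) (low (lookup v a)) ⟩
        low x * (⟦ follows? A x v ⟧ * low (lookup v a)) ∎

  halve-≤ : ∀ m n → 2 ℕ.* m ℕ.≤ n → n ℕ.≤ 2 ℕ.* (n ℕ.∸ m)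
  halve-≤ m n 2m≤n = begin
    n                             ≡⟨ ℕₚ.m∸n+n≡m {n} {m} m≤n ⟨
    n ℕ.∸ m ℕ.+ m                 ≤⟨ ℕₚ.+-monoʳ-≤ (n ℕ.∸ m) (subst (ℕ._≤ n ℕ.∸ m) (ℕₚ.m+n∸n≡m m m) (ℕₚ.∸-monoˡ-≤ m m+m≤n)) ⟩
    n ℕ.∸ m ℕ.+ (n ℕ.∸ m)         ≡⟨ cong (n ℕ.∸ m ℕ.+_) (ℕₚ.+-identityʳ (n ℕ.∸ m)) ⟨
    2 ℕ.* (n ℕ.∸ m)               ∎
    where
    open ℕₚ.≤-Reasoning
    m+m≤n : m ℕ.+ m ℕ.≤ n
    m+m≤n = subst (λ z → m ℕ.+ z ℕ.≤ n) (ℕₚ.+-identityʳ m) 2m≤n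
    m≤n : m ℕ.≤ n
    m≤n = ℕₚ.≤-trans (ℕₚ.m≤m+n m m) m+m≤n

  -- All lengths are multiples of h = n / K: the box has side h, the segments
  -- reserved for the blocks have length u = c h, and w is what is left of a
  -- segment when room for the whole vector is kept free.

  module Scales (k′ o b : ℕ) .{{_ : ℕ.NonZero k′}} .{{_ : ℕ.NonZero b}} where

    -- `K` makes the box and `k′` segments fit, since `h + k′ * (c * h) = K * h`. From `K ≤ l * c`
    -- and `u ≤ 2 w` follows `n ≤ 2 K h ≤ 2 l u ≤ q * w`. In `c = 2 (2 q^o) b`, the good vectors
    -- number at least `h n^o / (2 q^o)`, and the bad ones, weighted by `b`, must not exceed half of
    -- that. `n₀` ensures `c * l ≤ h`.
    l q c K n₀ : ℕ
    l  = suc k′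
    q  = 4 ℕ.* l
    c  = 4 ℕ.* q ℕ.^ o ℕ.* b
    K  = suc (k′ ℕ.* c)
    n₀ = c ℕ.* l ℕ.* K

    -- `fits` and `w+l≤u` are what `∑-good` asks for, and `ample` compares its count with `h n^o`.
    -- `cl≤h` makes boundary vectors rare, `ch≤n` crowded ones, and `n≤2Kh` turns `h` back into `n`.
    record Scale (n : ℕ) : Set where
      field
        h u w : ℕ
        cl≤h  : c ℕ.* l ℕ.≤ h
        ch≤n  : c ℕ.* h ℕ.≤ n
        n≤2Kh : n ℕ.≤ 2 ℕ.* K ℕ.* h
        h≤n   : h ℕ.≤ n
        fits  : h ℕ.+ k′ ℕ.* u ℕ.≤ n
        w+l≤u : w ℕ.+ k′ ℕ.≤ u
        ample : h ℕ.* n ℕ.^ o ℕ.≤ 2 ℕ.* q ℕ.^ o ℕ.* ((h ℕ.∸ l) ℕ.* w ℕ.^ o)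

    instance
      q^o≢0 : ℕ.NonZero (q ℕ.^ o)
      q^o≢0 = ℕₚ.m^n≢0 q o

      4q^o≢0 : ℕ.NonZero (4 ℕ.* q ℕ.^ o)
      4q^o≢0 = ℕₚ.m*n≢0 4 (q ℕ.^ o)

      c≢0 : ℕ.NonZero c
      c≢0 = ℕₚ.m*n≢0 (4 ℕ.* q ℕ.^ o) b

    b≤c : b ℕ.≤ c
    b≤c = ℕₚ.m≤n*m b (4 ℕ.* q ℕ.^ o)

    4≤c : 4 ℕ.≤ c
    4≤c = ℕₚ.≤-trans (ℕₚ.m≤m*n 4 (q ℕ.^ o)) (ℕₚ.m≤m*n (4 ℕ.* q ℕ.^ o) b)

    scale : ∀ n → n₀ ℕ.≤ n → Scale n
    scale n n₀≤n = record
      { h = h ; u = u ; w = u ℕ.∸ l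
      ; cl≤h = cl≤h
      ; ch≤n = ℕₚ.≤-trans (ℕₚ.*-monoˡ-≤ h c≤K) Kh≤n
      ; n≤2Kh = n≤2Kh
      ; h≤n = m/n≤m n K
      ; fits = ℕₚ.≤-trans (ℕₚ.≤-reflexive (cong (h ℕ.+_) (sym (ℕₚ.*-assoc k′ c h)))) Kh≤n
      ; w+l≤u = ℕₚ.≤-trans (ℕₚ.+-monoʳ-≤ (u ℕ.∸ l) (ℕₚ.n≤1+n k′)) (ℕₚ.≤-reflexive (ℕₚ.m∸n+n≡m {u} {l} (ℕₚ.≤-trans (ℕₚ.m≤m+n l _) 2l≤u)))
      ; ample = ample
      }
      where
      open ℕₚ.≤-Reasoning
      h = n ℕ./ K
      u = c ℕ.* h

      Kh≤n : K ℕ.* h ℕ.≤ n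
      Kh≤n = ℕₚ.≤-trans (ℕₚ.≤-reflexive (ℕₚ.*-comm K h)) (m/n*n≤m n K)

      c≤K : c ℕ.≤ K
      c≤K = ℕₚ.≤-trans (ℕₚ.m≤n*m c k′) (ℕₚ.n≤1+n _)

      cl≤h : c ℕ.* l ℕ.≤ h
      cl≤h = ℕₚ.≤-trans (ℕₚ.≤-reflexive (sym (m*n/n≡m (c ℕ.* l) K))) (/-monoˡ-≤ K n₀≤n)

      K≤n : K ℕ.≤ n
      K≤n = ℕₚ.≤-trans (ℕₚ.m≤n*m K (c ℕ.* l) {{ℕₚ.m*n≢0 c l}}) n₀≤n

      n≤2Kh : n ℕ.≤ 2 ℕ.* K ℕ.* h
      n≤2Kh = ≤-2*quotient n K K≤n

      2l≤h : 2 ℕ.* l ℕ.≤ h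
      2l≤h = ℕₚ.≤-trans (ℕₚ.*-monoˡ-≤ l (ℕₚ.≤-trans (ℕₚ.m≤m+n 2 2) 4≤c)) cl≤h

      2l≤u : 2 ℕ.* l ℕ.≤ u
      2l≤u = ℕₚ.≤-trans 2l≤h (ℕₚ.m≤n*m h c)

      n≤qw : n ℕ.≤ q ℕ.* (u ℕ.∸ l)
      n≤qw = begin
        n                                 ≤⟨ n≤2Kh ⟩
        2 ℕ.* K ℕ.* h                     ≤⟨ ℕₚ.*-monoˡ-≤ h (ℕₚ.*-monoʳ-≤ 2 (ℕₚ.+-monoˡ-≤ (k′ ℕ.* c) (ℕₚ.≤-trans (ℕ.s≤s ℕ.z≤n) 4≤c))) ⟩
        2 ℕ.* (l ℕ.* c) ℕ.* h             ≡⟨ trans (cong (ℕ._* h) (sym (ℕₚ.*-assoc 2 l c))) (ℕₚ.*-assoc (2 ℕ.* l) c h) ⟩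
        2 ℕ.* l ℕ.* u                     ≤⟨ ℕₚ.*-monoʳ-≤ (2 ℕ.* l) (halve-≤ l u 2l≤u) ⟩
        2 ℕ.* l ℕ.* (2 ℕ.* (u ℕ.∸ l))     ≡⟨ ℕₚ.*-assoc (2 ℕ.* l) 2 (u ℕ.∸ l) ⟨
        2 ℕ.* l ℕ.* 2 ℕ.* (u ℕ.∸ l)       ≡⟨ cong (ℕ._* (u ℕ.∸ l)) (trans (ℕₚ.*-comm (2 ℕ.* l) 2) (sym (ℕₚ.*-assoc 2 2 l))) ⟩
        q ℕ.* (u ℕ.∸ l)                   ∎

      ample : h ℕ.* n ℕ.^ o ℕ.≤ 2 ℕ.* q ℕ.^ o ℕ.* ((h ℕ.∸ l) ℕ.* (u ℕ.∸ l) ℕ.^ o)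
      ample = begin
        h ℕ.* n ℕ.^ o
          ≤⟨ ℕₚ.*-mono-≤ (halve-≤ l h 2l≤h) (ℕₚ.≤-trans (ℕₚ.^-monoˡ-≤ o n≤qw) (ℕₚ.≤-reflexive (ℕ^-distrib q (u ℕ.∸ l) o))) ⟩
        2 ℕ.* (h ℕ.∸ l) ℕ.* (q ℕ.^ o ℕ.* (u ℕ.∸ l) ℕ.^ o)
          ≡⟨ regroup (h ℕ.∸ l) (q ℕ.^ o) ((u ℕ.∸ l) ℕ.^ o) ⟩
        2 ℕ.* q ℕ.^ o ℕ.* ((h ℕ.∸ l) ℕ.* (u ℕ.∸ l) ℕ.^ o) ∎
        where
        regroup : ∀ a r w → 2 ℕ.* a ℕ.* (r ℕ.* w) ≡ 2 ℕ.* r ℕ.* (a ℕ.* w)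
        regroup = ℕ-solve-∀

        interchange : ∀ a b x y → a ℕ.* b ℕ.* (x ℕ.* y) ≡ a ℕ.* x ℕ.* (b ℕ.* y)
        interchange = ℕ-solve-∀

        ℕ^-distrib : ∀ a b e → (a ℕ.* b) ℕ.^ e ≡ a ℕ.^ e ℕ.* b ℕ.^ e
        ℕ^-distrib a b zero    = refl
        ℕ^-distrib a b (suc e) = trans (cong (a ℕ.* b ℕ.*_) (ℕ^-distrib a b e)) (interchange a b (a ℕ.^ e) (b ℕ.^ e))

  -- Up to division, the bounds on `good` and `bad` give `good - β bad ≥ h P / (2 E)`, so
  -- `4 F E X ≥ N P h²`; with `h ≥ n / (2 K)` the constant becomes `16 F E K²`.
  covariance-scale : ∀ n h N F E K β P X good bad →
    0ℤ ≤ n → 0ℤ ≤ h → 0ℤ ≤ N → 0ℤ ≤ E → 0ℤ ≤ K → 0ℤ ≤ P →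
    h * N * (good - β * bad) ≤ + 2 * F * X → h * P ≤ E * good → + 2 * E * β * bad ≤ h * P → n ≤ + 2 * K * h →
    N * (n * n * P) ≤ + 16 * F * E * K * K * X
  covariance-scale n h N F E K β P X good bad 0≤n 0≤h 0≤N 0≤E 0≤K 0≤P cov many few n≤2Kh =
    ≤-by _ (identity n h N F E K β P X good bad)
      (+-mono-≤ (0≤* (+ 8 * E * (K * K)) (+ 2 * F * X - h * N * (good - β * bad)) (0≤* (+ 8 * E) (K * K) (0≤* (+ 8) E (+≤+ ℕ.z≤n) 0≤E) 0≤KK) (i≤j⇒0≤j-i cov))
      (+-mono-≤ (0≤* (+ 4 * (K * K) * (h * N)) (+ 2 * (E * good - h * P) + (h * P - + 2 * E * β * bad)) (0≤* (+ 4 * (K * K)) (h * N) (0≤* (+ 4) (K * K) (+≤+ ℕ.z≤n) 0≤KK) (0≤* h N 0≤h 0≤N))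
                  (+-mono-≤ (0≤* (+ 2) (E * good - h * P) (+≤+ ℕ.z≤n) (i≤j⇒0≤j-i many)) (i≤j⇒0≤j-i few)))
                (0≤* (N * P) ((+ 2 * K * h - n) * (+ 2 * K * h + n)) (0≤* N P 0≤N 0≤P) (0≤* (+ 2 * K * h - n) (+ 2 * K * h + n) (i≤j⇒0≤j-i n≤2Kh)
                  (+-mono-≤ (0≤* (+ 2 * K) h (0≤* (+ 2) K (+≤+ ℕ.z≤n) 0≤K) 0≤h) 0≤n)))))
    where
    0≤KK = 0≤* K K 0≤K 0≤K
    identity : ∀ n h N F E K β P X good bad →
      + 16 * F * E * K * K * X - N * (n * n * P) ≡
      + 8 * E * (K * K) * (+ 2 * F * X - h * N * (good - β * bad)) +
      (+ 4 * (K * K) * (h * N) * (+ 2 * (E * good - h * P) + (h * P - + 2 * E * β * bad)) +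
       N * P * ((+ 2 * K * h - n) * (+ 2 * K * h + n)))
    identity = solve-∀

  -- Patterns with at least two blocks

  module Separated (k′ : ℕ) .{{_ : ℕ.NonZero k′}} (π : Permutation′ (suc k′)) (A : Subset k′)
    {a₀ : Fin k′} (a₀∉A : a₀ ∉ A) (o′ : ℕ) (∣∁A∣≡o : ∣ ∁ A ∣ ≡ suc o′) where

    private
      o = suc o′

    -- The weight that `covariance-≥` puts on a bad vector.
    b : ℕ
    b = 2 ℕ.* suc k′ ! ℕ.* suc k′

    instance
      b≢0 : ℕ.NonZero b
      b≢0 = ℕₚ.m*n≢0 (2 ℕ.* suc k′ !) (suc k′) {{ℕₚ.m*n≢0 2 (suc k′ !) {{_}} {{suc k′ ℕₚ.!≢0}}}}

    open Scales k′ o b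

    -- `E` is the loss in `ample`, and `d` the constant of `covariance-scale` with `F = l !`.
    E d : ℕ
    E = 2 ℕ.* q ℕ.^ o
    d = 16 ℕ.* l ! ℕ.* E ℕ.* K ℕ.* K

    d≢0 : ℕ.NonZero d
    d≢0 = ℕₚ.m*n≢0 (16 ℕ.* l ! ℕ.* E ℕ.* K) K {{ℕₚ.m*n≢0 (16 ℕ.* l ! ℕ.* E) K {{ℕₚ.m*n≢0 (16 ℕ.* l !) E {{ℕₚ.m*n≢0 16 (l !) {{_}} {{l ℕₚ.!≢0}}}} {{ℕₚ.m*n≢0 2 (q ℕ.^ o)}}}}}}

    m₀ : Fin l
    m₀ = π ⟨$⟩ˡ zero

    m₀-min : ∀ {r} → r ≢ m₀ → π ⟨$⟩ʳ m₀ Fin.< π ⟨$⟩ʳ r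
    m₀-min {r} r≢m₀ = 0<suc (Perm.inverseʳ π) λ πr≡0 → r≢m₀ (trans (sym (Perm.inverseˡ π)) (cong (π ⟨$⟩ˡ_) πr≡0))
      where
      0<suc : ∀ {x y : Fin l} → x ≡ zero → y ≢ zero → x Fin.< y
      0<suc {y = zero}  refl y≢0 = contradiction refl y≢0
      0<suc {y = suc _} refl y≢0 = ℕ.s≤s ℕ.z≤n

    module _ {n : ℕ} (n₀≤n : n₀ ℕ.≤ n) where

      open Scale (scale n n₀≤n)
      open GoodVectors h≤n A

      private
        nᵒ = + (n ℕ.^ o)
        V = vectors n l

        adm : Vec (Fin n) l → ℤ
        adm v = ⟦ admissible? A v ⟧

        cut : Vec (Fin n) l → Fin l → ℤ
        cut v r = ⟦ toℕ (lookup v r) ℕₚ.<? h ⟧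

        first≤ : ∀ (v : Vec (Fin n) l) → Admissible A v → ∀ r → toℕ (lookup v zero) ℕ.≤ toℕ (lookup v r)
        first≤ v (v↑ , _) r = lookup-mono {v = v} v↑ {zero} {r} ℕ.z≤n

        2l!h≤n : 2 ℕ.* l ! ℕ.* h ℕ.≤ n
        2l!h≤n = ℕₚ.≤-trans (ℕₚ.*-monoˡ-≤ h (ℕₚ.≤-trans (ℕₚ.m≤m*n (2 ℕ.* l !) l) b≤c)) ch≤n

      module _ (s : ℤ) (s-sign : s ≡ 1ℤ ⊎ s ≡ -1ℤ)
        {Bad : Vec (Fin n) l → Set} (bad? : ∀ v → Dec (Bad v))
        (weight≥0 : ∀ v → Admissible A v → ¬ Bad v → ∀ r → 0ℤ ≤ s * (cut v m₀ - cut v r))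
        (weight≡1 : ∀ v → Admissible A v → Good v → ∃ λ r → s * (cut v m₀ - cut v r) ≡ 1ℤ)
        (good⇒¬bad : ∀ v → Good v → ¬ Bad v)
        (few : + c * (∑[ v ∈ V ] adm v * ⟦ bad? v ⟧) ≤ + h * nᵒ)
        where

        open BoxCount h≤n s s-sign
        open Covariance {l} π A m₀-min 2l!h≤n good? bad? weight≥0 weight≡1 good⇒¬bad

        private
          Sₙ = permutations n
          XY = ∑[ σ ∈ Sₙ ] + occurrences π A σ * boxCount σ

          -- The best `t` has order n^(j-2), that is `n ^ o′`. Both `T² n³` and `T n² n^o` are then
          -- `n ^ (2 o + 1)`.
          T W : ℕ
          T = n ℕ.^ o′
          W = n ℕ.^ (2 ℕ.* o ℕ.+ 1)

          many : + h * nᵒ ≤ + E * #good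
          many = begin
            + h * nᵒ                                               ≡⟨ pos-* h (n ℕ.^ o) ⟨
            + (h ℕ.* n ℕ.^ o)                                     ≤⟨ +≤+ ample ⟩
            + (E ℕ.* ((h ℕ.∸ l) ℕ.* w ℕ.^ o))                     ≡⟨ trans (pos-* E _) (cong (+ E *_) (pos-* (h ℕ.∸ l) (w ℕ.^ o))) ⟩
            + E * (+ (h ℕ.∸ l) * + (w ℕ.^ o))                     ≡⟨ cong (λ e → + E * (+ (h ℕ.∸ l) * + (w ℕ.^ e))) (sym ∣∁A∣≡o) ⟩
            + E * (+ (h ℕ.∸ l) * + (w ℕ.^ ∣ ∁ A ∣))               ≤⟨ *-monoˡ-≤-nonNeg (+ E) (∑-good w+l≤u fits) ⟩
            + E * #good                                           ∎
            where open ≤-Reasoning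

          c≡ : + c ≡ + 2 * + E * (+ 2 * + (l !) * + l)
          c≡ = begin
            + c                                        ≡⟨ cong +_ (regroup (q ℕ.^ o) (l !) l) ⟩
            + (2 ℕ.* E ℕ.* (2 ℕ.* l ! ℕ.* l))          ≡⟨ pos-* (2 ℕ.* E) (2 ℕ.* l ! ℕ.* l) ⟩
            + (2 ℕ.* E) * + (2 ℕ.* l ! ℕ.* l)          ≡⟨ cong₂ _*_ (pos-* 2 E) (trans (pos-* (2 ℕ.* l !) l) (cong (_* + l) (pos-* 2 (l !)))) ⟩
            + 2 * + E * (+ 2 * + (l !) * + l)          ∎
            where
            open ≡-Reasoning
            regroup : ∀ r f l → 4 ℕ.* r ℕ.* (2 ℕ.* f ℕ.* l) ≡ 2 ℕ.* (2 ℕ.* r) ℕ.* (2 ℕ.* f ℕ.* l)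
            regroup = ℕ-solve-∀

          d≡ : + d ≡ + 16 * + (l !) * + E * + K * + K
          d≡ = trans (pos-* (16 ℕ.* l ! ℕ.* E ℕ.* K) K) (cong (_* + K) (trans (pos-* (16 ℕ.* l ! ℕ.* E) K) (cong (_* + K)
                 (trans (pos-* (16 ℕ.* l !) E) (cong (_* + E) (pos-* 16 (l !)))))))

          exponent : W ≡ T ℕ.* (n ℕ.* n ℕ.* n ℕ.^ o)
          exponent = trans (cong (n ℕ.^_) (split o′)) (trans (ℕₚ.^-distribˡ-+-* n o′ (2 ℕ.+ o)) (cong (T ℕ.*_) (sym (ℕₚ.*-assoc n n _))))
            where
            split : ∀ o′ → 2 ℕ.* suc o′ ℕ.+ 1 ≡ o′ ℕ.+ (2 ℕ.+ suc o′)
            split = ℕ-solve-∀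

          0≤+ : ∀ m → 0ℤ ≤ + m
          0≤+ m = +≤+ ℕ.z≤n

          core : + (n !) * (+ n * + n * nᵒ) ≤ + 16 * + (l !) * + E * + K * + K * XY
          core = covariance-scale (+ n) (+ h) (+ (n !)) (+ (l !)) (+ E) (+ K) (+ 2 * + (l !) * + l) nᵒ XY #good #bad
            (0≤+ n) (0≤+ h) (0≤+ (n !)) (0≤+ E) (0≤+ K) (0≤+ (n ℕ.^ o))
            covariance-≥ many
            (≤-trans (≤-reflexive (cong (_* #bad) (sym c≡))) few)
            (≤-trans (+≤+ n≤2Kh) (≤-reflexive (trans (pos-* (2 ℕ.* K) h) (cong (_* + h) (pos-* 2 K)))))

          cov : + (n !) * + W ≤ + d * + T * XY
          cov = begin
            + (n !) * + W                                       ≡⟨ cong (λ e → + (n !) * + e) exponent ⟩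
            + (n !) * + (T ℕ.* (n ℕ.* n ℕ.* n ℕ.^ o))           ≡⟨ cong (+ (n !) *_) (trans (pos-* T _) (cong (+ T *_) (trans (pos-* (n ℕ.* n) _) (cong (_* nᵒ) (pos-* n n))))) ⟩
            + (n !) * (+ T * (+ n * + n * nᵒ))                   ≡⟨ swap (+ (n !)) (+ T) _ ⟩
            + T * (+ (n !) * (+ n * + n * nᵒ))                   ≤⟨ *-monoˡ-≤-nonNeg (+ T) core ⟩
            + T * (+ 16 * + (l !) * + E * + K * + K * XY)       ≡⟨ cong (λ e → + T * (e * XY)) d≡ ⟨
            + T * (+ d * XY)                                    ≡⟨ regroup (+ T) (+ d) XY ⟩
            + d * + T * XY                                      ∎
            where
            open ≤-Reasoning
            swap : ∀ a t x → a * (t * x) ≡ t * (a * x)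
            swap = solve-∀
            regroup : ∀ t d x → t * (d * x) ≡ d * t * x
            regroup = solve-∀

          var : + T * + T * (∑[ σ ∈ Sₙ ] boxCount σ * boxCount σ) ≤ + (n !) * + W
          var = begin
            + T * + T * (∑[ σ ∈ Sₙ ] boxCount σ * boxCount σ)
              ≤⟨ *-monoˡ-≤-nonNeg (+ T * + T) {{nonNegative (0≤* (+ T) (+ T) (0≤+ T) (0≤+ T))}} ∑-boxCount² ⟩
            + T * + T * (+ n * (+ (n !) * (+ n * + n)))
              ≡⟨ regroup (+ T) (+ n) (+ (n !)) ⟩
            + (n !) * (+ T * (+ n * + n * (+ n * + T)))
              ≡⟨ cong (λ e → + (n !) * (+ T * e)) (trans (cong₂ _*_ (sym (pos-* n n)) (sym (pos-* n T))) (sym (pos-* (n ℕ.* n) (n ℕ.* T)))) ⟩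
            + (n !) * (+ T * + (n ℕ.* n ℕ.* n ℕ.^ o))
              ≡⟨ cong (+ (n !) *_) (trans (sym (pos-* T _)) (cong +_ (sym exponent))) ⟩
            + (n !) * + W ∎
            where
            open ≤-Reasoning
            regroup : ∀ t n f → t * t * (n * (f * (n * n))) ≡ f * (t * (n * n * (n * t)))
            regroup = solve-∀

        separated : let instance _ = d≢0 in
          (+ 1 / d) ℚ.* (+ 1 / d) ℚ.* fromℕ (n ℕ.^ (2 ℕ.* o ℕ.+ 1)) ℚ.≤ Var {n} (λ σ → fromℕ (occurrences π A σ))
        separated = variance-≥ (occurrences π A) boxCount d T W {{d≢0}} ∑-boxCount cov var

      private
        1-0 : ∀ v r s → toℕ (lookup v r) ℕ.< h → h ℕ.≤ toℕ (lookup v s) → cut v r - cut v s ≡ 1ℤ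
        1-0 v r s r<h h≤s = cong₂ _-_ (⟦⟧-yes (toℕ (lookup v r) ℕₚ.<? h) r<h) (⟦⟧-no (toℕ (lookup v s) ℕₚ.<? h) (ℕₚ.≤⇒≯ h≤s))

        negate : ∀ a b → b - a ≡ -1ℤ * (a - b)
        negate = solve-∀

      growth : let instance _ = d≢0 in
        (+ 1 / d) ℚ.* (+ 1 / d) ℚ.* fromℕ (n ℕ.^ (2 ℕ.* o ℕ.+ 1)) ℚ.≤ Var {n} (λ σ → fromℕ (occurrences π A σ))
      growth = by-cases (any? λ a → (toℕ a ℕₚ.<? toℕ m₀) ×-dec ¬? (a ∈? A))
        where
        by-cases : Dec (∃ λ a → toℕ a ℕ.< toℕ m₀ × a ∉ A) → let instance _ = d≢0 in
          (+ 1 / d) ℚ.* (+ 1 / d) ℚ.* fromℕ (n ℕ.^ (2 ℕ.* o ℕ.+ 1)) ℚ.≤ Var {n} (λ σ → fromℕ (occurrences π A σ))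
        -- The minimum stands in the first block. If any entry is below `h`, so is the first one,
        -- and off `Boundary` the whole first block with it. Hence the indicator at the minimum is
        -- the largest.
        by-cases (no ∄a) = separated 1ℤ (inj₁ refl) boundary? weight≥0 weight≡1 good⇒¬bad few
          where
          below∈A : ∀ a → toℕ a ℕ.< toℕ m₀ → a ∈ A
          below∈A a a<m₀ = decidable-stable (a ∈? A) λ a∉A → ∄a (a , a<m₀ , a∉A)

          m₀-low : ∀ v → Admissible A v → toℕ (lookup v zero) ℕ.+ l ℕ.< h → toℕ (lookup v m₀) ℕ.< h
          m₀-low v v-adm lt = ℕₚ.≤-<-trans (ℕₚ.≤-trans (ℕₚ.≤-reflexive (lookup-firstBlock A v v-adm m₀ below∈A))
            (ℕₚ.+-monoʳ-≤ (toℕ (lookup v zero)) (ℕₚ.<⇒≤ (Finₚ.toℕ<n m₀)))) lt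

          weight≥0 : ∀ v → Admissible A v → ¬ Boundary v → ∀ r → 0ℤ ≤ 1ℤ * (cut v m₀ - cut v r)
          weight≥0 v v-adm ¬boundary r = ≤-trans (i≤j⇒0≤j-i (⟦⟧-mono (toℕ (lookup v r) ℕₚ.<? h) (toℕ (lookup v m₀) ℕₚ.<? h) λ r<h →
              let 0<h = ℕₚ.≤-<-trans (first≤ v v-adm r) r<h in
              m₀-low v v-adm (ℕₚ.≰⇒> λ h≤ → ¬boundary (0<h , h≤))))
            (≤-reflexive (sym (*-identityˡ _)))

          weight≡1 : ∀ v → Admissible A v → Good v → ∃ λ r → 1ℤ * (cut v m₀ - cut v r) ≡ 1ℤ
          weight≡1 v v-adm (lt , high) = suc a₀ , trans (*-identityˡ _) (1-0 v m₀ (suc a₀) (m₀-low v v-adm lt) (high a₀ a₀∉A))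

          good⇒¬bad : ∀ v → Good v → ¬ Boundary v
          good⇒¬bad v (lt , _) (_ , h≤) = ℕₚ.≤⇒≯ h≤ lt

          few : + c * (∑[ v ∈ V ] adm v * ⟦ boundary? v ⟧) ≤ + h * nᵒ
          few = begin
            + c * (∑[ v ∈ V ] adm v * ⟦ boundary? v ⟧)  ≤⟨ *-monoˡ-≤-nonNeg (+ c) ∑-boundary ⟩
            + c * (+ l * + (n ℕ.^ ∣ ∁ A ∣))              ≡⟨ cong (λ e → + c * (+ l * + (n ℕ.^ e))) ∣∁A∣≡o ⟩
            + c * (+ l * nᵒ)                             ≡⟨ *-assoc (+ c) (+ l) nᵒ ⟨
            + c * + l * nᵒ                               ≡⟨ cong (_* nᵒ) (pos-* c l) ⟨
            + (c ℕ.* l) * nᵒ                             ≤⟨ *-monoʳ-≤-nonNeg nᵒ (+≤+ cl≤h) ⟩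
            + h * nᵒ                                     ∎
            where open ≤-Reasoning
        -- A later block starts at `suc a₁`, not after the minimum. If the minimum is below `h`, so
        -- are the first entry and this block start, and `v` is crowded; otherwise the indicator at
        -- the minimum is 0, and the sign -1 makes all weights nonnegative.
        by-cases (yes (a₁ , a₁<m₀ , a₁∉A)) = separated -1ℤ (inj₂ refl) (crowded? a₁) weight≥0 weight≡1 good⇒¬bad few
          where
          weight≥0 : ∀ v → Admissible A v → ¬ Crowded a₁ v → ∀ r → 0ℤ ≤ -1ℤ * (cut v m₀ - cut v r)
          weight≥0 v v-adm ¬crowded r = ≤-trans (i≤j⇒0≤j-i (⟦⟧-mono (toℕ (lookup v m₀) ℕₚ.<? h) (toℕ (lookup v r) ℕₚ.<? h) λ m₀<h →
              contradiction (ℕₚ.≤-<-trans (first≤ v v-adm m₀) m₀<h , ℕₚ.≤-<-trans (lookup-mono {v = v} (proj₁ v-adm) {suc a₁} {m₀} a₁<m₀) m₀<h) ¬crowded))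
            (≤-reflexive (negate (cut v m₀) (cut v r)))

          weight≡1 : ∀ v → Admissible A v → Good v → ∃ λ r → -1ℤ * (cut v m₀ - cut v r) ≡ 1ℤ
          weight≡1 v v-adm (lt , high) = zero , trans (sym (negate (cut v m₀) (cut v zero)))
            (1-0 v zero m₀ (ℕₚ.≤-<-trans (ℕₚ.m≤m+n _ l) lt)
              (ℕₚ.≤-trans (high a₁ a₁∉A) (lookup-mono {v = v} (proj₁ v-adm) {suc a₁} {m₀} a₁<m₀)))

          good⇒¬bad : ∀ v → Good v → ¬ Crowded a₁ v
          good⇒¬bad v (_ , high) (_ , low) = ℕₚ.≤⇒≯ (high a₁ a₁∉A) low

          n≢0 : ℕ.NonZero n
          n≢0 = ℕ.>-nonZero (ℕₚ.<-≤-trans (ℕ.>-nonZero⁻¹ n₀ {{ℕₚ.m*n≢0 (c ℕ.* l) K {{ℕₚ.m*n≢0 c l}}}}) n₀≤n)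

          0<n : ∀ {m} → ℕ.NonZero m → Positive (+ m)
          0<n {suc m} _ = _

          few : + c * (∑[ v ∈ V ] adm v * ⟦ crowded? a₁ v ⟧) ≤ + h * nᵒ
          -- One factor `h` of the crowded count, together with `c`, is absorbed by `c * h ≤ n`.
          few = *-cancelˡ-≤-pos (+ c * #crowded) (+ h * nᵒ) (+ n) {{0<n n≢0}} (begin
            + n * (+ c * #crowded)                          ≡⟨ swap (+ n) (+ c) #crowded ⟩
            + c * (+ n * #crowded)                          ≤⟨ *-monoˡ-≤-nonNeg (+ c) (∑-crowded a₁∉A) ⟩
            + c * (+ h * (+ h * + (n ℕ.^ ∣ ∁ A ∣)))         ≡⟨ cong (λ e → + c * (+ h * (+ h * + (n ℕ.^ e)))) ∣∁A∣≡o ⟩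
            + c * (+ h * (+ h * nᵒ))                        ≡⟨ *-assoc (+ c) (+ h) (+ h * nᵒ) ⟨
            + c * + h * (+ h * nᵒ)                          ≡⟨ cong (_* (+ h * nᵒ)) (pos-* c h) ⟨
            + (c ℕ.* h) * (+ h * nᵒ)                        ≤⟨ *-monoʳ-≤-nonNeg (+ h * nᵒ) {{nonNegative (0≤* (+ h) nᵒ (+≤+ ℕ.z≤n) (+≤+ ℕ.z≤n))}} (+≤+ ch≤n) ⟩
            + n * (+ h * nᵒ)                                ∎)
            where
            open ≤-Reasoning
            #crowded = ∑[ v ∈ V ] adm v * ⟦ crowded? a₁ v ⟧
            swap : ∀ n c x → n * (c * x) ≡ c * (n * x)
            swap = solve-∀

  -- Assembling the two cases

  ∣∁∣-full : ∀ {m} (A : Subset m) → (∀ a → a ∈ A) → ∣ ∁ A ∣ ≡ 0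
  ∣∁∣-full []            full = refl
  ∣∁∣-full (inside ∷ A)  full = ∣∁∣-full A λ a → drop-there (full (suc a))
  ∣∁∣-full (outside ∷ A) full = case full zero of λ ()

  ∣∁∣-suc : ∀ {m} (A : Subset m) {a} → a ∉ A → ∃ λ o → ∣ ∁ A ∣ ≡ suc o
  ∣∁∣-suc (outside ∷ A) a∉A = ∣ ∁ A ∣ , refl
  ∣∁∣-suc (inside ∷ A) {zero}  a∉A = contradiction here a∉A
  ∣∁∣-suc (inside ∷ A) {suc a} a∉A = ∣∁∣-suc A (a∉A ∘ there)

  blocks≡ : ∀ (A : Subset k) → blocks (suc k) A ≡ suc ∣ ∁ A ∣
  blocks≡ A = trans (ℕₚ.+-∸-assoc 1 (∣p∣≤n A)) (cong suc (sym (∣∁p∣≡n∸∣p∣ A)))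

  exponent : ∀ (A : Subset k) → 2 ℕ.* blocks (suc k) A ℕ.∸ 1 ≡ 2 ℕ.* ∣ ∁ A ∣ ℕ.+ 1
  exponent A = trans (cong (λ j → 2 ℕ.* j ℕ.∸ 1) (blocks≡ A)) (odd ∣ ∁ A ∣)
    where
    -- The left side is what `2 * suc o ∸ 1` computes to; the subtraction does not truncate.
    odd : ∀ o → o ℕ.+ 1 ℕ.* suc o ≡ 2 ℕ.* o ℕ.+ 1
    odd = ℕ-solve-∀

  varianceGrowth : (π : Permutation′ (suc (suc k))) (A : Subset (suc k)) →
                   VarianceGrowth π A (2 ℕ.* blocks (suc (suc k)) A ℕ.∸ 1)
  varianceGrowth {k} π A = subst (VarianceGrowth π A) (sym (exponent A)) (by-cases (any? λ a → ¬? (a ∈? A)))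
    where
    by-cases : Dec (∃ λ a → a ∉ A) → VarianceGrowth π A (2 ℕ.* ∣ ∁ A ∣ ℕ.+ 1)
    by-cases (no ∄a) = subst (λ o → VarianceGrowth π A (2 ℕ.* o ℕ.+ 1)) (sym (∣∁∣-full A full)) (consecutive-growth π A full)
      where
      full : ∀ a → a ∈ A
      full a = decidable-stable (a ∈? A) λ a∉A → ∄a (a , a∉A)
    by-cases (yes (a , a∉A)) = let o , ∣∁A∣≡ = ∣∁∣-suc A a∉A in
      subst (λ o → VarianceGrowth π A (2 ℕ.* o ℕ.+ 1)) (sym ∣∁A∣≡)
        (Separated.d (suc k) π A a∉A o ∣∁A∣≡ , Separated.d≢0 (suc k) π A a∉A o ∣∁A∣≡ , _ ,
         λ n n₀≤n → Separated.growth (suc k) π A a∉A o ∣∁A∣≡ n₀≤n)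

  growth⇒bound : (π : Permutation′ k) (A : Subset (ℕ.pred k)) (e : ℕ) → VarianceGrowth π A e →
    Σ[ C ∈ ℚ ] Σ[ n₀ ∈ ℕ ] (0ℚ ℚ.< C ×
      (∀ n → n₀ ℕ.≤ n → C ℚ.* fromℕ (n ℕ.^ e) ℚ.≤ Var {n} (λ σ → fromℕ (occurrences π A σ))))
  growth⇒bound π A e (d , d≢0 , n₀ , bound) =
    q ℚ.* q , n₀ , ℚₚ.positive⁻¹ (q ℚ.* q) {{ℚₚ.pos*pos⇒pos q {{q>0}} q {{q>0}}}} , bound
    where
    instance _ = d≢0
    q = + 1 / d
    q>0 : ℚ.Positive q
    q>0 = ℚ.positive (recip-pos d)

open import Data.Fin.Permutation using (Permutation′)
open import Data.Fin.Subset using (Subset)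
open import Data.Nat.Base using (ℕ; pred; _∸_; _^_) renaming (_≤_ to _≤ℕ_; _*_ to _*ℕ_)
open import Data.Product.Base using (Σ-syntax; _×_)
open import Data.Rational.Base using (ℚ; 0ℚ; _<_; _≥_; _*_)
open import Data.Nat.Base using (suc; zero; s≤s)
open VarianceBound using (varianceGrowth; growth⇒bound)

proposition4p6 : ∀ (k : ℕ) → 2 ≤ℕ k → (π : Permutation′ k) (A : Subset (pred k)) →
    let j = blocks k A in
    Σ[ C ∈ ℚ ] Σ[ n₀ ∈ ℕ ] (0ℚ < C ×
    (∀ (n : ℕ) → n₀ ≤ℕ n →
    Var {n} (λ σ → fromℕ (occurrences π A σ)) ≥ C * fromℕ (n ^ (2 *ℕ j ∸ 1))))
proposition4p6 (suc zero)    (s≤s ()) π A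
proposition4p6 (suc (suc k)) _        π A = growth⇒bound π A (2 *ℕ blocks (suc (suc k)) A ∸ 1) (varianceGrowth π A)
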